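{- Let $k\geq 3$ and let $m_1,\dots,m_{k-1}\geq 1$ and $m_k\geq 2$ be integers. The Euler-genus polynomials of the cubic caterpillar-Halin graphs satisfy $$\mathcal{E}_{m_1,\dots,m_k}(z)=(1+4z)\,\mathcal{E}_{m_1,\dots,m_{k-1},m_k-1}(z)+16z^2\,\mathcal{E}_{m_1,\dots,m_{k-1},m_k-2}(z)+2^{m_k+3}z^2\,\lambda_{m_1,\dots,m_{k-1},m_k-1}(z),$$ with the initial conditions $$\mathcal{E}_{m_1,\dots,m_{k-1},0}(z)=\mathcal{E}_{m_1,\dots,m_{k-2},m_{k-1}+1}(z),\qquad \mathcal{E}_{m_1,\dots,m_{k-1},1}(z)=\mathcal{E}_{m_1,\dots,m_{k-2},m_{k-1}+2}(z).$$
   Context: Euler-genus polynomial. The Euler-genus of a closed surface is $2j$ for the orientable surface with $j$ handles and $c$ for the non-orientable surface with $c$ crosscaps. A pure rotation system of a graph $G$ assigns to every vertex a cyclic permutation of its incident edges; a general rotation system is a pure rotation system together with a map $\tau:E(G)\to\{0,1\}$ (an edge $e$ is twisted if $\tau(e)=1$, untwisted otherwise); it determines a cellular embedding of $G$ in a closed surface. For a fixed spanning tree $T$ of $G$, a $T$-rotation system is a general rotation system with $\tau(e)=0$ for all $e\in E(T)$. Embeddings with equivalent $T$-rotation systems are identified, so the number $\varepsilon_G(i)$ of equivalent embeddings of $G$ into surfaces of Euler-genus $i$ is the number of $T$-rotation systems whose embedding surface has Euler-genus $i$. The Euler-genus polynomial is $\mathcal{E}_G(z)=\sum_{i\ge 0}\varepsilon_G(i)z^i$.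 The graphs $H_{m_1,\dots,m_k}$. Let $k\ge 2$, $m_1,\dots,m_{k-1}\ge 1$ and $m_k\ge 0$. Put $n_1=m_1$, $n_i=m_i+1$ for $1<i<k$, $n_k=m_k$, and $\ell=n_1+\dots+n_k$. Take the path $v_0v_1\cdots v_{\ell+1}$ drawn horizontally and attach to each $v_i$ ($1\le i\le\ell$) a leaf $u_i$; the first $n_1$ of the leaves $u_i$ are drawn above the path, the next $n_2$ below, the next $n_3$ above, and so on alternately. Add a cycle $C$ through all leaves of this tree in their planar order: $v_0$, then the upper leaves $u_i$ in increasing order of index, then $v_{\ell+1}$, then the lower leaves $u_i$ in decreasing order of index. The resulting cubic Halin graph (a cubic caterpillar-Halin graph) is $H_{m_1,\dots,m_k}$. Write $\mathcal{E}_{m_1,\dots,m_k}(z)$ for its Euler-genus polynomial. The polynomials $\lambda$. For $k\ge2$ and $m_1,\dots,m_k\ge 1$, consider symmetric matrices over $\mathbb{Z}_2=\{0,1\}$ of order $k+m_1+\dots+m_k$ whose rows and columns are indexed by symbols $e_i$ ($1\le i\le k$) and $e_{i,l}$ ($1\le i\le k$, $1\le l\le m_i$). A matrix has the form $\Delta_{m_1,\dots,m_k}$ if all its entries vanish except possibly the following (and their transposes), which are arbitrary in $\mathbb{Z}_2$: $(e_i,e_i)=x_i$ and $(e_{i,l},e_{i,l})=x_{i,l}$; $(e_i,e_{i+1})=y_i$ for $1\le i\le k-1$; $(e_{i,l},e_{i,l+1})=y_{i,l}$ for $1\le l\le m_i-1$; $(e_i,e_{i,l})=z_{i,l}$ for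 $1\le l\le m_i$; $(e_i,e_{i-1,m_{i-1}})=z_{i,0}$ for $2\le i\le k$; $(e_i,e_{i+1,1})=z_{i,m_i+1}$ for $1\le i\le k-1$. A matrix has the form $\Lambda_{m_1,\dots,m_k}$ if it has the form $\Delta_{m_1,\dots,m_k}$ and its row and column indexed by $e_k$ are zero. Set $\lambda_{m_1,\dots,m_k}(z)=\sum_j \lambda_{m_1,\dots,m_k}[j]z^j$, where $\lambda_{m_1,\dots,m_k}[j]$ is the number of matrices of the form $\Lambda_{m_1,\dots,m_k}$ of rank $j$. -}

module Defs where

open import Data.Bool.Base using (Bool; true; false; not; if_then_else_; _xor_)
import Data.Bool.Properties as Bool
open import Data.Empty using (⊥)
open import Data.Fin.Base using (Fin; zero; suc; toℕ; fromℕ; inject₁; _↑ˡ_; _↑ʳ_)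
import Data.Fin.Properties as Fin
open import Data.Fin.Subset using (Subset; Nonempty; _∈_; _⊆_; ∣_∣)
open import Data.Fin.Subset.Properties using (_∈?_; _⊆?_; nonempty?; anySubset?)
open import Data.Integer.Base as ℤ using (ℤ; +_; _-_)
import Data.Integer.Properties as ℤ
open import Data.List.Base using
  (List; []; _∷_; [_]; _++_; length; lookup; map; concatMap; zip; reverse;
   filter; deduplicate; iterate; allFin; upTo; replicate; cartesianProduct;
   cartesianProductWith)
open import Data.List.Extrema.Nat using (max)
import Data.List.Membership.DecPropositional as DecMembership
open import Data.List.Relation.Unary.Unique.Propositional using (Unique)
open import Data.Nat.Base using (ℕ; zero; suc; _+_; _*_; _∸_; _≡ᵇ_)
open import Data.Nat.ListAction using (sum)
import Data.Nat.Properties as ℕ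
open import Data.Product.Base using (_×_; _,_; proj₁; proj₂; ∃)
open import Data.Product.Properties using (≡-dec)
open import Data.Sum.Base using (_⊎_)
open import Data.Vec.Base as Vec using (Vec)
import Data.Vec.Properties as Vec
open import Function.Base using (_∘_)
open import Relation.Binary.Definitions using (DecidableEquality)
open import Relation.Binary.PropositionalEquality using (_≡_; _≢_; refl)
open import Relation.Nullary.Decidable using (Dec; yes; no; ¬?; _×-dec_; _⊎-dec_; _→-dec_)
open import Relation.Nullary.Negation.Core using (¬_)

choices : ∀ {A : Set} {n} → Vec (List A) n → List (Vec A n)
choices Vec.[]         = [ Vec.[] ]
choices (xs Vec.∷ xss) = cartesianProductWith Vec._∷_ xs (choices xss)

vectors : ∀ {A : Set} → List A → (n : ℕ) → List (Vec A n)
vectors xs n = choices (Vec.replicate n xs)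

bits : List Bool
bits = false ∷ true ∷ []

insertions : ∀ {A : Set} → A → List A → List (List A)
insertions x []       = [ [ x ] ]
insertions x (y ∷ ys) = (x ∷ y ∷ ys) ∷ map (y ∷_) (insertions x ys)

permutations : ∀ {A : Set} → List A → List (List A)
permutations []       = [ [] ]
permutations (x ∷ xs) = concatMap (insertions x) (permutations xs)

-- The cyclic permutations of a list of distinct elements, in cycle notation;
-- starting every cycle at the head of the list makes the notation unique.
cyclicOrders : ∀ {A : Set} → List A → List (List A)
cyclicOrders []       = [ [] ]
cyclicOrders (x ∷ xs) = map (x ∷_) (permutations xs)

-- (x₁ , x₂) ∷ (x₂ , x₃) ∷ … ∷ (xₙ , x₁) ∷ []
cyclicPairs : ∀ {A : Set} → List A → List (A × A)
cyclicPairs []       = []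
cyclicPairs (x ∷ xs) = zip (x ∷ xs) (xs ++ [ x ])

module _ {A : Set} (_≟_ : DecidableEquality A) where

  apply : List (A × A) → A → A
  apply []             x = x
  apply ((y , z) ∷ ps) x with y ≟ x
  ... | yes _ = z
  ... | no  _ = apply ps x

  -- The permutation written as the cycle xs, and its inverse.
  next prev : List A → A → A
  next xs = apply (cyclicPairs xs)
  prev xs = next (reverse xs)

-- Polynomials in z over ℕ, given by their coefficient sequences.
Poly : Set
Poly = ℕ → ℕ

infixl 6 _⊕_
infixl 7 _⊛_

_⊕_ : Poly → Poly → Poly
(p ⊕ q) n = p n + q n

_⊛_ : Poly → Poly → Poly
(p ⊛ q) n = sum (map (λ i → p i * q (n ∸ i)) (upTo (suc n)))

-- c ·z^ d  is the monomial  c z^d.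
infix 8 _·z^_
_·z^_ : ℕ → ℕ → Poly
(c ·z^ d) n = if n ≡ᵇ d then c else 0

-- nonOrientable c has c + 1 crosscaps.
data ClosedSurface : Set where
  orientable    : (j : ℕ) → ClosedSurface
  nonOrientable : (c : ℕ) → ClosedSurface

eulerGenus : ClosedSurface → ℕ
eulerGenus (orientable j)    = 2 * j
eulerGenus (nonOrientable c) = suc c

-- The characteristic 2 of the sphere drops by 2 for every handle and by 1 for
-- every crosscap.
eulerCharacteristic : ClosedSurface → ℤ
eulerCharacteristic (orientable j)    = + 2 - + (2 * j)
eulerCharacteristic (nonOrientable c) = + 2 - + suc c

characteristic-genus : ∀ S → eulerCharacteristic S ≡ + 2 - + eulerGenus S
characteristic-genus (orientable j)    = refl
characteristic-genus (nonOrientable c) = refl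

-- A finite graph, possibly with loops and multiple edges; the order in which
-- the ends of an edge are listed is immaterial.
record Graph : Set where
  field
    order : ℕ
    edges : List (Fin order × Fin order)

  size : ℕ
  size = length edges

  Vertex Edge Dart : Set
  Vertex = Fin order
  Edge   = Fin size
  -- A dart is an edge together with one of its two ends.
  Dart   = Edge × Bool

  _≟ᴰ_ : DecidableEquality Dart
  _≟ᴰ_ = ≡-dec Fin._≟_ Bool._≟_

  darts : List Dart
  darts = cartesianProduct (allFin size) bits

  source : Dart → Vertex
  source (e , false) = proj₁ (lookup edges e)
  source (e , true)  = proj₂ (lookup edges e)

  opposite : Dart → Dart
  opposite (e , b) = e , not b

  target : Dart → Vertex
  target = source ∘ opposite

  incident : Vertex → List Dart
  incident v = filter (λ d → source d Fin.≟ v) darts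

  -- Walk T u ds v: the darts ds form a walk from u to v along edges in T.
  data Walk (T : Subset size) : Vertex → List Dart → Vertex → Set where
    []  : ∀ {v} → Walk T v [] v
    _∷_ : ∀ {d ds v} → proj₁ d ∈ T → Walk T (target d) ds v →
          Walk T (source d) (d ∷ ds) v

  Connected : Subset size → Set
  Connected T = ∀ u v → ∃ λ ds → Walk T u ds v

  -- Distinctness of the edges excludes traversing one edge back and forth.
  IsCycle : Subset size → Vertex → List Dart → Set
  IsCycle T v ds = ds ≢ [] × Walk T v ds v ×
                   Unique (map source ds) × Unique (map proj₁ ds)

  Acyclic : Subset size → Set
  Acyclic T = ∀ v ds → ¬ IsCycle T v ds

record SpanningTree (G : Graph) : Set where
  open Graph G
  field
    treeEdges : Subset size
    connected : Connected treeEdges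
    acyclic   : Acyclic treeEdges

module _ (G : Graph) where
  open Graph G

  -- The rotation at v is a cycle on the darts leaving v; twist is τ, with
  -- true for a twisted edge.
  record RotationSystem : Set where
    constructor rotationSystem
    field
      rotation : Vec (List Dart) order
      twist    : Vec Bool size

  pureRotations : List (Vec (List Dart) order)
  pureRotations = choices (Vec.tabulate (cyclicOrders ∘ incident))

  generalRotationSystems : List RotationSystem
  generalRotationSystems =
    cartesianProductWith rotationSystem pureRotations (vectors bits size)

  IsTRotationSystem : SpanningTree G → RotationSystem → Set
  IsTRotationSystem T R = ∀ e → e ∈ treeEdges → Vec.lookup twist e ≡ false
    where
    open SpanningTree T
    open RotationSystem R

  isTRotationSystem? : ∀ T R → Dec (IsTRotationSystem T R)
  isTRotationSystem? T R =
    Fin.all? λ e → (e ∈? treeEdges) →-dec (Vec.lookup twist e Bool.≟ false)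
    where
    open SpanningTree T
    open RotationSystem R

  -- A flag (d , s) is a side of a dart: with s = true the side facing the dart
  -- after d in the rotation at source d, with s = false the one facing the dart
  -- before it.
  Flag : Set
  Flag = Dart × Bool

  _≟ᶠ_ : DecidableEquality Flag
  _≟ᶠ_ = ≡-dec _≟ᴰ_ Bool._≟_

  open DecMembership _≟ᶠ_ using () renaming (_∈_ to _∈ᶠ_; _∈?_ to _∈ᶠ?_)

  flags : List Flag
  flags = cartesianProduct darts bits

  module _ (R : RotationSystem) where
    open RotationSystem R

    -- The two flags on the same side of an edge.  Along an untwisted edge the
    -- local orientations at its ends agree, so that the left of a dart is the
    -- right of the opposite dart; a twist exchanges the sides.
    alongEdge : Flag → Flag
    alongEdge (d , s) = opposite d , not (s xor Vec.lookup twist (proj₁ d))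

    -- The two flags facing each other in a corner.
    acrossCorner : Flag → Flag
    acrossCorner (d , true)  = next _≟ᴰ_ (Vec.lookup rotation (source d)) d , false
    acrossCorner (d , false) = prev _≟ᴰ_ (Vec.lookup rotation (source d)) d , true

    -- The boundary walk of a face, starting along a given flag; it is closed
    -- within the number of all flags.
    boundary : Flag → List Flag
    boundary x = iterate (acrossCorner ∘ alongEdge) x (length flags)

    -- A boundary walk meets only one of the two flags on each side of an edge.
    SameFace : Flag → Flag → Set
    SameFace x y = y ∈ᶠ boundary x ⊎ alongEdge y ∈ᶠ boundary x

    sameFace? : ∀ x y → Dec (SameFace x y)
    sameFace? x y = (y ∈ᶠ? boundary x) ⊎-dec (alongEdge y ∈ᶠ? boundary x)

    faceCount : ℕ
    faceCount = length (deduplicate sameFace? flags)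

    -- For a connected graph with at least one edge; the face of an embedded
    -- isolated vertex contains no flag.
    embeddingCharacteristic : ℤ
    embeddingCharacteristic = + order - + size ℤ.+ + faceCount

    -- By characteristic-genus, the Euler-genus of the embedding surface is
    -- determined by its Euler characteristic, whether or not it is orientable.
    HasEulerGenus : ℕ → Set
    HasEulerGenus i = embeddingCharacteristic ≡ + 2 - + i

    hasEulerGenus? : ∀ i → Dec (HasEulerGenus i)
    hasEulerGenus? i = embeddingCharacteristic ℤ.≟ (+ 2 - + i)

-- The Euler-genus polynomial of G, for a spanning tree T of G.
ℰ : (G : Graph) → SpanningTree G → Poly
ℰ G T i = length (filter (λ R → hasEulerGenus? G R i)
                 (filter (isTRotationSystem? G T) (generalRotationSystems G)))

data Side : Set where
  above below : Side

_≟ˢ_ : DecidableEquality Side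
above ≟ˢ above = yes refl
above ≟ˢ below = no λ ()
below ≟ˢ above = no λ ()
below ≟ˢ below = yes refl

flip : Side → Side
flip above = below
flip below = above

-- m₁ , m₂ , … , mₖ₋₁ , mₖ  ↦  m₁ , m₂ + 1 , … , mₖ₋₁ + 1 , mₖ
leafCounts : List ℕ → List ℕ
leafCounts []       = []
leafCounts (m ∷ ms) = m ∷ rest ms
  where
  rest : List ℕ → List ℕ
  rest []            = []
  rest (m ∷ [])      = m ∷ []
  rest (m ∷ m′ ∷ ms) = suc m ∷ rest (m′ ∷ ms)

alternate : Side → List ℕ → List Side
alternate s []       = []
alternate s (n ∷ ns) = replicate n s ++ alternate (flip s) ns

module Caterpillar (sides : List Side) where

  ℓ : ℕ
  ℓ = length sides

  order : ℕ
  order = (2 + ℓ) + ℓ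

  v : Fin (2 + ℓ) → Fin order
  v i = i ↑ˡ ℓ

  -- The leaf u i is attached to v (suc (inject₁ i)).
  u : Fin ℓ → Fin order
  u i = (2 + ℓ) ↑ʳ i

  path : List (Fin order × Fin order)
  path = map (λ i → v (inject₁ i) , v (suc i)) (allFin (1 + ℓ))

  spokes : List (Fin order × Fin order)
  spokes = map (λ i → v (suc (inject₁ i)) , u i) (allFin ℓ)

  leaves : Side → List (Fin order)
  leaves s = map u (filter (λ i → lookup sides i ≟ˢ s) (allFin ℓ))

  cycle : List (Fin order × Fin order)
  cycle = cyclicPairs
    (v zero ∷ leaves above ++ v (fromℕ (1 + ℓ)) ∷ reverse (leaves below))

  halin : Graph
  halin = record { order = order ; edges = path ++ spokes ++ cycle }

H : List ℕ → Graph
H ms = Caterpillar.halin (alternate above (leafCounts ms))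

-- Matrices over ℤ₂, which is Bool with addition _xor_.
Matrix : ℕ → Set
Matrix n = Vec (Vec Bool n) n

entry : ∀ {n} → Matrix n → Fin n → Fin n → Bool
entry M p q = Vec.lookup (Vec.lookup M p) q

zeroRow : ∀ {n} → Vec Bool n
zeroRow = Vec.replicate _ false

-- The linear combinations of rows are the sums of the rows in a subset.
rowSum : ∀ {m n} → Vec (Vec Bool n) m → Subset m → Vec Bool n
rowSum Vec.[]       Vec.[]       = zeroRow
rowSum (r Vec.∷ rs) (c Vec.∷ cs) =
  if c then Vec.zipWith _xor_ r (rowSum rs cs) else rowSum rs cs

-- The rows in S are independent: no nontrivial combination of them is zero.
Independent : ∀ {n} → Matrix n → Subset n → Set
Independent M S = ¬ ∃ λ C → C ⊆ S × Nonempty C × rowSum M C ≡ zeroRow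

independent? : ∀ {n} (M : Matrix n) S → Dec (Independent M S)
independent? M S = ¬? (anySubset? λ C →
  (C ⊆? S) ×-dec nonempty? C ×-dec Vec.≡-dec Bool._≟_ (rowSum M C) zeroRow)

-- The maximal number of independent rows.
rank : ∀ {n} → Matrix n → ℕ
rank {n} M = max 0 (map ∣_∣ (filter (independent? M) (vectors bits n)))

module _ (ms : List ℕ) where

  private
    k : ℕ
    k = length ms

  -- All indices count from 0: e i is e_{i+1} and e′ i l is e_{i+1,l+1}.
  data Index : Set where
    e  : (i : Fin k) → Index
    e′ : (i : Fin k) (l : Fin (lookup ms i)) → Index

  indices : List Index
  indices = map e (allFin k) ++
            concatMap (λ i → map (e′ i) (allFin (lookup ms i))) (allFin k)

  dim : ℕ
  dim = length indices

  -- The entries that may be nonzero in the form Δ, transposes excluded.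
  Supported : Index → Index → Set
  Supported (e i) (e j) =
      (j ≡ i)                                                 -- xᵢ
    ⊎ (toℕ j ≡ suc (toℕ i))                                   -- yᵢ
  Supported (e i) (e′ j l) =
      (j ≡ i)                                                 -- zᵢ,ₗ
    ⊎ (suc (toℕ j) ≡ toℕ i × suc (toℕ l) ≡ lookup ms j)       -- zᵢ,₀
    ⊎ (toℕ j ≡ suc (toℕ i) × toℕ l ≡ 0)                       -- zᵢ,ₘᵢ₊₁
  Supported (e′ i l) (e′ j l′) =
    (j ≡ i) × (  (toℕ l′ ≡ toℕ l)                             -- xᵢ,ₗ
               ⊎ (toℕ l′ ≡ suc (toℕ l)))                      -- yᵢ,ₗ
  Supported (e′ _ _) (e _) = ⊥

  supported? : ∀ a b → Dec (Supported a b)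
  supported? (e i)    (e j)     = (j Fin.≟ i) ⊎-dec (toℕ j ℕ.≟ suc (toℕ i))
  supported? (e i)    (e′ j l)  =
    (j Fin.≟ i)
    ⊎-dec ((suc (toℕ j) ℕ.≟ toℕ i) ×-dec (suc (toℕ l) ℕ.≟ lookup ms j))
    ⊎-dec ((toℕ j ℕ.≟ suc (toℕ i)) ×-dec (toℕ l ℕ.≟ 0))
  supported? (e′ i l) (e′ j l′) =
    (j Fin.≟ i) ×-dec ((toℕ l′ ℕ.≟ toℕ l) ⊎-dec (toℕ l′ ℕ.≟ suc (toℕ l)))
  supported? (e′ _ _) (e _)     = no λ ()

  -- The index eₖ.
  IsLast : Index → Set
  IsLast (e i)    = suc (toℕ i) ≡ k
  IsLast (e′ _ _) = ⊥

  isLast? : ∀ a → Dec (IsLast a)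
  isLast? (e i)    = suc (toℕ i) ℕ.≟ k
  isLast? (e′ _ _) = no λ ()

  module _ (M : Matrix dim) where

    HasFormΔ : Set
    HasFormΔ = ∀ p q →
      entry M p q ≡ entry M q p ×
      (entry M p q ≡ true →
       Supported (lookup indices p) (lookup indices q) ⊎
       Supported (lookup indices q) (lookup indices p))

    HasFormΛ : Set
    HasFormΛ = HasFormΔ ×
      (∀ p q → IsLast (lookup indices p) →
       entry M p q ≡ false × entry M q p ≡ false)

    hasFormΔ? : Dec HasFormΔ
    hasFormΔ? = Fin.all? λ p → Fin.all? λ q →
      (entry M p q Bool.≟ entry M q p) ×-dec
      ((entry M p q Bool.≟ true) →-dec
       (supported? (lookup indices p) (lookup indices q) ⊎-dec
        supported? (lookup indices q) (lookup indices p)))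

    hasFormΛ? : Dec HasFormΛ
    hasFormΛ? = hasFormΔ? ×-dec
      (Fin.all? λ p → Fin.all? λ q → isLast? (lookup indices p) →-dec
       ((entry M p q Bool.≟ false) ×-dec (entry M q p Bool.≟ false)))

  λ-poly : Poly
  λ-poly j = length (filter (λ M → rank M ℕ.≟ j)
                    (filter hasFormΛ? (vectors (vectors bits dim) dim)))

{-# OPTIONS --safe #-}

-- Reversing the rotation at a vertex and twisting the three edges there does not change the faces.  Hence
-- every T-rotation system of a cubic graph amounts to a twist assignment σ of one fixed rotation system, and
-- every σ arises from exactly two T-rotation systems, whatever the tree T.  For the planar rotation of a Halin
-- graph, the ℤ₂-valued functions on the flags that are constant on the faces of the twisted embedding
-- correspond two-to-one to the kernel of the Laplacian of the dual graph with weights σ, grounded at the outer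
-- face.  So the Euler-genus is the rank of a symmetric matrix over ℤ₂ with arbitrary entries on the edges and
-- the diagonal of a triangulated polygon.  Let w be its last vertex, p the vertex before w in the last fan and
-- eₖ the centre of that fan.  If (w,w) ≠ 0, or if (w,w) = 0 and (w,p) ≠ 0, eliminating w, or w and p, leaves an
-- arbitrary matrix of the same kind; these cases give 4z and 16z².  If the row of w vanishes, w can be dropped.
-- If only (w,eₖ) survives, eliminating w and eₖ deletes eₖ and leaves a matrix of the form Λ.

module Submission where

open import Defs
open import Algebra.Bundles using (AbelianGroup; CommutativeRing)
import Algebra.Properties.CommutativeSemigroup as CommutativeSemigroup
import Algebra.Properties.CommutativeMonoid.Sum as MonoidSum
import Algebra.Properties.Group as GroupProperties
open import Axiom.UniquenessOfIdentityProofs.WithK using (uip)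
open import Data.Bool.Base using (Bool; true; false; not; if_then_else_; _xor_; _∧_)
import Data.Bool.Properties as Bool
open import Data.Empty using (⊥; ⊥-elim)
open import Data.Fin.Base as Fin using (Fin; zero; suc; toℕ; fromℕ; inject₁)
import Data.Fin.Properties as Fin
open import Data.Fin.Permutation using (Permutation; ↔⇒≡)
open import Data.Fin.Subset using (Subset; ∣_∣; _⊆_) renaming (_∈_ to _∈ˢ_)
open import Data.Fin.Subset.Properties using (anySubset?; nonempty?; _⊆?_)
import Data.Integer.Base as ℤ
import Data.Integer.Properties as ℤₚ
import Data.Integer.Solver as ℤSolver
open import Data.List.Base as List using
  (List; []; _∷_; [_]; _++_; length; lookup; map; concatMap; zip; reverse; filter;
   deduplicate; iterate; allFin; upTo; replicate; cartesianProduct; cartesianProductWith)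
import Data.List.Properties as List
open import Data.List.Membership.Propositional using (_∈_; find)
import Data.List.Membership.Propositional.Properties as Membership
open import Data.List.Relation.Unary.All as All using (All; []; _∷_)
import Data.List.Relation.Unary.All.Properties as All
open import Data.List.Relation.Unary.AllPairs as AllPairs using (AllPairs; []; _∷_)
import Data.List.Relation.Unary.AllPairs.Properties as AllPairs
open import Data.List.Relation.Unary.Any as Any using (Any; here; there)
import Data.List.Relation.Unary.Any.Properties as Any
open import Data.List.Relation.Unary.Unique.Propositional using (Unique)
import Data.List.Relation.Unary.Unique.Propositional.Properties as Unique
open import Data.List.Extrema.Nat using (xs≤max; argmax-sel)
open import Data.Nat.ListAction using (sum)
open import Data.Nat.Base as ℕ using (ℕ; zero; suc; _+_; _*_; _∸_; _^_; _≤_; _<_; z≤n; s≤s)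
import Data.Nat.Properties as ℕ
import Data.Nat.Solver as ℕSolver
open import Data.Product.Base using (Σ; ∃; _×_; _,_; proj₁; proj₂)
open import Data.Sum.Base as Sum using (_⊎_; inj₁; inj₂)
open import Data.Unit.Base using (⊤; tt)
open import Data.Vec.Base as Vec using (Vec; []; _∷_)
import Data.Vec.Properties as Vec
open import Function.Base using (_∘_; id)
open import Function.Bundles using (Inverse)
import Function.Construct.Composition as Composition
import Function.Construct.Symmetry as Symmetry
open import Level using (0ℓ)
open import Relation.Binary.Bundles using (Setoid)
open import Relation.Binary.Definitions using (DecidableEquality)
open import Relation.Binary.PropositionalEquality hiding ([_])
open import Relation.Nullary.Decidable using (Dec; yes; no; does; ¬?; _×-dec_; dec-true; dec-false)
open import Relation.Nullary.Negation using (¬_; contradiction)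
open import Relation.Unary using (Pred; Decidable)
open import Data.Fin.Patterns using (0F; 1F; 2F)
import Data.Fin.Permutation as Perm
open import Data.List.Relation.Binary.Permutation.Propositional as ↭ using (_↭_; ↭-prep; ↭-trans; ↭-reflexive)
import Data.List.Relation.Binary.Permutation.Propositional.Properties as ↭

-- Identities over Bool are proved by evaluating them at all arguments.

-- Let `h` be constant on the faces of the twisted embedding. The difference of its values on the
-- two sides of a dart is the same at both ends of the edge, and around a vertex the differences sum
-- to zero. By planarity they form the coboundary of a function on the planar faces that vanishes on
-- the outer one. Along a planar face `h` jumps by this difference at every twisted edge and nowhere
-- else, so returning to its initial value is the Laplacian equation of the face. Complementing `h`
-- explains the two-to-one. No matrix is row-reduced. Kernel vectors are counted by a sweep along
-- the path with only two faces open at a time, so each elimination at the right end is an identity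
-- in boundedly many bits, decided by evaluation. Genus and rank occur only as exponents in
-- equations between powers of two, which avoids subtraction. The 4 counts the values of the two
-- free entries in the pivot row of w. The 16 counts those of (w,eₖ) and of the three entries of p
-- not involving w. Finally, 2^(mₖ+3) is twice the number of values of the row of eₖ, which has mₖ +
-- 2 entries after w has gone.

Fn : ℕ → Set → Set
Fn zero    A = A
Fn (suc n) A = Bool → Fn n A

Everywhere : ∀ {A : Set} n → Fn n Bool → (f g : Fn n A) → Set
Everywhere zero    h f g = h ≡ true → f ≡ g
Everywhere (suc n) h f g = ∀ x → Everywhere n (h x) (f x) (g x)

module _ {A : Set} (_≟_ : DecidableEquality A) where

  agree : ∀ n → Fn n Bool → (f g : Fn n A) → Bool
  agree zero    h f g = if h then does (f ≟ g) else true
  agree (suc n) h f g = agree n (h false) (f false) (g false) ∧ agree n (h true) (f true) (g true)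

  exhaust : ∀ n h f g → agree n h f g ≡ true → Everywhere n h f g
  exhaust zero h f g ok refl with f ≟ g
  ... | yes f≡g = f≡g
  exhaust (suc n) h f g ok false = exhaust n _ _ _ (Bool.∧-conicalˡ _ _ ok)
  exhaust (suc n) h f g ok true  = exhaust n _ _ _ (Bool.∧-conicalʳ _ _ ok)

  always : ∀ n → Fn n Bool
  always zero    = true
  always (suc n) = λ _ → always n

-- It unfolds to plain pointwise equality. Statements like `W ≋ W′` with Boolean parameters are
-- therefore definitional instances, and one `refl` that evaluates `agree` proves them.
Identity : ∀ {A : Set} n → (f g : Fn n A) → Set
Identity zero    f g = f ≡ g
Identity (suc n) f g = ∀ x → Identity n (f x) (g x)

exhaust′ : ∀ {A : Set} (_≟_ : DecidableEquality A) n f g → agree _≟_ n (always _≟_ n) f g ≡ true →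
           Identity n f g
exhaust′ _≟_ zero f g ok = exhaust _≟_ zero true f g ok refl
exhaust′ _≟_ (suc n) f g ok false = exhaust′ _≟_ n _ _ (Bool.∧-conicalˡ _ _ ok)
exhaust′ _≟_ (suc n) f g ok true  = exhaust′ _≟_ n _ _ (Bool.∧-conicalʳ _ _ ok)

boolean : ∀ n (f g : Fn n Bool) → agree Bool._≟_ n (always Bool._≟_ n) f g ≡ true → Identity n f g
boolean = exhaust′ Bool._≟_

booleanIf : ∀ n h (f g : Fn n Bool) → agree Bool._≟_ n h f g ≡ true → Everywhere n h f g
booleanIf = exhaust Bool._≟_

infix 4 _⇔ᵇ_
_⇔ᵇ_ : Bool → Bool → Bool
x ⇔ᵇ y = not (x xor y)

⇔ᵇ-refl : ∀ {x y} → x ≡ y → (x ⇔ᵇ y) ≡ true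
⇔ᵇ-refl {false} refl = refl
⇔ᵇ-refl {true}  refl = refl

⇔ᵇ-sound : ∀ x y → (x ⇔ᵇ y) ≡ true → x ≡ y
⇔ᵇ-sound = booleanIf 2 _⇔ᵇ_ (λ x y → x) (λ x y → y) refl

∧-intro : ∀ {x y} → x ≡ true → y ≡ true → x ∧ y ≡ true
∧-intro refl refl = refl

-- Counting

⟦_⟧ : Bool → ℕ
⟦ false ⟧ = 0
⟦ true ⟧  = 1

count : ∀ {A : Set} {P : Pred A 0ℓ} → Decidable P → List A → ℕ
count P? xs = length (filter P? xs)

lookup-injective : ∀ {A : Set} {xs : List A} → Unique xs → ∀ {i j} → lookup xs i ≡ lookup xs j → i ≡ j
lookup-injective (x∉ ∷ xs!) {zero}  {zero}  eq = refl
lookup-injective (x∉ ∷ xs!) {zero}  {suc j} eq =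
  contradiction eq (All.lookup x∉ (Membership.∈-lookup j))
lookup-injective (x∉ ∷ xs!) {suc i} {zero}  eq =
  contradiction (sym eq) (All.lookup x∉ (Membership.∈-lookup i))
lookup-injective (x∉ ∷ xs!) {suc i} {suc j} eq = cong suc (lookup-injective xs! eq)

length-injection : ∀ {A B : Set} {xs : List A} {ys : List B} → Unique xs → (f : A → B) →
  (∀ {x} → x ∈ xs → f x ∈ ys) → (∀ {x y} → x ∈ xs → y ∈ xs → f x ≡ f y → x ≡ y) →
  length xs ≤ length ys
length-injection {xs = xs} {ys} xs! f f∈ inj = Fin.injective⇒≤ {f = position} λ {i} {j} eq →
  lookup-injective xs! (inj (∈xs i) (∈xs j)
    (trans (Any.lookup-index (f∈ (∈xs i))) (trans (cong (lookup ys) eq) (sym (Any.lookup-index (f∈ (∈xs j)))))))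
  where
  ∈xs : ∀ i → lookup xs i ∈ xs
  ∈xs i = Membership.∈-lookup i
  position : Fin (length xs) → Fin (length ys)
  position i = Any.index (f∈ (∈xs i))

length-bijection : ∀ {A B : Set} {xs : List A} {ys : List B} → Unique xs → Unique ys →
  (f : A → B) (g : B → A) →
  (∀ {x} → x ∈ xs → f x ∈ ys) → (∀ {y} → y ∈ ys → g y ∈ xs) →
  (∀ {x} → x ∈ xs → g (f x) ≡ x) → (∀ {y} → y ∈ ys → f (g y) ≡ y) →
  length xs ≡ length ys
length-bijection xs! ys! f g f∈ g∈ gf fg = ℕ.≤-antisym
  (length-injection xs! f f∈ λ x∈ y∈ eq → trans (sym (gf x∈)) (trans (cong g eq) (gf y∈)))
  (length-injection ys! g g∈ λ x∈ y∈ eq → trans (sym (fg x∈)) (trans (cong f eq) (fg y∈)))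

module _ {A B : Set} {P : Pred A 0ℓ} (P? : Decidable P) {Q : Pred B 0ℓ} (Q? : Decidable Q) where

  -- The maps have to be mutually inverse only on the elements counted, so that partial codings,
  -- such as that of matrices by their slots, can be given as total functions.
  count-bijection : ∀ {xs ys} → Unique xs → Unique ys → (f : A → B) (g : B → A) →
    (∀ {x} → x ∈ xs → P x → f x ∈ ys × Q (f x)) → (∀ {y} → y ∈ ys → Q y → g y ∈ xs × P (g y)) →
    (∀ {x} → x ∈ xs → P x → g (f x) ≡ x) → (∀ {y} → y ∈ ys → Q y → f (g y) ≡ y) →
    count P? xs ≡ count Q? ys
  count-bijection {xs} {ys} xs! ys! f g f∈ g∈ gf fg = length-bijection
    (Unique.filter⁺ P? xs!) (Unique.filter⁺ Q? ys!) f g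
    (λ x∈ → let x∈xs , px = in-filter P? x∈ ; a , b = f∈ x∈xs px in Membership.∈-filter⁺ Q? a b)
    (λ y∈ → let y∈ys , qy = in-filter Q? y∈ ; a , b = g∈ y∈ys qy in Membership.∈-filter⁺ P? a b)
    (λ x∈ → let x∈xs , px = in-filter P? x∈ in gf x∈xs px)
    (λ y∈ → let y∈ys , qy = in-filter Q? y∈ in fg y∈ys qy)
    where
    in-filter : ∀ {C : Set} {R : Pred C 0ℓ} (R? : Decidable R) {zs z} → z ∈ filter R? zs → z ∈ zs × R z
    in-filter R? = Membership.∈-filter⁻ R?

count-++ : ∀ {A : Set} {P : Pred A 0ℓ} (P? : Decidable P) xs ys →
           count P? (xs ++ ys) ≡ count P? xs + count P? ys
count-++ P? xs ys = trans (cong length (List.filter-++ P? xs ys)) (List.length-++ (filter P? xs))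

count-map : ∀ {A B : Set} {P : Pred B 0ℓ} (P? : Decidable P) (f : A → B) xs →
            count P? (map f xs) ≡ count (P? ∘ f) xs
count-map P? f []       = refl
count-map P? f (x ∷ xs) with does (P? (f x))
... | true  = cong suc (count-map P? f xs)
... | false = count-map P? f xs

∑ᵇ : (Bool → ℕ) → ℕ
∑ᵇ F = F false + F true

∑ⱽ : ∀ n → (Vec Bool n → ℕ) → ℕ
∑ⱽ zero    F = F []
∑ⱽ (suc n) F = ∑ᵇ λ b → ∑ⱽ n λ σ → F (b ∷ σ)

∑ᵇ-cong : ∀ {F G : Bool → ℕ} → (∀ b → F b ≡ G b) → ∑ᵇ F ≡ ∑ᵇ G
∑ᵇ-cong eq = cong₂ _+_ (eq false) (eq true)

∑ⱽ-cong : ∀ n {F G : Vec Bool n → ℕ} → (∀ σ → F σ ≡ G σ) → ∑ⱽ n F ≡ ∑ⱽ n G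
∑ⱽ-cong zero    eq = eq []
∑ⱽ-cong (suc n) eq = ∑ᵇ-cong λ b → ∑ⱽ-cong n λ σ → eq (b ∷ σ)

∑ᵇ-xor : ∀ k (F : Bool → ℕ) → ∑ᵇ (λ b → F (b xor k)) ≡ ∑ᵇ F
∑ᵇ-xor false F = refl
∑ᵇ-xor true  F = ℕ.+-comm (F true) (F false)

∑ᵇ-+ : ∀ F G → ∑ᵇ (λ b → F b + G b) ≡ ∑ᵇ F + ∑ᵇ G
∑ᵇ-+ F G = CommutativeSemigroup.interchange ℕ.+-commutativeSemigroup (F false) (G false) (F true) (G true)

∑ⱽ-+ : ∀ n F G → ∑ⱽ n (λ σ → F σ + G σ) ≡ ∑ⱽ n F + ∑ⱽ n G
∑ⱽ-+ zero    F G = refl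
∑ⱽ-+ (suc n) F G = trans (∑ᵇ-cong λ b → ∑ⱽ-+ n (F ∘ (b ∷_)) (G ∘ (b ∷_)))
                         (∑ᵇ-+ (λ b → ∑ⱽ n (F ∘ (b ∷_))) (λ b → ∑ⱽ n (G ∘ (b ∷_))))

∑ⱽ-* : ∀ n c F → ∑ⱽ n (λ σ → c * F σ) ≡ c * ∑ⱽ n F
∑ⱽ-* zero    c F = refl
∑ⱽ-* (suc n) c F = trans (∑ᵇ-cong λ b → ∑ⱽ-* n c (F ∘ (b ∷_)))
                         (sym (ℕ.*-distribˡ-+ c (∑ⱽ n (F ∘ (false ∷_))) (∑ⱽ n (F ∘ (true ∷_)))))

∑ⱽ-zero : ∀ n {F} → (∀ σ → F σ ≡ 0) → ∑ⱽ n F ≡ 0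
∑ⱽ-zero n {F} eq = trans (∑ⱽ-cong n eq) (∑ⱽ-* n 0 F)

count-vectors : ∀ n {P : Pred (Vec Bool n) 0ℓ} (P? : Decidable P) →
                count P? (vectors bits n) ≡ ∑ⱽ n (λ σ → ⟦ does (P? σ) ⟧)
count-vectors zero P? with does (P? [])
... | true  = refl
... | false = refl
count-vectors (suc n) P? = begin
  count P? (map (false ∷_) vs ++ map (true ∷_) vs ++ [])
    ≡⟨ count-++ P? (map (false ∷_) vs) _ ⟩
  count P? (map (false ∷_) vs) + count P? (map (true ∷_) vs ++ [])
    ≡⟨ cong (λ ws → count P? (map (false ∷_) vs) + count P? ws) (List.++-identityʳ (map (true ∷_) vs)) ⟩
  count P? (map (false ∷_) vs) + count P? (map (true ∷_) vs)
    ≡⟨ cong₂ _+_ (part false) (part true) ⟩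
  ∑ⱽ (suc n) (λ σ → ⟦ does (P? σ) ⟧) ∎
  where
  open ≡-Reasoning
  vs = vectors bits n
  part : ∀ b → count P? (map (b ∷_) vs) ≡ ∑ⱽ n (λ σ → ⟦ does (P? (b ∷ σ)) ⟧)
  part b = trans (count-map P? (b ∷_) vs) (count-vectors n (P? ∘ (b ∷_)))

-- Enumerations

vectors-unique : ∀ {A : Set} {xs : List A} → Unique xs → ∀ n → Unique (vectors xs n)
vectors-unique xs! zero    = [] ∷ []
vectors-unique xs! (suc n) =
  Unique.cartesianProductWith⁺ _∷_ (λ eq → Vec.∷-injective eq) xs! (vectors-unique xs! n)

∈-choices : ∀ {A : Set} {n} (xss : Vec (List A) n) (v : Vec A n) →
            (∀ i → Vec.lookup v i ∈ Vec.lookup xss i) → v ∈ choices xss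
∈-choices []         []      v∈ = here refl
∈-choices (xs ∷ xss) (x ∷ v) v∈ =
  Membership.∈-cartesianProductWith⁺ _∷_ (v∈ zero) (∈-choices xss v (v∈ ∘ suc))

∈-choices⁻ : ∀ {A : Set} {n} (xss : Vec (List A) n) {v : Vec A n} →
             v ∈ choices xss → ∀ i → Vec.lookup v i ∈ Vec.lookup xss i
∈-choices⁻ (xs ∷ xss) v∈ i with Membership.∈-cartesianProductWith⁻ _∷_ xs (choices xss) v∈
∈-choices⁻ (xs ∷ xss) v∈ zero    | x , w , x∈ , w∈ , refl = x∈
∈-choices⁻ (xs ∷ xss) v∈ (suc i) | x , w , x∈ , w∈ , refl = ∈-choices⁻ xss w∈ i

choices-unique : ∀ {A : Set} {n} (xss : Vec (List A) n) → (∀ i → Unique (Vec.lookup xss i)) →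
                 Unique (choices xss)
choices-unique []         xss! = [] ∷ []
choices-unique (xs ∷ xss) xss! =
  Unique.cartesianProductWith⁺ _∷_ (λ eq → Vec.∷-injective eq) (xss! zero) (choices-unique xss (xss! ∘ suc))

∈-vectors : ∀ {A : Set} {xs : List A} → (∀ x → x ∈ xs) → ∀ {n} (v : Vec A n) → v ∈ vectors xs n
∈-vectors all∈ []      = here refl
∈-vectors all∈ (x ∷ v) = Membership.∈-cartesianProductWith⁺ _∷_ (all∈ x) (∈-vectors all∈ v)

bits-unique : Unique bits
bits-unique = ((λ ()) ∷ []) ∷ [] ∷ []

∈-bits : ∀ b → b ∈ bits
∈-bits false = here refl
∈-bits true  = there (here refl)

-- Cardinalities of setoids

≡-Setoid : Set → Setoid 0ℓ 0ℓ
≡-Setoid A = setoid A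

infix 4 _hasSize_
_hasSize_ : Setoid 0ℓ 0ℓ → ℕ → Set
A hasSize n = Inverse A (≡-Setoid (Fin n))

module _ {A B : Setoid 0ℓ 0ℓ} where
  private
    module A = Setoid A
    module B = Setoid B

  mkInverse : (to : A.Carrier → B.Carrier) (from : B.Carrier → A.Carrier) →
    (∀ {x y} → x A.≈ y → to x B.≈ to y) → (∀ {x y} → x B.≈ y → from x A.≈ from y) →
    (∀ y → to (from y) B.≈ y) → (∀ x → from (to x) A.≈ x) → Inverse A B
  mkInverse to from to-cong from-cong to-from from-to = record
    { to = to ; from = from ; to-cong = to-cong ; from-cong = from-cong
    ; inverse = (λ {y} eq → B.trans (to-cong eq) (to-from y))
              , (λ {x} eq → A.trans (from-cong eq) (from-to x)) }

infixr 9 _⨾_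
_⨾_ : ∀ {A B C : Setoid 0ℓ 0ℓ} → Inverse A B → Inverse B C → Inverse A C
_⨾_ = Composition.inverse

flipⁱ : ∀ {A B : Setoid 0ℓ 0ℓ} → Inverse A B → Inverse B A
flipⁱ = Symmetry.inverse

size-unique : ∀ {A : Setoid 0ℓ 0ℓ} {m n} → A hasSize m → A hasSize n → m ≡ n
size-unique p q = ↔⇒≡ (flipⁱ p ⨾ q)

-- Equality is pointwise and ignores the proof of `P`, so that neither function extensionality nor
-- uniqueness of these proofs is called for.
Solutions : (A : Set) → ((A → Bool) → Set) → Setoid 0ℓ 0ℓ
Solutions A P = record
  { Carrier = Σ (A → Bool) P
  ; _≈_     = λ f g → ∀ x → proj₁ f x ≡ proj₁ g x
  ; isEquivalence = record
    { refl = λ _ → refl ; sym = λ p x → sym (p x) ; trans = λ p q x → trans (p x) (q x) } }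

Σ-split : {P : Bool → Set} → Inverse (≡-Setoid (Σ Bool P)) (≡-Setoid (P false ⊎ P true))
Σ-split = mkInverse (λ { (false , p) → inj₁ p ; (true , p) → inj₂ p })
    (λ { (inj₁ p) → false , p ; (inj₂ p) → true , p }) (λ { refl → refl }) (λ { refl → refl })
    (λ { (inj₁ _) → refl ; (inj₂ _) → refl }) (λ { (false , _) → refl ; (true , _) → refl })

⊎-size : ∀ {A B : Set} {m n} → ≡-Setoid A hasSize m → ≡-Setoid B hasSize n → ≡-Setoid (A ⊎ B) hasSize (m + n)
⊎-size {A} {B} {m} {n} p q = mkInverse to from (λ { refl → refl }) (λ { refl → refl }) to-from from-to
  where
  module p = Inverse p
  module q = Inverse q
  to : A ⊎ B → Fin (m + n)
  to = Fin.join m n ∘ Sum.map p.to q.to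
  from : Fin (m + n) → A ⊎ B
  from = Sum.map p.from q.from ∘ Fin.splitAt m
  cancel : ∀ z → Sum.map p.to q.to (Sum.map p.from q.from z) ≡ z
  cancel (inj₁ i) = cong inj₁ (p.inverseˡ refl)
  cancel (inj₂ j) = cong inj₂ (q.inverseˡ refl)
  to-from : ∀ i → to (from i) ≡ i
  to-from i = trans (cong (Fin.join m n) (cancel (Fin.splitAt m i))) (Fin.join-splitAt m n i)
  from-to : ∀ z → from (to z) ≡ z
  from-to (inj₁ x) = trans (cong (Sum.map p.from q.from) (Fin.splitAt-↑ˡ m (p.to x) n)) (cong inj₁ (p.inverseʳ refl))
  from-to (inj₂ y) = trans (cong (Sum.map p.from q.from) (Fin.splitAt-↑ʳ m n (q.to y))) (cong inj₂ (q.inverseʳ refl))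

∑ᵇ-size : ∀ {P : Bool → Set} {F : Bool → ℕ} → (∀ b → ≡-Setoid (P b) hasSize F b) → ≡-Setoid (Σ Bool P) hasSize (∑ᵇ F)
∑ᵇ-size p = Σ-split ⨾ ⊎-size (p false) (p true)

guard-size : ∀ {A : Set} {n} x y → ≡-Setoid A hasSize n → ≡-Setoid (x ≡ y × A) hasSize (⟦ x ⇔ᵇ y ⟧ * n)
guard-size {A} {n} x y p = go x y
  where
  module p = Inverse p
  hit : ∀ x → ≡-Setoid (x ≡ x × A) hasSize (n + 0)
  hit x = subst (≡-Setoid (x ≡ x × A) hasSize_) (sym (ℕ.+-identityʳ n))
    (mkInverse (p.to ∘ proj₂) (λ i → refl , p.from i) (λ { refl → refl }) (λ { refl → refl })
      (λ i → p.inverseˡ refl) λ { (refl , a) → cong (refl ,_) (p.inverseʳ refl) })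
  miss : ∀ {x y} → x ≢ y → ≡-Setoid (x ≡ y × A) hasSize 0
  miss x≢y = mkInverse (λ (eq , _) → contradiction eq x≢y) (λ ()) (λ { refl → refl }) (λ { refl → refl })
    (λ ()) (λ (eq , _) → contradiction eq x≢y)
  go : ∀ x y → ≡-Setoid (x ≡ y × A) hasSize (⟦ x ⇔ᵇ y ⟧ * n)
  go false false = hit false
  go false true  = miss λ ()
  go true  false = miss λ ()
  go true  true  = hit true

⊤-size : ≡-Setoid ⊤ hasSize 1
⊤-size = mkInverse (λ _ → zero) (λ _ → tt) (λ { refl → refl }) (λ { refl → refl }) (λ { zero → refl }) (λ _ → refl)

-- Faces

binary : Bool → Fin 2
binary false = zero
binary true  = suc zero

binary⁻¹ : Fin 2 → Bool
binary⁻¹ zero       = false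
binary⁻¹ (suc zero) = true

binary-inverse : ∀ i → binary (binary⁻¹ i) ≡ i
binary-inverse zero       = refl
binary-inverse (suc zero) = refl

binary⁻¹-inverse : ∀ b → binary⁻¹ (binary b) ≡ b
binary⁻¹-inverse false = refl
binary⁻¹-inverse true  = refl

funToFin-cong : ∀ {m n} {f g : Fin m → Fin n} → f ≗ g → Fin.funToFin f ≡ Fin.funToFin g
funToFin-cong {zero}  eq = refl
funToFin-cong {suc m} eq = cong₂ Fin.combine (eq zero) (funToFin-cong (eq ∘ suc))

functions-size : ∀ k → Solutions (Fin k) (λ _ → ⊤) hasSize 2 ^ k
functions-size k = mkInverse (λ (f , _) → Fin.funToFin (binary ∘ f)) (λ i → binary⁻¹ ∘ Fin.finToFun {2} {k} i , tt)
  (λ eq → funToFin-cong λ i → cong binary (eq i)) (λ { refl _ → refl })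
  (λ i → trans (funToFin-cong λ j → binary-inverse (Fin.finToFun {2} {k} i j)) (Fin.funToFin-finToFin {k} {2} i))
  (λ (f , _) i → trans (cong binary⁻¹ (Fin.finToFun-funToFin (binary ∘ f) i)) (binary⁻¹-inverse (f i)))

module _ {A : Set} {R : A → A → Set} (R? : ∀ x y → Dec (R x y)) where

  -- If the representative found for `y` in the tail is filtered out, it is related to `x`, and
  -- transitivity makes `x` a representative of `y`.
  deduplicate-cover : (∀ x → R x x) → (∀ {x y z} → R x y → R y z → R x z) →
                      ∀ {y xs} → y ∈ xs → Any (λ x → R x y) (deduplicate R? xs)
  deduplicate-cover R-refl R-trans {xs = x ∷ xs} (here refl) = here (R-refl x)
  deduplicate-cover R-refl R-trans {y} {x ∷ xs} (there y∈)
    with Any.filter⁺ (¬? ∘ R? x) (deduplicate-cover R-refl R-trans y∈)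
  ... | inj₁ kept = there kept
  ... | inj₂ dropped with R? x y
  ...   | yes xRy = here xRy
  ...   | no ¬xRy = contradiction
    (λ xRz → ¬xRy (R-trans xRz (Any.lookup-result (deduplicate-cover R-refl R-trans y∈)))) dropped

  deduplicate-unrelated : ∀ xs → AllPairs (λ x y → ¬ R x y) (deduplicate R? xs)
  deduplicate-unrelated []       = []
  deduplicate-unrelated (x ∷ xs) =
    All.all-filter (¬? ∘ R? x) (deduplicate R? xs) ∷ AllPairs.filter⁺ (¬? ∘ R? x) (deduplicate-unrelated xs)

unrelated-lookup : ∀ {A : Set} {R : A → A → Set} → (∀ {x y} → R x y → R y x) →
  ∀ {xs} → AllPairs (λ x y → ¬ R x y) xs → ∀ i j → R (lookup xs i) (lookup xs j) → i ≡ j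
unrelated-lookup R-sym (x# ∷ xs#) zero    zero    r = refl
unrelated-lookup R-sym (x# ∷ xs#) zero    (suc j) r = contradiction r (All.lookup x# (Membership.∈-lookup j))
unrelated-lookup R-sym (x# ∷ xs#) (suc i) zero    r =
  contradiction (R-sym r) (All.lookup x# (Membership.∈-lookup i))
unrelated-lookup R-sym (x# ∷ xs#) (suc i) (suc j) r = cong suc (unrelated-lookup R-sym xs# i j r)

-- Orbits of a pair of involutions

module Orbits {A : Set} (xs : List A) (∈xs : ∀ x → x ∈ xs) (α κ : A → A)
  (α-involutive : ∀ x → α (α x) ≡ x) (κ-involutive : ∀ x → κ (κ x) ≡ x) where

  π : A → A
  π = κ ∘ α

  power : ℕ → A → A
  power zero    x = x
  power (suc k) x = power k (π x)

  power-+ : ∀ j k x → power (j + k) x ≡ power k (power j x)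
  power-+ zero    k x = refl
  power-+ (suc j) k x = power-+ j k (π x)

  π-injective : ∀ {x y} → π x ≡ π y → x ≡ y
  π-injective {x} {y} eq = trans (sym (α-involutive x)) (trans (cong α
    (trans (sym (κ-involutive (α x))) (trans (cong κ eq) (κ-involutive (α y))))) (α-involutive y))

  power-injective : ∀ k {x y} → power k x ≡ power k y → x ≡ y
  power-injective zero    eq = eq
  power-injective (suc k) eq = π-injective (power-injective k eq)

  position : A → Fin (length xs)
  position x = Any.index (∈xs x)

  position-injective : ∀ {x y} → position x ≡ position y → x ≡ y
  position-injective {x} {y} eq =
    trans (Any.lookup-index (∈xs x)) (trans (cong (lookup xs) eq) (sym (Any.lookup-index (∈xs y))))

  -- Among the powers with exponents 0 to `length xs` two coincide by the pigeonhole principle, and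
  -- injectivity cancels the smaller exponent. The bound ensures that a boundary walk of `length xs`
  -- flags is long enough to close up.
  period : ∀ x → ∃ λ p → suc p ≤ length xs × power (suc p) x ≡ x
  period x with Fin.pigeonhole (ℕ.n<1+n (length xs)) (λ i → position (power (toℕ i) x))
  ... | i , j , i<j , eq = p , p<n , power-injective (toℕ i) (begin
      power (toℕ i) (power (suc p) x) ≡⟨ power-+ (suc p) (toℕ i) x ⟨
      power (suc p + toℕ i) x         ≡⟨ cong (λ k → power k x) p+i ⟩
      power (toℕ j) x                 ≡⟨ position-injective eq ⟨
      power (toℕ i) x                 ∎)
    where
    open ≡-Reasoning
    p = toℕ j ∸ suc (toℕ i)
    p+i : suc p + toℕ i ≡ toℕ j
    p+i = trans (sym (ℕ.+-suc p (toℕ i))) (ℕ.m∸n+n≡m i<j)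
    p<n : suc p ≤ length xs
    p<n = ℕ.≤-trans (ℕ.m≤m+n (suc p) (toℕ i)) (ℕ.≤-trans (ℕ.≤-reflexive p+i) (ℕ.≤-pred (Fin.toℕ<n j)))

  Reach : A → A → Set
  Reach x y = ∃ λ k → y ≡ power k x

  -- The powers of `π` meet one of the two flags on each side of an edge, and `α` supplies the
  -- other. The two alternatives are those of `SameFace`, and together they give the orbits of the
  -- group generated by `α` and `κ`.
  Orbit : A → A → Set
  Orbit x y = Reach x y ⊎ Reach x (α y)

  ∈-iterate : ∀ {n k} x → k < n → power k x ∈ iterate π x n
  ∈-iterate {suc n} {zero}  x k<n       = here refl
  ∈-iterate {suc n} {suc k} x (s≤s k<n) = there (∈-iterate (π x) k<n)

  -- Reduction of the exponent modulo the period `suc p`: `j` is the current residue and `k` the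
  -- number of steps still to be made. At `j = p` the next step returns to `x`.
  reduce : ∀ x {p} → p ≤ length xs → power (suc p) x ≡ x → ∀ k j → j ≤ p → power (k + j) x ∈ iterate π x (suc p)
  reduce x {p} p≤ cyc zero    j j≤p = ∈-iterate x (s≤s j≤p)
  reduce x {p} p≤ cyc (suc k) j j≤p with j ℕ.≟ p
  ... | yes refl = subst (_∈ iterate π x (suc p)) (sym turn) (reduce x p≤ cyc k 0 z≤n)
    where
    open ≡-Reasoning
    turn : power (suc k + p) x ≡ power (k + 0) x
    turn = begin
      power (suc k + p) x         ≡⟨ cong (λ m → power (suc m) x) (ℕ.+-comm k p) ⟩
      power (suc p + k) x         ≡⟨ power-+ (suc p) k x ⟩
      power k (power (suc p) x)   ≡⟨ cong (power k) cyc ⟩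
      power k x                   ≡⟨ cong (λ m → power m x) (ℕ.+-identityʳ k) ⟨
      power (k + 0) x             ∎
  ... | no j≢p = subst (λ m → power m x ∈ iterate π x (suc p)) (ℕ.+-suc k j)
      (reduce x p≤ cyc k (suc j) (ℕ.≤∧≢⇒< j≤p j≢p))

  iterate-mono : ∀ {m n y} x → m ≤ n → y ∈ iterate π x m → y ∈ iterate π x n
  iterate-mono x (s≤s m≤n) (here eq)  = here eq
  iterate-mono x (s≤s m≤n) (there y∈) = there (iterate-mono (π x) m≤n y∈)

  reach⇒∈ : ∀ {x y} → Reach x y → y ∈ iterate π x (length xs)
  reach⇒∈ {x} (k , refl) with period x
  ... | p , p<n , cyc = iterate-mono x p<n (subst (λ m → power m x ∈ iterate π x (suc p)) (ℕ.+-identityʳ k)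
      (reduce x (ℕ.<⇒≤ p<n) cyc k 0 z≤n))

  ∈⇒reach : ∀ {n x y} → y ∈ iterate π x n → Reach x y
  ∈⇒reach {suc n} (here eq) = 0 , eq
  ∈⇒reach {suc n} (there y∈) with ∈⇒reach {n} y∈
  ... | k , eq = suc k , eq

  reach-π : ∀ {x y} → Reach x y → Reach x (π y)
  reach-π {x} (k , refl) = k + 1 , sym (power-+ k 1 x)

  reach-π⁻¹ : ∀ {x y} → Reach x y → Reach x (α (κ y))
  reach-π⁻¹ {x} {y} (k , eq) = step k eq
    where
    back : ∀ {z} j → y ≡ power j (π z) → y ≡ π (power j z)
    back {z} j eq = trans eq (trans (sym (power-+ 1 j z)) (trans (cong (λ m → power m z) (ℕ.+-comm 1 j)) (power-+ j 1 z)))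
    undo : ∀ {z} j → y ≡ power (suc j) z → α (κ y) ≡ power j z
    undo {z} j eq = trans (cong (α ∘ κ) (back j eq)) (trans (cong α (κ-involutive _)) (α-involutive _))
    step : ∀ k → y ≡ power k x → Reach x (α (κ y))
    step zero    eq = let p , _ , cyc = period x in p , undo p (trans eq (sym cyc))
    step (suc j) eq = j , undo j eq

  orbit-α : ∀ {x y} → Orbit x y → Orbit x (α y)
  orbit-α {x} {y} (inj₁ r) = inj₂ (subst (Reach x) (sym (α-involutive y)) r)
  orbit-α         (inj₂ r) = inj₁ r

  orbit-κ : ∀ {x y} → Orbit x y → Orbit x (κ y)
  orbit-κ         (inj₁ r) = inj₂ (reach-π⁻¹ r)
  orbit-κ {x} {y} (inj₂ r) = inj₁ (subst (Reach x) (cong κ (α-involutive y)) (reach-π r))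

  orbit-refl : ∀ x → Orbit x x
  orbit-refl x = inj₁ (0 , refl)

  orbit-power : ∀ {x y} k → Orbit x y → Orbit x (power k y)
  orbit-power zero    o = o
  orbit-power (suc k) o = orbit-power k (orbit-κ (orbit-α o))

  orbit-power⁻¹ : ∀ {x y} k → Orbit x (power k y) → Orbit x y
  orbit-power⁻¹         zero    o = o
  orbit-power⁻¹ {x} {y} (suc k) o = subst (Orbit x) (α-involutive y)
    (orbit-α (subst (Orbit x) (κ-involutive (α y)) (orbit-κ (orbit-power⁻¹ k o))))

  orbit-α⁻¹ : ∀ {x y} → Orbit x (α y) → Orbit x y
  orbit-α⁻¹ {x} {y} o = subst (Orbit x) (α-involutive y) (orbit-α o)

  orbit-trans : ∀ {x y z} → Orbit x y → Orbit y z → Orbit x z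
  orbit-trans {x} o (inj₁ (k , eq)) = subst (Orbit x) (sym eq) (orbit-power k o)
  orbit-trans {x} o (inj₂ (k , eq)) = orbit-α⁻¹ (subst (Orbit x) (sym eq) (orbit-power k o))

  orbit-sym : ∀ {x y} → Orbit x y → Orbit y x
  orbit-sym {x} {y} (inj₁ (k , eq)) = orbit-power⁻¹ k (subst (Orbit y) eq (orbit-refl y))
  orbit-sym {x} {y} (inj₂ (k , eq)) = orbit-power⁻¹ k (subst (Orbit y) eq (orbit-α (orbit-refl y)))

  Invariant : (A → Bool) → Set
  Invariant h = (∀ x → h (α x) ≡ h x) × (∀ x → h (κ x) ≡ h x)

  invariant-power : ∀ {h} → Invariant h → ∀ k x → h (power k x) ≡ h x
  invariant-power inv zero    x = refl
  invariant-power inv@(hα , hκ) (suc k) x = trans (invariant-power inv k (π x)) (trans (hκ (α x)) (hα x))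

  invariant-orbit : ∀ {h} → Invariant h → ∀ {x y} → Orbit x y → h x ≡ h y
  invariant-orbit {h} inv {x} (inj₁ (k , eq)) = sym (trans (cong h eq) (invariant-power inv k x))
  invariant-orbit {h} inv {x} {y} (inj₂ (k , eq)) =
    sym (trans (sym (proj₁ inv y)) (trans (cong h eq) (invariant-power inv k x)))

  module _ {R : A → A → Set} (R? : ∀ x y → Dec (R x y))
    (R⇒orbit : ∀ {x y} → R x y → Orbit x y) (orbit⇒R : ∀ {x y} → Orbit x y → R x y) where

    private
      reps : List A
      reps = deduplicate R? xs

      covered : ∀ y → Any (λ x → R x y) reps
      covered y = deduplicate-cover R? (orbit⇒R ∘ orbit-refl)
        (λ p q → orbit⇒R (orbit-trans (R⇒orbit p) (R⇒orbit q))) (∈xs y)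

      class : A → Fin (length reps)
      class y = Any.index (covered y)

      class-related : ∀ y → Orbit (lookup reps (class y)) y
      class-related y = R⇒orbit (Any.lookup-index (covered y))

      class-unique : ∀ i j → Orbit (lookup reps i) (lookup reps j) → i ≡ j
      class-unique i j o = unrelated-lookup (λ p → orbit⇒R (orbit-sym (R⇒orbit p)))
        (deduplicate-unrelated R? xs) i j (orbit⇒R o)

      class-orbit : ∀ {x y} → Orbit x y → class x ≡ class y
      class-orbit {x} {y} o = class-unique _ _
        (orbit-trans (class-related x) (orbit-trans o (orbit-sym (class-related y))))

    -- An invariant function takes arbitrary values on the representatives that `deduplicate` keeps
    -- and is determined by them. This makes the computed number of faces the exponent of a
    -- cardinality.
    invariants-size : Solutions A Invariant hasSize 2 ^ length (deduplicate R? xs)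
    invariants-size = mkInverse
      (λ (h , _) → h ∘ lookup reps , tt)
      (λ (f , _) → f ∘ class
        , (λ x → cong f (class-orbit (orbit-sym (orbit-α (orbit-refl x)))))
        , (λ x → cong f (class-orbit (orbit-sym (orbit-κ (orbit-refl x))))))
      (λ eq → eq ∘ lookup reps) (λ eq → eq ∘ class)
      (λ (f , _) i → cong f (class-unique _ _ (class-related (lookup reps i))))
      (λ (h , inv) x → invariant-orbit {h} inv (class-related x))
      ⨾ functions-size (length reps)

-- Potentials on spanning trees

-- A repetition is returned together with the pieces around it, as needed for cutting up a closed
-- walk.
split-duplicate : ∀ {A B : Set} → DecidableEquality B → (f : A → B) (xs : List A) →
  Unique (map f xs) ⊎ ∃ λ as → ∃ λ bs → ∃ λ cs → ∃ λ x → ∃ λ y → xs ≡ as ++ x ∷ bs ++ y ∷ cs × f x ≡ f y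
split-duplicate _≟_ f [] = inj₁ []
split-duplicate _≟_ f (x ∷ xs) with Any.any? (λ y → f x ≟ f y) xs
... | yes dup with find dup
...   | y , y∈ , eq′ with Membership.∈-∃++ y∈
...     | bs , cs , eq = inj₂ ([] , bs , cs , x , y , cong (x ∷_) eq , eq′)
split-duplicate _≟_ f (x ∷ xs) | no nodup with split-duplicate _≟_ f xs
... | inj₁ xs! = inj₁ (All.map⁺ (All.¬Any⇒All¬ xs nodup) ∷ xs!)
... | inj₂ (as , bs , cs , y , z , eq , eq′) = inj₂ (x ∷ as , bs , cs , y , z , cong (x ∷_) eq , eq′)

module Potential (G : Graph) (T : SpanningTree G) (σ : Graph.Edge G → Bool) where
  open Graph G
  open SpanningTree T

  sumAlong : List Dart → Bool
  sumAlong []       = false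
  sumAlong (d ∷ ds) = σ (proj₁ d) xor sumAlong ds

  sumAlong-++ : ∀ xs ys → sumAlong (xs ++ ys) ≡ sumAlong xs xor sumAlong ys
  sumAlong-++ []       ys = refl
  sumAlong-++ (d ∷ xs) ys =
    trans (cong (σ (proj₁ d) xor_) (sumAlong-++ xs ys)) (sym (Bool.xor-assoc (σ (proj₁ d)) _ _))

  Walkᵀ : Vertex → List Dart → Vertex → Set
  Walkᵀ = Walk treeEdges

  uncons : ∀ {x y d ds} → Walkᵀ x (d ∷ ds) y → x ≡ source d × proj₁ d ∈ˢ treeEdges × Walkᵀ (target d) ds y
  uncons (p ∷ w) = refl , p , w

  split : ∀ {x y} ds {ds′} → Walkᵀ x (ds ++ ds′) y → ∃ λ z → Walkᵀ x ds z × Walkᵀ z ds′ y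
  split []       w       = _ , [] , w
  split (d ∷ ds) (p ∷ w) = let z , w₁ , w₂ = split ds w in z , p ∷ w₁ , w₂

  infixr 5 _◅◅_
  _◅◅_ : ∀ {x y z ds ds′} → Walkᵀ x ds y → Walkᵀ y ds′ z → Walkᵀ x (ds ++ ds′) z
  []      ◅◅ w′ = w′
  (p ∷ w) ◅◅ w′ = p ∷ (w ◅◅ w′)

  length-inner : ∀ {A : Set} {n} (as bs cs : List A) {x y : A} → length (as ++ x ∷ bs ++ y ∷ cs) ≤ suc n →
                 length (x ∷ bs) ≤ n × length bs ≤ n × length (as ++ y ∷ cs) ≤ n × length (as ++ cs) ≤ n
  length-inner {n = n} as bs cs {x} {y} le = ≤n (ℕ.≤-trans (s≤s (ℕ.m≤m+n b c)) (ℕ.m≤n+m _ a))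
    , ≤n (ℕ.≤-trans (ℕ.≤-trans (ℕ.m≤m+n b c) (ℕ.n≤1+n _)) (ℕ.m≤n+m _ a))
    , ≤n (ℕ.≤-trans (ℕ.≤-reflexive (trans (List.length-++ as) (ℕ.+-suc a c)))
           (ℕ.≤-trans (s≤s (ℕ.+-monoʳ-≤ a (ℕ.m≤n+m c b))) (ℕ.≤-reflexive (sym (ℕ.+-suc a (b + c))))))
    , ≤n (ℕ.≤-trans (ℕ.≤-reflexive (List.length-++ as)) (ℕ.+-monoʳ-≤ a (ℕ.≤-trans (ℕ.m≤n+m c b) (ℕ.n≤1+n _))))
    where
    a = length as
    b = length bs
    c = length cs
    total : length (as ++ x ∷ bs ++ y ∷ cs) ≡ suc (a + suc (b + c))
    total = trans (List.length-++ as) (trans (cong (λ k → a + suc k) (trans (List.length-++ bs) (ℕ.+-suc b c)))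
      (ℕ.+-suc a (suc (b + c))))
    ≤n : ∀ {k} → k ≤ a + suc (b + c) → k ≤ n
    ≤n k≤ = ℕ.≤-trans k≤ (ℕ.≤-pred (subst (_≤ suc n) total le))

  -- Induction on a bound for the length. Since the tree has no cycle, the walk repeats a source or
  -- an edge. At a repeated source a closed walk is cut out, leaving two shorter ones. If only an
  -- edge repeats, it is run through once in each direction: its two contributions cancel, and the
  -- walk in between and the rest are closed and shorter.
  closed-sum : ∀ n {v ds} → length ds ≤ n → Walkᵀ v ds v → sumAlong ds ≡ false
  closed-sum n {ds = []} le w = refl
  closed-sum (suc n) {v} {ds@(_ ∷ _)} le w
    with split-duplicate Fin._≟_ source ds | split-duplicate Fin._≟_ proj₁ ds
  ... | inj₁ sources! | inj₁ edges! = contradiction ((λ ()) , w , sources! , edges!) (acyclic v ds)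
  ... | inj₂ (as , bs , cs , x , y , eq , same) | _ = detour as bs cs eq same
    where
    detour : ∀ as bs cs {x y} → ds ≡ as ++ x ∷ bs ++ y ∷ cs → source x ≡ source y → sumAlong ds ≡ false
    detour as bs cs {x} {y} eq same with split as (subst (λ l → Walkᵀ v l v) eq w)
    ... | z , w₁ , w₂ with split (x ∷ bs) w₂
    ...   | z′ , w₃ , w₄ with uncons w₃ | uncons w₄ | length-inner as bs cs (subst (λ l → length l ≤ suc n) eq le)
    ...     | refl , _ | refl , _ | le₁ , _ , le₂ , _ = begin
      sumAlong ds                                                  ≡⟨ cong sumAlong eq ⟩
      sumAlong (as ++ (x ∷ bs) ++ y ∷ cs)                          ≡⟨ sumAlong-++ as _ ⟩
      sumAlong as xor sumAlong ((x ∷ bs) ++ y ∷ cs)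
        ≡⟨ cong (sumAlong as xor_) (sumAlong-++ (x ∷ bs) (y ∷ cs)) ⟩
      sumAlong as xor (sumAlong (x ∷ bs) xor sumAlong (y ∷ cs))
        ≡⟨ cong (λ s → sumAlong as xor (s xor sumAlong (y ∷ cs)))
             (closed-sum n le₁ (subst (Walkᵀ (source x) (x ∷ bs)) (sym same) w₃)) ⟩
      sumAlong as xor sumAlong (y ∷ cs)                            ≡⟨ sumAlong-++ as _ ⟨
      sumAlong (as ++ y ∷ cs)
        ≡⟨ closed-sum n le₂ (w₁ ◅◅ subst (λ t → Walkᵀ t (y ∷ cs) v) (sym same) w₄) ⟩
      false ∎
      where open ≡-Reasoning
  closed-sum (suc n) {v} {ds@(_ ∷ _)} le w | inj₁ sources! | inj₂ (as , bs , cs , (k , b) , (_ , b′) , eq , refl) =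
    retrace (b Bool.≟ b′)
    where
    open ≡-Reasoning
    w′ = subst (λ l → Walkᵀ v l v) eq w
    repeat : ∀ {d} as bs cs {xs} → Unique (map source xs) → xs ≡ as ++ d ∷ bs ++ d ∷ cs → ⊥
    repeat []       bs cs (x# ∷ _) refl =
      All.lookup x# (Membership.∈-map⁺ source (Membership.∈-++⁺ʳ bs (here refl))) refl
    repeat (_ ∷ as) bs cs (_ ∷ xs!) refl = repeat as bs cs xs! refl
    retrace : Dec (b ≡ b′) → sumAlong ds ≡ false
    -- An edge used twice in the same direction would repeat its source.
    retrace (yes refl) = ⊥-elim (repeat as bs cs sources! eq)
    retrace (no b≢b′) with Bool.¬-not (b≢b′ ∘ sym)
    ... | refl with split as w′
    ...   | z , w₁ , w₂ with uncons w₂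
    ...     | refl , _ , w₃ with split bs w₃
    ...       | z′ , w₄ , w₅ with uncons w₅ | length-inner as bs cs (subst (λ l → length l ≤ suc n) eq le)
    ...         | refl , _ , w₆ | _ , le₁ , _ , le₂ = begin
      sumAlong ds                                               ≡⟨ cong sumAlong eq ⟩
      sumAlong (as ++ (k , b) ∷ bs ++ (k , not b) ∷ cs)         ≡⟨ sumAlong-++ as _ ⟩
      A xor (s xor sumAlong (bs ++ (k , not b) ∷ cs))           ≡⟨ cong (λ t → A xor (s xor t)) (sumAlong-++ bs _) ⟩
      A xor (s xor (sumAlong bs xor (s xor C)))
        ≡⟨ boolean 4 (λ A s B C → A xor (s xor (B xor (s xor C)))) (λ A s B C → B xor (A xor C)) refl A s (sumAlong bs) C ⟩
      sumAlong bs xor (A xor C)                                 ≡⟨ cong (_xor (A xor C)) (closed-sum n le₁ w₄) ⟩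
      A xor C                                                   ≡⟨ sumAlong-++ as cs ⟨
      sumAlong (as ++ cs)
        ≡⟨ closed-sum n le₂ (w₁ ◅◅ subst (λ c → Walkᵀ (source (k , c)) cs v) (Bool.not-involutive b) w₆) ⟩
      false ∎
      where
      A = sumAlong as
      C = sumAlong cs
      s = σ k

  reverseWalk : ∀ {x y ds} → Walkᵀ x ds y → ∃ λ ds′ → Walkᵀ y ds′ x × sumAlong ds′ ≡ sumAlong ds
  reverseWalk [] = [] , [] , refl
  reverseWalk {ds = (k , b) ∷ ds} (p ∷ w) with reverseWalk w
  ... | ds′ , w′ , eq = ds′ ++ [ k , not b ]
      , w′ ◅◅ subst (λ c → Walkᵀ (source (k , not b)) [ k , not b ] (source (k , c))) (Bool.not-involutive b) (p ∷ [])
      , trans (sumAlong-++ ds′ _) (trans (cong₂ _xor_ eq (Bool.xor-identityʳ (σ k))) (Bool.xor-comm (sumAlong ds) (σ k)))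

  potential : Vertex → Vertex → Bool
  potential root x = sumAlong (proj₁ (connected root x))

  potential-root : ∀ root → potential root root ≡ false
  potential-root root = closed-sum _ ℕ.≤-refl (proj₂ (connected root root))

  -- The walk to one end, the edge, and the reversed walk to the other end form a closed walk in the
  -- tree, whose sum vanishes. The choice of walks made by `connected` is thus immaterial.
  potential-edge : ∀ root k → k ∈ˢ treeEdges →
    potential root (source (k , false)) xor potential root (source (k , true)) ≡ σ k
  potential-edge root k e∈ with connected root (source (k , false)) | connected root (source (k , true))
  ... | ds , w | ds′ , w′ with reverseWalk w′
  ...   | ds″ , w″ , eq = ⇔ᵇ-sound _ _ (trans
      (boolean 3 (λ a b s → (a xor b) ⇔ᵇ s) (λ a b s → not (a xor (s xor b))) refl (sumAlong ds) (sumAlong ds′) (σ k))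
      (cong not (trans (cong (λ t → sumAlong ds xor (σ k xor t)) (sym eq))
        (trans (sym (sumAlong-++ ds ((k , false) ∷ ds″))) (closed-sum _ ℕ.≤-refl (w ◅◅ (e∈ ∷ w″)))))))

  -- Equal differences on the tree edges propagate the agreement of `p` and `q` along a tree walk.
  potential-unique : ∀ {p q : Vertex → Bool} →
    (∀ k → k ∈ˢ treeEdges → p (source (k , false)) xor p (source (k , true)) ≡ q (source (k , false)) xor q (source (k , true))) →
    ∀ {x y} → p x ≡ q x → p y ≡ q y
  potential-unique {p} {q} same {x} {y} eq = along (proj₂ (connected x y)) eq
    where
    step : ∀ k b → k ∈ˢ treeEdges → p (source (k , b)) ≡ q (source (k , b)) → p (source (k , not b)) ≡ q (source (k , not b))
    step k false e∈ eq = booleanIf′ (same k e∈) eq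
      where
      booleanIf′ : ∀ {a b c d} → a xor b ≡ c xor d → a ≡ c → b ≡ d
      booleanIf′ {a} {b} {c} {d} h k = booleanIf 4 (λ a b c d → ((a xor b) ⇔ᵇ (c xor d)) ∧ (a ⇔ᵇ c))
        (λ a b c d → b) (λ a b c d → d) refl a b c d (∧-intro (⇔ᵇ-refl h) (⇔ᵇ-refl k))
    step k true e∈ eq = booleanIf′ (same k e∈) eq
      where
      booleanIf′ : ∀ {a b c d} → a xor b ≡ c xor d → b ≡ d → a ≡ c
      booleanIf′ {a} {b} {c} {d} h k = booleanIf 4 (λ a b c d → ((a xor b) ⇔ᵇ (c xor d)) ∧ (b ⇔ᵇ d))
        (λ a b c d → a) (λ a b c d → c) refl a b c d (∧-intro (⇔ᵇ-refl h) (⇔ᵇ-refl k))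
    along : ∀ {x y ds} → Walkᵀ x ds y → p x ≡ q x → p y ≡ q y
    along []                    eq = eq
    along (_∷_ {d = k , b} e∈ w) eq = along w (step k b e∈ eq)

-- Rotation systems of cubic graphs

-- A reference rotation for a graph in which every vertex has three darts.
record Cubic (G : Graph) : Set where
  open Graph G
  field
    clockwise  : Dart → Dart
    clockwise³ : ∀ d → clockwise (clockwise (clockwise d)) ≡ d
    clockwise≢ : ∀ d → clockwise d ≢ d
    source-cw  : ∀ d → source (clockwise d) ≡ source d
    at-source  : ∀ d d′ → source d ≡ source d′ → d′ ≡ d ⊎ d′ ≡ clockwise d ⊎ d′ ≡ clockwise (clockwise d)
    dart-at    : Vertex → Dart
    source-at  : ∀ x → source (dart-at x) ≡ x

singleton-unique : ∀ {A : Set} {w : A} {xs} → Unique xs → w ∈ xs → (∀ {z} → z ∈ xs → z ≡ w) → xs ≡ [ w ]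
singleton-unique {xs = x ∷ []}     _  w∈ only = cong [_] (only (here refl))
singleton-unique {xs = x ∷ y ∷ xs} ((x≢y ∷ _) ∷ _) w∈ only =
  contradiction (trans (only (here refl)) (sym (only (there (here refl))))) x≢y

module _ {A : Set} (_≟_ : DecidableEquality A) where

  apply-hit : ∀ {x y} z ps → y ≡ x → apply _≟_ ((y , z) ∷ ps) x ≡ z
  apply-hit {x} {y} z ps eq with y ≟ x
  ... | yes _ = refl
  ... | no ≢  = contradiction eq ≢

  apply-miss : ∀ {x y} z ps → y ≢ x → apply _≟_ ((y , z) ∷ ps) x ≡ apply _≟_ ps x
  apply-miss {x} {y} z ps ≢ with y ≟ x
  ... | yes eq = contradiction eq ≢
  ... | no _   = refl

  module _ {a b c : A} (a≢b : a ≢ b) (b≢c : b ≢ c) (a≢c : a ≢ c) where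

    next₁ : next _≟_ (a ∷ b ∷ c ∷ []) a ≡ b
    next₁ = apply-hit b _ refl

    next₂ : next _≟_ (a ∷ b ∷ c ∷ []) b ≡ c
    next₂ = trans (apply-miss b _ a≢b) (apply-hit c _ refl)

    next₃ : next _≟_ (a ∷ b ∷ c ∷ []) c ≡ a
    next₃ = trans (apply-miss b _ a≢c) (trans (apply-miss c _ b≢c) (apply-hit a _ refl))

module CubicGraph (G : Graph) (C : Cubic G) where
  open Graph G
  open Cubic C

  cw : Dart → Dart
  cw = clockwise

  -- The neighbour of a dart on its given side in the reference rotation.
  turn : Bool → Dart → Dart
  turn true  d = cw d
  turn false d = cw (cw d)

  -- The bit is true when the cycle runs against the reference rotation, so that it can be read as
  -- "reversed at this vertex".
  order3 : Dart → Bool → List Dart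
  order3 d p = d ∷ turn (not p) d ∷ turn p d ∷ []

  turn-source : ∀ s d → source (turn s d) ≡ source d
  turn-source true  d = source-cw d
  turn-source false d = trans (source-cw (cw d)) (source-cw d)

  turn-turn : ∀ s d → turn s (turn s d) ≡ turn (not s) d
  turn-turn true  d = refl
  turn-turn false d = cong cw (clockwise³ d)

  turn-inverse : ∀ s d → turn (not s) (turn s d) ≡ d
  turn-inverse true  d = clockwise³ d
  turn-inverse false d = clockwise³ d

  cw²≢ : ∀ d → cw (cw d) ≢ d
  cw²≢ d eq = clockwise≢ d (trans (cong cw (sym eq)) (clockwise³ d))

  turn≢ : ∀ s d → turn s d ≢ d
  turn≢ true  d = clockwise≢ d
  turn≢ false d = cw²≢ d

  turn-not≢ : ∀ s d → turn (not s) d ≢ turn s d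
  turn-not≢ s d eq = turn≢ s (turn s d) (trans (turn-turn s d) eq)

  incident-∈ : ∀ {x d} → source d ≡ x → d ∈ incident x
  incident-∈ {x} {k , b} eq = Membership.∈-filter⁺ (λ d → source d Fin.≟ x)
    (Membership.∈-cartesianProduct⁺ (Membership.∈-allFin k) (∈-bits b)) eq

  incident-source : ∀ {x d} → d ∈ incident x → source d ≡ x
  incident-source {x} d∈ = proj₂ (Membership.∈-filter⁻ (λ d → source d Fin.≟ x) {xs = darts} d∈)

  darts-unique : Unique darts
  darts-unique = Unique.cartesianProduct⁺ (Unique.allFin⁺ size) bits-unique

  incident-unique : ∀ x → Unique (incident x)
  incident-unique x = Unique.filter⁺ (λ d → source d Fin.≟ x) darts-unique

  -- The list follows the numbering of the edges, which is unrelated to the reference rotation;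
  -- hence the unknown orientation `p`.
  incident-shape : ∀ x → ∃ λ d → ∃ λ p → source d ≡ x × incident x ≡ order3 d p
  incident-shape x with incident x in eq | incident-unique x | incident-∈ {x} {dart-at x} (source-at x)
  ... | []         | _            | ()
  ... | d ∷ []     | _            | _ with in-list (turn true d) (turn-source true d)
    where
    in-list : ∀ d′ → source d′ ≡ source d → d′ ∈ d ∷ []
    in-list d′ eq′ = subst (d′ ∈_) eq (incident-∈ (trans eq′ (incident-source (subst (d ∈_) (sym eq) (here refl)))))
  ...   | here eq′ = contradiction eq′ (turn≢ true d)
  incident-shape x | d ∷ y ∷ zs | (d≢y ∷ d∉) ∷ (y∉ ∷ zs!) | _ = d , shape
    where
    src : ∀ {d′} → d′ ∈ d ∷ y ∷ zs → source d′ ≡ x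
    src {d′} d′∈ = incident-source (subst (d′ ∈_) (sym eq) d′∈)
    in-list : ∀ s → turn s d ∈ y ∷ zs
    in-list s with subst (turn s d ∈_) eq (incident-∈ (trans (turn-source s d) (src (here refl))))
    ... | here eq′  = contradiction eq′ (turn≢ s d)
    ... | there t∈  = t∈
    options : ∀ {d′} → d′ ∈ y ∷ zs → ∃ λ s → d′ ≡ turn s d
    options {d′} d′∈ with at-source d d′ (trans (src (here refl)) (sym (src (there d′∈))))
    ... | inj₁ refl        = contradiction refl (All.lookup (d≢y ∷ d∉) d′∈)
    ... | inj₂ (inj₁ eq′)  = true , eq′
    ... | inj₂ (inj₂ eq′)  = false , eq′
    shape : ∃ λ p → source d ≡ x × d ∷ y ∷ zs ≡ order3 d p
    shape with options (here refl)
    ... | s , refl = not s , src (here refl)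
        , cong₂ (λ a as → d ∷ a ∷ as) (cong (λ t → turn t d) (sym (Bool.not-involutive s)))
            (singleton-unique zs! last only)
      where
      last : turn (not s) d ∈ zs
      last with in-list (not s)
      ... | here eq′  = contradiction eq′ (turn-not≢ s d)
      ... | there t∈  = t∈
      only : ∀ {z} → z ∈ zs → z ≡ turn (not s) d
      only {z} z∈ with options (there z∈)
      ... | s′ , refl with s Bool.≟ s′
      ...   | yes refl = contradiction refl (All.lookup y∉ z∈)
      ...   | no s≢s′  = cong (λ t → turn t d) (Bool.¬-not (s≢s′ ∘ sym))

  first : Vertex → Dart
  first x = proj₁ (incident-shape x)

  source-first : ∀ x → source (first x) ≡ x
  source-first x = proj₁ (proj₂ (proj₂ (incident-shape x)))

  rotationAt : Vertex → Bool → List Dart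
  rotationAt x = order3 (first x)

  cyclicOrders-incident : ∀ x → ∃ λ p → cyclicOrders (incident x) ≡ rotationAt x p ∷ rotationAt x (not p) ∷ []
  cyclicOrders-incident x with incident-shape x
  ... | d , p , _ , eq = p , trans (cong cyclicOrders eq)
    (cong (λ t → order3 d p ∷ (d ∷ turn t d ∷ turn (not p) d ∷ []) ∷ []) (sym (Bool.not-involutive p)))

  rotationAt-∈ : ∀ x p → rotationAt x p ∈ cyclicOrders (incident x)
  rotationAt-∈ x p with cyclicOrders-incident x
  ... | q , eq with p Bool.≟ q
  ...   | yes refl = subst (rotationAt x p ∈_) (sym eq) (here refl)
  ...   | no p≢q   = subst (rotationAt x p ∈_) (sym eq) (there (here (cong (rotationAt x) (Bool.¬-not p≢q))))

  orientation : List Dart → Bool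
  orientation (d ∷ d′ ∷ _) = not (does (d′ ≟ᴰ cw d))
  orientation _            = false

  orientation-order3 : ∀ d p → orientation (order3 d p) ≡ p
  orientation-order3 d false = cong not (dec-true (cw d ≟ᴰ cw d) refl)
  orientation-order3 d true  = cong not (dec-false (cw (cw d) ≟ᴰ cw d) (clockwise≢ (cw d)))

  ∈-cyclicOrders : ∀ x {ds} → ds ∈ cyclicOrders (incident x) → ds ≡ rotationAt x (orientation ds)
  ∈-cyclicOrders x {ds} ds∈ with cyclicOrders-incident x
  ... | q , eq with subst (ds ∈_) eq ds∈
  ...   | here refl         = cong (rotationAt x) (sym (orientation-order3 (first x) q))
  ...   | there (here refl) = cong (rotationAt x) (sym (orientation-order3 (first x) (not q)))

  cyclicOrders-unique : ∀ x → Unique (cyclicOrders (incident x))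
  cyclicOrders-unique x with cyclicOrders-incident x
  ... | q , eq = subst Unique (sym eq) ((distinct ∷ []) ∷ [] ∷ [])
    where
    distinct : rotationAt x q ≢ rotationAt x (not q)
    distinct eq′ = Bool.not-¬ refl (trans (sym (orientation-order3 (first x) q))
      (trans (cong orientation eq′) (orientation-order3 (first x) (not q))))

  module _ (d : Dart) where
    private
      d≢ : ∀ s → d ≢ turn s d
      d≢ s = turn≢ s d ∘ sym
      ≢d : ∀ s → turn s d ≢ d
      ≢d s = turn≢ s d
      apart : ∀ s → turn (not s) d ≢ turn s d
      apart s = turn-not≢ s d

    next-order3 : ∀ p {d′} → source d ≡ source d′ → next _≟ᴰ_ (order3 d p) d′ ≡ turn (not p) d′
    next-order3 p {d′} same with at-source d d′ same
    next-order3 p     same | inj₁ refl        = next₁ _≟ᴰ_ (d≢ (not p)) (apart p) (d≢ p)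
    next-order3 false same | inj₂ (inj₁ refl) = next₂ _≟ᴰ_ (d≢ true) (apart false) (d≢ false)
    next-order3 false same | inj₂ (inj₂ refl) = trans (next₃ _≟ᴰ_ (d≢ true) (apart false) (d≢ false)) (sym (clockwise³ d))
    next-order3 true  same | inj₂ (inj₁ refl) = trans (next₃ _≟ᴰ_ (d≢ false) (apart true) (d≢ true)) (sym (clockwise³ d))
    next-order3 true  same | inj₂ (inj₂ refl) = trans (next₂ _≟ᴰ_ (d≢ false) (apart true) (d≢ true)) (sym (cong cw (clockwise³ d)))

    prev-order3 : ∀ p {d′} → source d ≡ source d′ → prev _≟ᴰ_ (order3 d p) d′ ≡ turn p d′
    prev-order3 p {d′} same with at-source d d′ same
    prev-order3 p     same | inj₁ refl        = next₃ _≟ᴰ_ (apart p ∘ sym) (≢d (not p)) (≢d p)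
    prev-order3 false same | inj₂ (inj₁ refl) = trans (next₂ _≟ᴰ_ (apart false ∘ sym) (≢d true) (≢d false)) (sym (clockwise³ d))
    prev-order3 false same | inj₂ (inj₂ refl) = trans (next₁ _≟ᴰ_ (apart false ∘ sym) (≢d true) (≢d false)) (sym (cong cw (clockwise³ d)))
    prev-order3 true  same | inj₂ (inj₁ refl) = next₁ _≟ᴰ_ (apart true ∘ sym) (≢d false) (≢d true)
    prev-order3 true  same | inj₂ (inj₂ refl) = trans (next₂ _≟ᴰ_ (apart true ∘ sym) (≢d false) (≢d true)) (sym (clockwise³ d))

2^-injective : ∀ {m n} → 2 ^ m ≡ 2 ^ n → m ≡ n
2^-injective eq = ℕ.≤-antisym (half eq) (half (sym eq))
  where
  half : ∀ {m n} → 2 ^ m ≡ 2 ^ n → m ≤ n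
  half {m} {n} eq with m ℕ.≤? n
  ... | yes m≤n = m≤n
  ... | no m≰n  = contradiction (sym eq) (ℕ.<⇒≢ (ℕ.^-monoʳ-< 2 (s≤s (s≤s z≤n)) (ℕ.≰⇒> m≰n)))

-- T-rotation systems as twist assignments

module CubicCount (G : Graph) (C : Cubic G) where
  open ℤ using (+_)
  open Graph G
  open Cubic C
  open CubicGraph G C

  private
    orders : Vec (List (List Dart)) order
    orders = Vec.tabulate (cyclicOrders ∘ incident)

    lookup-orders : ∀ x → Vec.lookup orders x ≡ cyclicOrders (incident x)
    lookup-orders = Vec.lookup∘tabulate (cyclicOrders ∘ incident)

  -- The change of the twists when the rotation is reversed at the vertices where `p` is true: an
  -- edge is affected if exactly one of its ends is reversed, and a loop is not.
  coboundary : (Vertex → Bool) → Edge → Bool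
  coboundary p k = p (source (k , false)) xor p (source (k , true))

  coboundary-dart : ∀ p d → coboundary p (proj₁ d) ≡ p (source d) xor p (source (opposite d))
  coboundary-dart p (k , false) = refl
  coboundary-dart p (k , true)  = Bool.xor-comm (p (source (k , false))) _

  -- The reference rotation with the twists σ; reversing the rotation at a vertex amounts to twisting its edges.
  Balanced : (Edge → Bool) → (Flag G → Bool) → Set
  Balanced σ h = (∀ d s → h (opposite d , not (s xor σ (proj₁ d))) ≡ h (d , s))
               × (∀ d → h (cw d , false) ≡ h (d , true))

  module _ (R : RotationSystem G) (p : Vertex → Bool) where
    open RotationSystem R

    module _ (oriented : ∀ x → Vec.lookup rotation x ≡ rotationAt x (p x)) where
      private
        α κ : Flag G → Flag G
        α = alongEdge G R
        κ = acrossCorner G R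

      across : ∀ d s → κ (d , s) ≡ (turn (s xor p (source d)) d , not s)
      across d true = cong (_, false) (trans (cong (λ ds → next _≟ᴰ_ ds d) (oriented (source d)))
        (next-order3 (first (source d)) (p (source d)) (source-first (source d))))
      across d false = cong (_, true) (trans (cong (λ ds → prev _≟ᴰ_ ds d) (oriented (source d)))
        (prev-order3 (first (source d)) (p (source d)) (source-first (source d))))

      α-involutive : ∀ x → α (α x) ≡ x
      α-involutive ((k , b) , s) = cong₂ _,_ (cong (k ,_) (Bool.not-involutive b))
        (boolean 2 (λ s t → not (not (s xor t) xor t)) (λ s t → s) refl s (Vec.lookup twist k))

      κ-involutive : ∀ x → κ (κ x) ≡ x
      κ-involutive (d , s) = trans (cong κ (across d s)) (trans (across _ (not s)) (cong₂ _,_ (begin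
        turn (not s xor p (source (turn t d))) (turn t d)
          ≡⟨ cong (λ x → turn (not s xor p x) (turn t d)) (turn-source t d) ⟩
        turn (not s xor p (source d)) (turn t d)
          ≡⟨ cong (λ b → turn b (turn t d)) (sym (Bool.not-distribˡ-xor s (p (source d)))) ⟩
        turn (not t) (turn t d) ≡⟨ turn-inverse t d ⟩
        d ∎) (Bool.not-involutive s)))
        where
        open ≡-Reasoning
        t = s xor p (source d)

      ∈-flags : ∀ x → x ∈ flags G
      ∈-flags ((k , b) , s) = Membership.∈-cartesianProduct⁺
        (Membership.∈-cartesianProduct⁺ (Membership.∈-allFin k) (∈-bits b)) (∈-bits s)

      open Orbits (flags G) ∈-flags α κ α-involutive κ-involutive

      faces-size : Solutions (Flag G) Invariant hasSize 2 ^ faceCount G R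
      faces-size = invariants-size (sameFace? G R) (Sum.map ∈⇒reach ∈⇒reach) (Sum.map reach⇒∈ reach⇒∈)

      σᴿ : Edge → Bool
      σᴿ k = Vec.lookup twist k xor coboundary p k

      -- A reversal exchanges the two sides of the darts at a vertex. Conjugation by this involution
      -- carries `R` to the reference rotation with the twists `σᴿ`.
      reorient : Flag G → Flag G
      reorient (d , s) = d , s xor p (source d)

      reorient-involutive : ∀ x → reorient (reorient x) ≡ x
      reorient-involutive (d , s) =
        cong (d ,_) (boolean 2 (λ s t → (s xor t) xor t) (λ s t → s) refl s (p (source d)))

      along-reorient : ∀ d s → α (reorient (d , s)) ≡ reorient (opposite d , not (s xor σᴿ (proj₁ d)))
      along-reorient d s = cong (opposite d ,_) (trans
        (boolean 4 (λ s a b t → not ((s xor a) xor t)) (λ s a b t → not (s xor (t xor (a xor b))) xor b) refl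
          s (p (source d)) (p (source (opposite d))) (Vec.lookup twist (proj₁ d)))
        (cong (λ c → not (s xor (Vec.lookup twist (proj₁ d) xor c)) xor p (source (opposite d)))
          (sym (coboundary-dart p d))))

      across-reorient : ∀ d s → κ (reorient (d , s)) ≡ reorient (turn s d , not s)
      across-reorient d s = trans (across d (s xor p (source d))) (cong₂ _,_
        (cong (λ t → turn t d) (boolean 2 (λ s t → (s xor t) xor t) (λ s t → s) refl s (p (source d))))
        (trans (Bool.not-distribˡ-xor s (p (source d))) (cong (λ x → not s xor p x) (sym (turn-source s d)))))

      balanced⇒turn : ∀ {σ h} → Balanced σ h → ∀ d s → h (turn s d , not s) ≡ h (d , s)
      balanced⇒turn (_ , hκ) d true  = hκ d
      balanced⇒turn {h = h} (_ , hκ) d false = trans (sym (hκ (cw (cw d)))) (cong (λ d′ → h (d′ , false)) (clockwise³ d))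

      invariant⇒balanced : ∀ {h} → Invariant h → Balanced σᴿ (h ∘ reorient)
      invariant⇒balanced {h} (hα , hκ) =
          (λ d s → trans (cong h (sym (along-reorient d s))) (hα (reorient (d , s))))
        , (λ d → trans (cong h (sym (across-reorient d true))) (hκ (reorient (d , true))))

      balanced⇒invariant : ∀ {h} → Balanced σᴿ h → Invariant (h ∘ reorient)
      balanced⇒invariant {h} bal@(hα , _) =
          (λ x → back α (λ d s → (opposite d , not (s xor σᴿ (proj₁ d)))) (λ d s → along-reorient d s) hα x)
        , (λ x → back κ (λ d s → (turn s d , not s)) (λ d s → across-reorient d s) (balanced⇒turn {σᴿ} {h} bal) x)
        where
        back : (f : Flag G → Flag G) (g : Dart → Bool → Flag G) → (∀ d s → f (reorient (d , s)) ≡ reorient (g d s)) →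
               (∀ d s → h (g d s) ≡ h (d , s)) → ∀ x → h (reorient (f x)) ≡ h (reorient x)
        back f g fg hg x = let d , s = reorient x in
          trans (cong (h ∘ reorient) (trans (cong f (sym (reorient-involutive x))) (fg d s)))
            (trans (cong h (reorient-involutive (g d s))) (hg d s))

      balanced-size : Solutions (Flag G) (Balanced σᴿ) hasSize 2 ^ faceCount G R
      balanced-size = mkInverse
        (λ (h , b) → h ∘ reorient , balanced⇒invariant b) (λ (h , i) → h ∘ reorient , invariant⇒balanced i)
        (λ eq → eq ∘ reorient) (λ eq → eq ∘ reorient)
        (λ (h , _) x → cong h (reorient-involutive x)) (λ (h , _) x → cong h (reorient-involutive x))
        ⨾ faces-size

  module _ (T : SpanningTree G) (N : Vec Bool size → ℕ)
    (N-size : ∀ σ → Solutions (Flag G) (Balanced (Vec.lookup σ)) hasSize N σ) (root : Vertex) (i : ℕ) where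
    open SpanningTree T

    private
      orient : RotationSystem G → Vertex → Bool
      orient R x = orientation (Vec.lookup (RotationSystem.rotation R) x)

      twists : RotationSystem G → Vec Bool size
      twists R = Vec.tabulate λ k → Vec.lookup (RotationSystem.twist R) k xor coboundary (orient R) k

      -- Reversing these vertices untwists the tree, since the potential has coboundary `σ` on tree
      -- edges. It is unique up to the constant `b`, which is the orientation at the root.
      tree : Bool → Vec Bool size → Vertex → Bool
      tree b σ x = Potential.potential G T (Vec.lookup σ) root x xor b

      system : Bool × Vec Bool size → RotationSystem G
      system (b , σ) = rotationSystem (Vec.tabulate λ x → rotationAt x (tree b σ x))
        (Vec.tabulate λ k → Vec.lookup σ k xor coboundary (tree b σ) k)

      encode : RotationSystem G → Bool × Vec Bool size
      encode R = orient R root , twists R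

      -- Euler's formula order + faces + i = 2 + size in the exponents of 2. In this form `N σ` can
      -- stand for 2 to the number of faces.
      Condition : Vec Bool size → Set
      Condition σ = 2 ^ order * N σ * 2 ^ i ≡ 2 ^ (2 + size)

      condition? : Decidable Condition
      condition? σ = 2 ^ order * N σ * 2 ^ i ℕ.≟ 2 ^ (2 + size)

      oriented : ∀ R → R ∈ generalRotationSystems G → ∀ x →
                 Vec.lookup (RotationSystem.rotation R) x ≡ rotationAt x (orient R x)
      oriented R R∈ x with Membership.∈-cartesianProductWith⁻ rotationSystem (pureRotations G) (vectors bits size) R∈
      ... | ρ , τ , ρ∈ , τ∈ , refl = ∈-cyclicOrders x (subst (Vec.lookup ρ x ∈_)
        (lookup-orders x) (∈-choices⁻ orders ρ∈ x))

      orient-system : ∀ b σ x → orient (system (b , σ)) x ≡ tree b σ x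
      orient-system b σ x = trans (cong orientation (Vec.lookup∘tabulate _ x)) (orientation-order3 (first x) _)

      coboundary-cong : ∀ {p q : Vertex → Bool} → p ≗ q → coboundary p ≗ coboundary q
      coboundary-cong eq k = cong₂ _xor_ (eq _) (eq _)

      twists-system : ∀ b σ → twists (system (b , σ)) ≡ σ
      twists-system b σ = trans (Vec.tabulate-cong λ k → trans
        (cong₂ _xor_ (Vec.lookup∘tabulate _ k) (coboundary-cong (orient-system b σ) k))
        (boolean 2 (λ s c → (s xor c) xor c) (λ s c → s) refl (Vec.lookup σ k) (coboundary (tree b σ) k)))
        (Vec.tabulate∘lookup σ)

      genus⇔ : ∀ f → (+ order ℤ.- + size ℤ.+ + f ≡ + 2 ℤ.- + i → order + f + i ≡ 2 + size)
                   × (order + f + i ≡ 2 + size → + order ℤ.- + size ℤ.+ + f ≡ + 2 ℤ.- + i)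
      genus⇔ f = (λ eq → ℤₚ.+-injective (begin
            + (order + f + i)                                 ≡⟨ left ⟨
            (+ order ℤ.- + size ℤ.+ + f) ℤ.+ (+ size ℤ.+ + i) ≡⟨ cong (ℤ._+ (+ size ℤ.+ + i)) eq ⟩
            (+ 2 ℤ.- + i) ℤ.+ (+ size ℤ.+ + i)                ≡⟨ right ⟩
            + (2 + size) ∎))
        , (λ eq → GroupProperties.∙-cancelʳ (AbelianGroup.group ℤₚ.+-0-abelianGroup) (+ size ℤ.+ + i) _ _ (trans left (trans (cong +_ eq) (sym right))))
        where
        open ≡-Reasoning
        left : (+ order ℤ.- + size ℤ.+ + f) ℤ.+ (+ size ℤ.+ + i) ≡ + (order + f + i)
        left = trans (solve 4 (λ o s f i → (o :- s :+ f) :+ (s :+ i) := o :+ f :+ i) refl (+ order) (+ size) (+ f) (+ i)) refl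
          where open ℤSolver.+-*-Solver
        right : (+ 2 ℤ.- + i) ℤ.+ (+ size ℤ.+ + i) ≡ + (2 + size)
        right = trans (solve 3 (λ t s i → (t :- i) :+ (s :+ i) := t :+ s) refl (+ 2) (+ size) (+ i)) refl
          where open ℤSolver.+-*-Solver

      faces : ∀ R → R ∈ generalRotationSystems G → 2 ^ faceCount G R ≡ N (twists R)
      faces R R∈ = size-unique (balanced-size R (orient R) (oriented R R∈))
        (transport ⨾ N-size (twists R))
        where
        same : ∀ k → Vec.lookup (twists R) k ≡ Vec.lookup (RotationSystem.twist R) k xor coboundary (orient R) k
        same = Vec.lookup∘tabulate _
        transport : Inverse (Solutions (Flag G) (Balanced (λ k → Vec.lookup (RotationSystem.twist R) k xor coboundary (orient R) k)))
                            (Solutions (Flag G) (Balanced (Vec.lookup (twists R))))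
        transport = mkInverse
          (λ (h , hα , hκ) → h , (λ d s → trans (cong (λ t → h (opposite d , not (s xor t))) (same (proj₁ d))) (hα d s)) , hκ)
          (λ (h , hα , hκ) → h , (λ d s → trans (cong (λ t → h (opposite d , not (s xor t))) (sym (same (proj₁ d)))) (hα d s)) , hκ)
          (λ eq → eq) (λ eq → eq) (λ _ _ → refl) (λ _ _ → refl)

      powers : ∀ f → 2 ^ order * 2 ^ f * 2 ^ i ≡ 2 ^ (order + f + i)
      powers f = trans (cong (_* 2 ^ i) (sym (ℕ.^-distribˡ-+-* 2 order f))) (sym (ℕ.^-distribˡ-+-* 2 (order + f) i))

      genus⇒condition : ∀ R → R ∈ generalRotationSystems G → HasEulerGenus G R i → Condition (twists R)
      genus⇒condition R R∈ g = trans (cong (λ n → 2 ^ order * n * 2 ^ i) (sym (faces R R∈)))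
        (trans (powers (faceCount G R)) (cong (2 ^_) (proj₁ (genus⇔ (faceCount G R)) g)))

      condition⇒genus : ∀ R → R ∈ generalRotationSystems G → Condition (twists R) → HasEulerGenus G R i
      condition⇒genus R R∈ c = proj₂ (genus⇔ (faceCount G R)) (2^-injective
        (trans (sym (powers (faceCount G R))) (trans (cong (λ n → 2 ^ order * n * 2 ^ i) (faces R R∈)) c)))

      targets : List (Bool × Vec Bool size)
      targets = cartesianProduct bits (vectors bits size)

      system-∈ : ∀ y → system y ∈ generalRotationSystems G
      system-∈ (b , σ) = Membership.∈-cartesianProductWith⁺ rotationSystem
        (∈-choices orders _ λ x → subst₂ _∈_ (sym (Vec.lookup∘tabulate _ x)) (sym (lookup-orders x))
          (rotationAt-∈ x (tree b σ x)))
        (∈-vectors ∈-bits _)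

      system-tree : ∀ y → IsTRotationSystem G T (system y)
      system-tree (b , σ) k k∈ = trans (Vec.lookup∘tabulate _ k) (begin
        Vec.lookup σ k xor coboundary (tree b σ) k
          ≡⟨ boolean 4 (λ s x y b → s xor ((x xor b) xor (y xor b))) (λ s x y b → s xor (x xor y)) refl
               (Vec.lookup σ k) (P (source (k , false))) (P (source (k , true))) b ⟩
        Vec.lookup σ k xor (P (source (k , false)) xor P (source (k , true)))
          ≡⟨ cong (Vec.lookup σ k xor_) (Potential.potential-edge G T (Vec.lookup σ) root k k∈) ⟩
        Vec.lookup σ k xor Vec.lookup σ k ≡⟨ Bool.xor-same (Vec.lookup σ k) ⟩
        false ∎)
        where
        open ≡-Reasoning
        P = Potential.potential G T (Vec.lookup σ) root

      encode-system : ∀ y → encode (system y) ≡ y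
      encode-system (b , σ) = cong₂ _,_
        (trans (orient-system b σ root) (cong (_xor b) (Potential.potential-root G T (Vec.lookup σ) root)))
        (twists-system b σ)

      system-encode : ∀ R → R ∈ generalRotationSystems G → IsTRotationSystem G T R → system (encode R) ≡ R
      system-encode R R∈ isT = cong₂ rotationSystem
        (trans (Vec.tabulate-cong λ x → trans (cong (rotationAt x) (agrees x)) (sym (oriented R R∈ x))) (Vec.tabulate∘lookup ρ))
        (trans (Vec.tabulate-cong λ k → trans
            (cong₂ _xor_ (Vec.lookup∘tabulate _ k) (coboundary-cong agrees k))
            (boolean 2 (λ s c → (s xor c) xor c) (λ s c → s) refl (Vec.lookup τ k) (coboundary (orient R) k)))
          (Vec.tabulate∘lookup τ))
        where
        open RotationSystem R renaming (rotation to ρ; twist to τ)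
        P = Potential.potential G T (Vec.lookup (twists R)) root
        b = orient R root
        agrees : ∀ x → tree b (twists R) x ≡ orient R x
        agrees x = Potential.potential-unique G T (Vec.lookup (twists R)) {tree b (twists R)} {orient R}
          (λ k k∈ → trans
            (boolean 3 (λ x y b → (x xor b) xor (y xor b)) (λ x y b → x xor y) refl
              (P (source (k , false))) (P (source (k , true))) b)
            (trans (Potential.potential-edge G T (Vec.lookup (twists R)) root k k∈)
              (trans (Vec.lookup∘tabulate _ k) (cong (_xor coboundary (orient R) k) (isT k k∈)))))
          {root} {x} (cong (_xor b) (Potential.potential-root G T (Vec.lookup (twists R)) root))

    -- A T-rotation system amounts to its orientation at the root and an arbitrary `σ`. The faces
    -- depend on `σ` alone; hence the factor 2, and a right-hand side in which `T` does not occur.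
    ℰ-cubic : ℰ G T i ≡ 2 * count condition? (vectors bits size)
    ℰ-cubic = trans (length-bijection systems! targets! encode system
        (λ {R} R∈ → let R∈′ , g = in-systems R∈ in
          Membership.∈-filter⁺ (condition? ∘ proj₂) (Membership.∈-cartesianProduct⁺ (∈-bits _) (∈-vectors ∈-bits _))
            (genus⇒condition R (proj₁ R∈′) g))
        (λ {y} y∈ → Membership.∈-filter⁺ (λ R → hasEulerGenus? G R i)
            (Membership.∈-filter⁺ (isTRotationSystem? G T) (system-∈ y) (system-tree y))
            (condition⇒genus (system y) (system-∈ y)
              (subst Condition (sym (cong proj₂ (encode-system y))) (proj₂ (Membership.∈-filter⁻ (condition? ∘ proj₂) {xs = targets} y∈)))))
        (λ {R} R∈ → let (R∈′ , isT) , _ = in-systems R∈ in system-encode R R∈′ isT)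
        (λ {y} _ → encode-system y))
      (trans (count-++ c? (map (false ,_) vs) (map (true ,_) vs ++ []))
        (cong₂ _+_ (count-map c? (false ,_) vs)
          (trans (count-++ c? (map (true ,_) vs) []) (cong (_+ 0) (count-map c? (true ,_) vs)))))
      where
      vs = vectors bits size
      c? : Decidable (Condition ∘ proj₂)
      c? = condition? ∘ proj₂
      in-systems : ∀ {R} → R ∈ filter (λ R → hasEulerGenus? G R i) (filter (isTRotationSystem? G T) (generalRotationSystems G)) →
                   (R ∈ generalRotationSystems G × IsTRotationSystem G T R) × HasEulerGenus G R i
      in-systems R∈ = let R∈′ , g = Membership.∈-filter⁻ (λ R → hasEulerGenus? G R i) R∈
        in Membership.∈-filter⁻ (isTRotationSystem? G T) {xs = generalRotationSystems G} R∈′ , g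
      systems! : Unique (filter (λ R → hasEulerGenus? G R i) (filter (isTRotationSystem? G T) (generalRotationSystems G)))
      systems! = Unique.filter⁺ (λ R → hasEulerGenus? G R i) (Unique.filter⁺ (isTRotationSystem? G T) (Unique.cartesianProductWith⁺ rotationSystem
        (λ { refl → refl , refl })
        (choices-unique orders λ x → subst Unique (sym (lookup-orders x)) (cyclicOrders-unique x))
        (vectors-unique bits-unique size)))
      targets! : Unique (filter (condition? ∘ proj₂) targets)
      targets! = Unique.filter⁺ _ (Unique.cartesianProduct⁺ bits-unique (vectors-unique bits-unique size))

-- Caterpillar-Halin graphs as ladders

-- Every leaf brings a path edge, its spoke and a cycle edge; the last triple consists of the three
-- edges at the right end of the path. In the dual, grounded at the outer face, a path edge joins
-- the faces above and below, a spoke joins successive faces on its own side, and a cycle edge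
-- contributes to the diagonal. The same slots therefore index the matrix entries later.
slots : List Side → ℕ
slots []      = 3
slots (s ∷ S) = 3 + slots S

-- The edges in order of the construction along the path from the vertex v 0; a and b are the last
-- vertices of the cycle above and below the path.
ends : ∀ {X : Set} S → (Fin (2 + length S) → X) → (Fin (length S) → X) → X → X → Fin (slots S) → X × X
ends []          v u a b 0F = v 0F , v 1F
ends []          v u a b 1F = a , v 1F
ends []          v u a b 2F = v 1F , b
ends (s     ∷ S) v u a b 0F = v 0F , v 1F
ends (s     ∷ S) v u a b 1F = v 1F , u 0F
ends (above ∷ S) v u a b 2F = a , u 0F
ends (below ∷ S) v u a b 2F = u 0F , b
ends (above ∷ S) v u a b (suc (suc (suc k))) = ends S (v ∘ suc) (u ∘ suc) (u 0F) b k
ends (below ∷ S) v u a b (suc (suc (suc k))) = ends S (v ∘ suc) (u ∘ suc) a (u 0F) k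

leavesOn : ∀ {X : Set} S → (Fin (length S) → X) → Side → List X
leavesOn []      u t = []
leavesOn (s ∷ S) u t = if does (s ≟ˢ t) then u 0F ∷ leavesOn S (u ∘ suc) t else leavesOn S (u ∘ suc) t

map-filter-tabulate : ∀ {X : Set} S t {m} {P : Pred (Fin m) 0ℓ} (P? : Decidable P) (g : Fin (length S) → Fin m)
  (f : Fin m → X) → (∀ i → does (P? (g i)) ≡ does (lookup S i ≟ˢ t)) →
  map f (filter P? (List.tabulate g)) ≡ leavesOn S (f ∘ g) t
map-filter-tabulate []      t P? g f eq = refl
map-filter-tabulate (s ∷ S) t P? g f eq with does (P? (g 0F)) | does (s ≟ˢ t) | eq 0F
... | true  | true  | refl = cong (f (g 0F) ∷_) (map-filter-tabulate S t P? (g ∘ suc) f (eq ∘ suc))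
... | false | false | refl = map-filter-tabulate S t P? (g ∘ suc) f (eq ∘ suc)

zip-snoc : ∀ {X : Set} (a : X) xs u b →
           zip (a ∷ xs ++ [ u ]) ((xs ++ [ u ]) ++ [ b ]) ≡ zip (a ∷ xs) (xs ++ [ u ]) ++ [ (u , b) ]
zip-snoc a []       u b = refl
zip-snoc a (x ∷ xs) u b = cong ((a , x) ∷_) (zip-snoc x xs u b)

module _ {X : Set} where

  rim : ∀ S → (Fin (2 + length S) → X) → (Fin (length S) → X) → List X
  rim S v u = leavesOn S u above ++ v (fromℕ (1 + length S)) ∷ reverse (leavesOn S u below)

  -- The ends `a` and `b` of the rim are general because the induction continues from the leaf just
  -- passed. The rim lists the lower leaves backwards, so a leaf below contributes its cycle edge at
  -- the end of the list and a leaf above at the beginning.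
  edges-↭ : ∀ S v u a b →
    List.tabulate {n = 1 + length S} (λ i → v (inject₁ i) , v (suc i)) ++
    List.tabulate {n = length S} (λ i → v (suc (inject₁ i)) , u i) ++
    zip (a ∷ rim S v u) (rim S v u ++ [ b ]) ↭ List.tabulate (ends S v u a b)
  edges-↭ [] v u a b = ↭.refl
  edges-↭ (above ∷ S) v u a b = ↭-prep _ (↭-trans (↭.shift _ P _)
    (↭-prep _ (↭-trans (↭.++⁺ˡ P (↭.shift _ Q _)) (↭-trans (↭.shift _ P _)
      (↭-prep _ (edges-↭ S (v ∘ suc) (u ∘ suc) (u 0F) b))))))
    where
    P = List.tabulate {n = 1 + length S} (λ i → v (suc (inject₁ i)) , v (suc (suc i)))
    Q = List.tabulate {n = length S} (λ i → v (suc (suc (inject₁ i))) , u (suc i))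
  edges-↭ (below ∷ S) v u a b = ↭-prep _ (↭-trans (↭.shift _ P _)
    (↭-prep _ (↭-trans (↭-reflexive (cong (λ zs → P ++ Q ++ zs) snoc)) (↭-trans
      (↭-reflexive (trans (cong (P ++_) (sym (List.++-assoc Q R _))) (sym (List.++-assoc P (Q ++ R) _))))
      (↭-trans (↭.++-comm (P ++ Q ++ R) _)
      (↭-prep _ (edges-↭ S (v ∘ suc) (u ∘ suc) a (u 0F))))))))
    where
    P = List.tabulate {n = 1 + length S} (λ i → v (suc (inject₁ i)) , v (suc (suc i)))
    Q = List.tabulate {n = length S} (λ i → v (suc (suc (inject₁ i))) , u (suc i))
    R = zip (a ∷ rim S (v ∘ suc) (u ∘ suc)) (rim S (v ∘ suc) (u ∘ suc) ++ [ u 0F ])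
    rim-snoc : rim (below ∷ S) v u ≡ rim S (v ∘ suc) (u ∘ suc) ++ [ u 0F ]
    rim-snoc = trans (cong (λ zs → leavesOn S (u ∘ suc) above ++ _ ∷ zs) (List.unfold-reverse (u 0F) (leavesOn S (u ∘ suc) below)))
      (sym (List.++-assoc (leavesOn S (u ∘ suc) above) _ _))
    snoc : zip (a ∷ rim (below ∷ S) v u) (rim (below ∷ S) v u ++ [ b ]) ≡ R ++ [ (u 0F , b) ]
    snoc = trans (cong (λ zs → zip (a ∷ zs) (zs ++ [ b ])) rim-snoc) (zip-snoc a (rim S (v ∘ suc) (u ∘ suc)) (u 0F) b)

↭-positions : ∀ {A : Set} {xs ys : List A} → xs ↭ ys →
  Σ (Permutation (length xs) (length ys)) λ π → ∀ i → lookup ys (Inverse.to π i) ≡ lookup xs i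
↭-positions ↭.refl = Perm.id , λ _ → refl
↭-positions (↭.prep x p) with ↭-positions p
... | π , eq = Perm.lift₀ π , λ { zero → refl ; (suc i) → eq i }
↭-positions (↭.swap x y p) with ↭-positions p
... | π , eq = Perm.swap π , λ { zero → refl ; (suc zero) → refl ; (suc (suc i)) → eq i }
↭-positions (↭.trans p q) with ↭-positions p | ↭-positions q
... | π , eq | ρ , eq′ = π Perm.∘ₚ ρ , λ i → trans (eq′ (Inverse.to π i)) (eq i)

-- start stands for the three vertices v 0, a, b, which coincide at the left end of the graph.
data Hub (S : List Side) : Set where
  start : Hub S
  path  : Fin (1 + length S) → Hub S
  leaf  : Fin (length S) → Hub S

-- The three darts at every vertex in clockwise order; at start these are the darts leaving
-- a, v 0 and b to the right.
Place : List Side → Set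
Place S = Hub S × Fin 3

LDart : List Side → Set
LDart S = Fin (slots S) × Bool

pattern inner k = suc (suc (suc k))

lift : ∀ {n} → Fin n × Bool → Fin (3 + n) × Bool
lift (k , b) = inner k , b

place : ∀ S → Place S → LDart S
place []          (start , 0F)       = 1F , false
place []          (start , 1F)       = 0F , false
place []          (start , 2F)       = 2F , true
place []          (path 0F , 0F)     = 0F , true
place []          (path 0F , 1F)     = 1F , true
place []          (path 0F , 2F)     = 2F , false
place (above ∷ S) (start , 0F)       = 2F , false
place (above ∷ S) (start , 1F)       = 0F , false
place (above ∷ S) (start , 2F)       = lift (place S (start , 2F))
place (above ∷ S) (path 0F , 0F)     = 0F , true
place (above ∷ S) (path 0F , 1F)     = 1F , false
place (above ∷ S) (path 0F , 2F)     = lift (place S (start , 1F))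
place (above ∷ S) (path (suc i) , j) = lift (place S (path i , j))
place (above ∷ S) (leaf 0F , 0F)     = 2F , true
place (above ∷ S) (leaf 0F , 1F)     = lift (place S (start , 0F))
place (above ∷ S) (leaf 0F , 2F)     = 1F , true
place (above ∷ S) (leaf (suc i) , j) = lift (place S (leaf i , j))
place (below ∷ S) (start , 0F)       = lift (place S (start , 0F))
place (below ∷ S) (start , 1F)       = 0F , false
place (below ∷ S) (start , 2F)       = 2F , true
place (below ∷ S) (path 0F , 0F)     = 0F , true
place (below ∷ S) (path 0F , 1F)     = lift (place S (start , 1F))
place (below ∷ S) (path 0F , 2F)     = 1F , false
place (below ∷ S) (path (suc i) , j) = lift (place S (path i , j))
place (below ∷ S) (leaf 0F , 0F)     = 1F , true
place (below ∷ S) (leaf 0F , 1F)     = lift (place S (start , 2F))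
place (below ∷ S) (leaf 0F , 2F)     = 2F , false
place (below ∷ S) (leaf (suc i) , j) = lift (place S (leaf i , j))

-- The three open darts at the left end of the shorter ladder are taken over by the new path vertex,
-- the new leaf and, on the other side of the path, again by `start`.
embed : ∀ s {S} → Place S → Place (s ∷ S)
embed above (start , 0F) = leaf 0F , 1F
embed above (start , 1F) = path 0F , 2F
embed above (start , 2F) = start , 2F
embed below (start , 0F) = start , 0F
embed below (start , 1F) = path 0F , 1F
embed below (start , 2F) = leaf 0F , 1F
embed s     (path i , j) = path (suc i) , j
embed s     (leaf i , j) = leaf (suc i) , j

locate : ∀ S → LDart S → Place S
locate []          (0F , false) = start , 1F
locate []          (0F , true)  = path 0F , 0F
locate []          (1F , false) = start , 0F
locate []          (1F , true)  = path 0F , 1F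
locate []          (2F , false) = path 0F , 2F
locate []          (2F , true)  = start , 2F
locate (above ∷ S) (0F , false) = start , 1F
locate (above ∷ S) (0F , true)  = path 0F , 0F
locate (above ∷ S) (1F , false) = path 0F , 1F
locate (above ∷ S) (1F , true)  = leaf 0F , 2F
locate (above ∷ S) (2F , false) = start , 0F
locate (above ∷ S) (2F , true)  = leaf 0F , 0F
locate (below ∷ S) (0F , false) = start , 1F
locate (below ∷ S) (0F , true)  = path 0F , 0F
locate (below ∷ S) (1F , false) = path 0F , 2F
locate (below ∷ S) (1F , true)  = leaf 0F , 0F
locate (below ∷ S) (2F , false) = leaf 0F , 2F
locate (below ∷ S) (2F , true)  = start , 2F
locate (s ∷ S)     (inner k , b) = embed s (locate S (k , b))

locate-lift : ∀ s S d → locate (s ∷ S) (lift d) ≡ embed s (locate S d)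
locate-lift above S (k , b) = refl
locate-lift below S (k , b) = refl

place-embed : ∀ s S p → place (s ∷ S) (embed s p) ≡ lift (place S p)
place-embed above S (start , 0F) = refl
place-embed above S (start , 1F) = refl
place-embed above S (start , 2F) = refl
place-embed below S (start , 0F) = refl
place-embed below S (start , 1F) = refl
place-embed below S (start , 2F) = refl
place-embed above S (path i , j) = refl
place-embed below S (path i , j) = refl
place-embed above S (leaf i , j) = refl
place-embed below S (leaf i , j) = refl

place-locate : ∀ S d → place S (locate S d) ≡ d
place-locate []          (0F , false) = refl
place-locate []          (0F , true)  = refl
place-locate []          (1F , false) = refl
place-locate []          (1F , true)  = refl
place-locate []          (2F , false) = refl
place-locate []          (2F , true)  = refl
place-locate (above ∷ S) (0F , false) = refl
place-locate (above ∷ S) (0F , true)  = refl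
place-locate (above ∷ S) (1F , false) = refl
place-locate (above ∷ S) (1F , true)  = refl
place-locate (above ∷ S) (2F , false) = refl
place-locate (above ∷ S) (2F , true)  = refl
place-locate (below ∷ S) (0F , false) = refl
place-locate (below ∷ S) (0F , true)  = refl
place-locate (below ∷ S) (1F , false) = refl
place-locate (below ∷ S) (1F , true)  = refl
place-locate (below ∷ S) (2F , false) = refl
place-locate (below ∷ S) (2F , true)  = refl
place-locate (above ∷ S) (inner k , b) = trans (place-embed above S _) (cong lift (place-locate S (k , b)))
place-locate (below ∷ S) (inner k , b) = trans (place-embed below S _) (cong lift (place-locate S (k , b)))

locate-place : ∀ S p → locate S (place S p) ≡ p
locate-lifted : ∀ s S p → locate (s ∷ S) (lift (place S p)) ≡ embed s p
locate-lifted s S p = trans (locate-lift s S (place S p)) (cong (embed s) (locate-place S p))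
locate-place []          (start , 0F)       = refl
locate-place []          (start , 1F)       = refl
locate-place []          (start , 2F)       = refl
locate-place []          (path 0F , 0F)     = refl
locate-place []          (path 0F , 1F)     = refl
locate-place []          (path 0F , 2F)     = refl
locate-place (above ∷ S) (start , 0F)       = refl
locate-place (above ∷ S) (start , 1F)       = refl
locate-place (above ∷ S) (start , 2F)       = locate-lifted above S (start , 2F)
locate-place (above ∷ S) (path 0F , 0F)     = refl
locate-place (above ∷ S) (path 0F , 1F)     = refl
locate-place (above ∷ S) (path 0F , 2F)     = locate-lifted above S (start , 1F)
locate-place (above ∷ S) (path (suc i) , j) = locate-lifted above S (path i , j)
locate-place (above ∷ S) (leaf 0F , 0F)     = refl
locate-place (above ∷ S) (leaf 0F , 1F)     = locate-lifted above S (start , 0F)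
locate-place (above ∷ S) (leaf 0F , 2F)     = refl
locate-place (above ∷ S) (leaf (suc i) , j) = locate-lifted above S (leaf i , j)
locate-place (below ∷ S) (start , 0F)       = locate-lifted below S (start , 0F)
locate-place (below ∷ S) (start , 1F)       = refl
locate-place (below ∷ S) (start , 2F)       = refl
locate-place (below ∷ S) (path 0F , 0F)     = refl
locate-place (below ∷ S) (path 0F , 1F)     = locate-lifted below S (start , 1F)
locate-place (below ∷ S) (path 0F , 2F)     = refl
locate-place (below ∷ S) (path (suc i) , j) = locate-lifted below S (path i , j)
locate-place (below ∷ S) (leaf 0F , 0F)     = refl
locate-place (below ∷ S) (leaf 0F , 1F)     = locate-lifted below S (start , 2F)
locate-place (below ∷ S) (leaf 0F , 2F)     = refl
locate-place (below ∷ S) (leaf (suc i) , j) = locate-lifted below S (leaf i , j)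

end : ∀ {X : Set} → Bool → X × X → X
end false = proj₁
end true  = proj₂

module _ {X : Set} where

  vertexOf : ∀ S → (Fin (2 + length S) → X) → (Fin (length S) → X) → X → X → Place S → X
  vertexOf S v u a b (start , 0F)  = a
  vertexOf S v u a b (start , 1F)  = v 0F
  vertexOf S v u a b (start , 2F)  = b
  vertexOf S v u a b (path i , j)  = v (suc i)
  vertexOf S v u a b (leaf i , j)  = u i

  source-place : ∀ S v u a b p → end (proj₂ (place S p)) (ends S v u a b (proj₁ (place S p))) ≡ vertexOf S v u a b p
  source-place []          v u a b (start , 0F)       = refl
  source-place []          v u a b (start , 1F)       = refl
  source-place []          v u a b (start , 2F)       = refl
  source-place []          v u a b (path 0F , 0F)     = refl
  source-place []          v u a b (path 0F , 1F)     = refl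
  source-place []          v u a b (path 0F , 2F)     = refl
  source-place (above ∷ S) v u a b (start , 0F)       = refl
  source-place (above ∷ S) v u a b (start , 1F)       = refl
  source-place (above ∷ S) v u a b (start , 2F)       = source-place S (v ∘ suc) (u ∘ suc) (u 0F) b (start , 2F)
  source-place (above ∷ S) v u a b (path 0F , 0F)     = refl
  source-place (above ∷ S) v u a b (path 0F , 1F)     = refl
  source-place (above ∷ S) v u a b (path 0F , 2F)     = source-place S (v ∘ suc) (u ∘ suc) (u 0F) b (start , 1F)
  source-place (above ∷ S) v u a b (path (suc i) , j) = source-place S (v ∘ suc) (u ∘ suc) (u 0F) b (path i , j)
  source-place (above ∷ S) v u a b (leaf 0F , 0F)     = refl
  source-place (above ∷ S) v u a b (leaf 0F , 1F)     = source-place S (v ∘ suc) (u ∘ suc) (u 0F) b (start , 0F)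
  source-place (above ∷ S) v u a b (leaf 0F , 2F)     = refl
  source-place (above ∷ S) v u a b (leaf (suc i) , j) = source-place S (v ∘ suc) (u ∘ suc) (u 0F) b (leaf i , j)
  source-place (below ∷ S) v u a b (start , 0F)       = source-place S (v ∘ suc) (u ∘ suc) a (u 0F) (start , 0F)
  source-place (below ∷ S) v u a b (start , 1F)       = refl
  source-place (below ∷ S) v u a b (start , 2F)       = refl
  source-place (below ∷ S) v u a b (path 0F , 0F)     = refl
  source-place (below ∷ S) v u a b (path 0F , 1F)     = source-place S (v ∘ suc) (u ∘ suc) a (u 0F) (start , 1F)
  source-place (below ∷ S) v u a b (path 0F , 2F)     = refl
  source-place (below ∷ S) v u a b (path (suc i) , j) = source-place S (v ∘ suc) (u ∘ suc) a (u 0F) (path i , j)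
  source-place (below ∷ S) v u a b (leaf 0F , 0F)     = refl
  source-place (below ∷ S) v u a b (leaf 0F , 1F)     = source-place S (v ∘ suc) (u ∘ suc) a (u 0F) (start , 2F)
  source-place (below ∷ S) v u a b (leaf 0F , 2F)     = refl
  source-place (below ∷ S) v u a b (leaf (suc i) , j) = source-place S (v ∘ suc) (u ∘ suc) a (u 0F) (leaf i , j)

rotate : Fin 3 → Fin 3
rotate 0F = 1F
rotate 1F = 2F
rotate 2F = 0F

rotate³ : ∀ j → rotate (rotate (rotate j)) ≡ j
rotate³ 0F = refl
rotate³ 1F = refl
rotate³ 2F = refl

rotate≢ : ∀ j → rotate j ≢ j
rotate≢ 0F ()
rotate≢ 1F ()
rotate≢ 2F ()

rotations : ∀ i j → j ≡ i ⊎ j ≡ rotate i ⊎ j ≡ rotate (rotate i)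
rotations 0F 0F = inj₁ refl
rotations 0F 1F = inj₂ (inj₁ refl)
rotations 0F 2F = inj₂ (inj₂ refl)
rotations 1F 0F = inj₂ (inj₂ refl)
rotations 1F 1F = inj₁ refl
rotations 1F 2F = inj₂ (inj₁ refl)
rotations 2F 0F = inj₂ (inj₁ refl)
rotations 2F 1F = inj₂ (inj₂ refl)
rotations 2F 2F = inj₁ refl

module Halin (S : List Side) where
  open Caterpillar S using (halin; v; u)
  open Graph halin

  private
    ends′ : Fin (slots S) → Vertex × Vertex
    ends′ = ends S v u (v 0F) (v 0F)

    leaves≡ : ∀ t → Caterpillar.leaves S t ≡ leavesOn S u t
    leaves≡ t = map-filter-tabulate S t (λ i → lookup S i ≟ˢ t) (λ i → i) u (λ _ → refl)

    path≡ : Caterpillar.path S ≡ List.tabulate {n = 1 + length S} (λ i → v (inject₁ i) , v (suc i))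
    path≡ = List.map-tabulate {n = 1 + length S} (λ i → i) (λ i → v (inject₁ i) , v (suc i))

    spokes≡ : Caterpillar.spokes S ≡ List.tabulate {n = length S} (λ i → v (suc (inject₁ i)) , u i)
    spokes≡ = List.map-tabulate {n = length S} (λ i → i) (λ i → v (suc (inject₁ i)) , u i)

    cycle≡ : Caterpillar.cycle S ≡ zip (v 0F ∷ rim S v u) (rim S v u ++ [ v 0F ])
    cycle≡ = cong₂ (λ U D → cyclicPairs (v 0F ∷ U ++ v (fromℕ (1 + length S)) ∷ reverse D)) (leaves≡ above) (leaves≡ below)

    edges≡ : edges ↭ List.tabulate ends′
    edges≡ = ↭-trans (↭-reflexive (cong₂ _++_ path≡ (cong₂ _++_ spokes≡ cycle≡))) (edges-↭ S v u (v 0F) (v 0F))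

    positions = ↭-positions edges≡

  edgePermutation : Permutation (slots S) size
  edgePermutation = Perm.cast-id (sym (List.length-tabulate ends′)) Perm.∘ₚ Perm.flip (proj₁ positions)

  edgeAt : Fin (slots S) → Edge
  edgeAt = Inverse.to edgePermutation

  slotOf : Edge → Fin (slots S)
  slotOf = Inverse.from edgePermutation

  edgeAt-slotOf : ∀ k → edgeAt (slotOf k) ≡ k
  edgeAt-slotOf k = Inverse.inverseˡ edgePermutation refl

  slotOf-edgeAt : ∀ k → slotOf (edgeAt k) ≡ k
  slotOf-edgeAt k = Inverse.inverseʳ edgePermutation refl

  lookup-edgeAt : ∀ k → lookup edges (edgeAt k) ≡ ends′ k
  lookup-edgeAt k = trans (sym (proj₂ positions (edgeAt k)))
    (trans (cong (lookup (List.tabulate ends′)) (Inverse.inverseˡ (proj₁ positions) refl)) (List.lookup-tabulate ends′ k))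

  toDart : LDart S → Dart
  toDart (k , b) = edgeAt k , b

  fromDart : Dart → LDart S
  fromDart (k , b) = slotOf k , b

  toDart-fromDart : ∀ d → toDart (fromDart d) ≡ d
  toDart-fromDart (k , b) = cong (_, b) (edgeAt-slotOf k)

  fromDart-toDart : ∀ d → fromDart (toDart d) ≡ d
  fromDart-toDart (k , b) = cong (_, b) (slotOf-edgeAt k)

  dartAt : Place S → Dart
  dartAt = toDart ∘ place S

  placeOf : Dart → Place S
  placeOf = locate S ∘ fromDart

  dartAt-placeOf : ∀ d → dartAt (placeOf d) ≡ d
  dartAt-placeOf d = trans (cong toDart (place-locate S (fromDart d))) (toDart-fromDart d)

  placeOf-dartAt : ∀ p → placeOf (dartAt p) ≡ p
  placeOf-dartAt p = trans (cong (locate S) (fromDart-toDart (place S p))) (locate-place S p)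

  hubVertex : Hub S → Vertex
  hubVertex start    = v 0F
  hubVertex (path i) = v (suc i)
  hubVertex (leaf i) = u i

  hubVertex-injective : ∀ {x y} → hubVertex x ≡ hubVertex y → x ≡ y
  hubVertex-injective {x} {y} eq = trans (sym (hubOf-hubVertex x)) (trans (cong hubOf eq) (hubOf-hubVertex y))
    where
    hub : Fin (2 + length S) ⊎ Fin (length S) → Hub S
    hub (inj₁ zero)    = start
    hub (inj₁ (suc i)) = path i
    hub (inj₂ i)       = leaf i
    hubOf : Vertex → Hub S
    hubOf x = hub (Fin.splitAt (2 + length S) x)
    hubOf-hubVertex : ∀ x → hubOf (hubVertex x) ≡ x
    hubOf-hubVertex start    = refl
    hubOf-hubVertex (path i) = cong hub (Fin.splitAt-↑ˡ (2 + length S) (suc i) (length S))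
    hubOf-hubVertex (leaf i) = cong hub (Fin.splitAt-↑ʳ (2 + length S) (length S) i)

  hubVertex-surjective : ∀ x → ∃ λ h → hubVertex h ≡ x
  hubVertex-surjective x with Fin.splitAt (2 + length S) x | Fin.join-splitAt (2 + length S) (length S) x
  ... | inj₁ zero    | eq = start , eq
  ... | inj₁ (suc i) | eq = path i , eq
  ... | inj₂ i       | eq = leaf i , eq

  source-end : ∀ d → source d ≡ end (proj₂ d) (lookup edges (proj₁ d))
  source-end (k , false) = refl
  source-end (k , true)  = refl

  source-dartAt : ∀ p → source (dartAt p) ≡ hubVertex (proj₁ p)
  source-dartAt p = trans (source-end (dartAt p)) (trans (cong (end (proj₂ (place S p))) (lookup-edgeAt (proj₁ (place S p))))
    (trans (source-place S v u (v 0F) (v 0F) p) (vertexOf-hub p)))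
    where
    vertexOf-hub : ∀ p → vertexOf S v u (v 0F) (v 0F) p ≡ hubVertex (proj₁ p)
    vertexOf-hub (start , 0F) = refl
    vertexOf-hub (start , 1F) = refl
    vertexOf-hub (start , 2F) = refl
    vertexOf-hub (path i , j) = refl
    vertexOf-hub (leaf i , j) = refl

  source-placeOf : ∀ d → source d ≡ hubVertex (proj₁ (placeOf d))
  source-placeOf d = trans (cong source (sym (dartAt-placeOf d))) (source-dartAt (placeOf d))

  turnPlace : Place S → Place S
  turnPlace (x , j) = x , rotate j

  clockwise : Dart → Dart
  clockwise = dartAt ∘ turnPlace ∘ placeOf

  placeOf-clockwise : ∀ d → placeOf (clockwise d) ≡ turnPlace (placeOf d)
  placeOf-clockwise d = placeOf-dartAt _

  cubic : Cubic halin
  cubic = record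
    { clockwise  = clockwise
    ; clockwise³ = λ d → trans (cong (dartAt ∘ turnPlace) (trans (placeOf-clockwise (clockwise d)) (cong turnPlace (placeOf-clockwise d))))
        (trans (cong (λ j → dartAt (proj₁ (placeOf d) , j)) (rotate³ (proj₂ (placeOf d)))) (dartAt-placeOf d))
    ; clockwise≢ = λ d eq → rotate≢ (proj₂ (placeOf d)) (cong proj₂ (trans (sym (placeOf-clockwise d)) (cong placeOf eq)))
    ; source-cw  = λ d → trans (source-dartAt (turnPlace (placeOf d))) (sym (source-placeOf d))
    ; at-source  = at-source
    ; dart-at    = λ x → dartAt (proj₁ (hubVertex-surjective x) , 0F)
    ; source-at  = λ x → trans (source-dartAt (proj₁ (hubVertex-surjective x) , 0F)) (proj₂ (hubVertex-surjective x))
    }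
    where
    at-source : ∀ d d′ → source d ≡ source d′ → d′ ≡ d ⊎ d′ ≡ clockwise d ⊎ d′ ≡ clockwise (clockwise d)
    at-source d d′ eq with placeOf d in eqd | placeOf d′ in eqd′
      | trans (sym (source-placeOf d)) (trans eq (source-placeOf d′))
    ... | x , i | y , j | eq′ with hubVertex-injective {x} {y} eq′ | rotations i j
    ...   | refl | inj₁ refl        = inj₁ (trans (back d′ eqd′) (sym (back d eqd)))
      where
      back : ∀ d {p} → placeOf d ≡ p → d ≡ dartAt p
      back d eq = trans (sym (dartAt-placeOf d)) (cong dartAt eq)
    ...   | refl | inj₂ (inj₁ refl) = inj₂ (inj₁ (trans (sym (dartAt-placeOf d′)) (cong dartAt eqd′)))
    ...   | refl | inj₂ (inj₂ refl) = inj₂ (inj₂ (trans (sym (dartAt-placeOf d′)) (cong dartAt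
            (trans eqd′ (sym (cong turnPlace (placeOf-dartAt (x , rotate i))))))))

-- Invariant functions on the flags of a ladder

-- A vertical cut crosses one path edge and two cycle edges. The values on both sides of these three
-- decide how a function can be continued to the right.
record State : Set where
  constructor state
  field vf vt af at bf bt : Bool

select : Bool → Bool → Bool → Bool
select x y false = x
select x y true  = y

-- The values on the two sides of the darts leaving a, v 0 and b to the right.
value : State → Fin 3 → Bool → Bool
value (state vf vt af at bf bt) 0F = select af at
value (state vf vt af at bf bt) 1F = select vf vt
value (state vf vt af at bf bt) 2F = select bf bt

-- As `not (s xor t)` is an involution in `s`, it also gives the side at the near end whose value
-- appears on side `s` of the far end.
carry : Bool → Bool → Bool → Bool → Bool
carry t x y s = select x y (not (s xor t))

carry-edge : ∀ t x y s → carry t x y (not (s xor t)) ≡ select x y s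
carry-edge = boolean 4 (λ t x y s → carry t x y (not (s xor t))) (λ t x y s → select x y s) refl

carry-unique : ∀ {t x y} {f g : Bool → Bool} → (∀ s → f (not (s xor t)) ≡ g s) → (∀ s → g s ≡ select x y s) →
               ∀ s → f s ≡ carry t x y s
carry-unique {t} {x} {y} {f} {g} fg gs s = trans (cong f (boolean 2 (λ s t → s) (λ s t → not (not (s xor t) xor t)) refl s t))
  (trans (fg (not (s xor t))) (gs (not (s xor t))))

-- At the new path vertex and leaf only one corner value is not forced: `k`, between the spoke and
-- the next path edge. The corner of the leaf between the spoke and the incoming cycle edge is
-- determined twice, which leaves the equation between `checkAbove₁` and `checkAbove₂`.
afterAbove : (g y d k : Bool) → State → State
afterAbove g y d k (state vf vt af at bf bt) =
  state k (carry g vf vt false) (carry d af at true) (carry y (carry g vf vt true) k false) bf bt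

afterBelow : (g y d k : Bool) → State → State
afterBelow g y d k (state vf vt af at bf bt) =
  state (carry g vf vt true) k af at (carry y k (carry g vf vt false) true) (carry d bf bt false)

checkAbove₁ checkAbove₂ checkBelow₁ checkBelow₂ : (g y d k : Bool) → State → Bool
checkAbove₁ g y d k (state vf vt af at bf bt) = carry y (carry g vf vt true) k true
checkAbove₂ g y d k (state vf vt af at bf bt) = carry d af at false
checkBelow₁ g y d k (state vf vt af at bf bt) = carry y k (carry g vf vt false) false
checkBelow₂ g y d k (state vf vt af at bf bt) = carry d bf bt true

Extension : ∀ S → Vec Bool (slots S) → State → Set
Extension [] (g ∷ x ∷ z ∷ []) (state vf vt af at bf bt) =
  carry g vf vt true ≡ carry x af at false × (carry x af at true ≡ carry z bf bt false
  × (carry z bf bt true ≡ carry g vf vt false × ⊤))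
Extension (above ∷ S) (g ∷ y ∷ d ∷ τ) st =
  Σ Bool λ k → checkAbove₁ g y d k st ≡ checkAbove₂ g y d k st × Extension S τ (afterAbove g y d k st)
Extension (below ∷ S) (g ∷ y ∷ d ∷ τ) st =
  Σ Bool λ k → checkBelow₁ g y d k st ≡ checkBelow₂ g y d k st × Extension S τ (afterBelow g y d k st)

extensions : ∀ S → Vec Bool (slots S) → State → ℕ
extensions [] (g ∷ x ∷ z ∷ []) (state vf vt af at bf bt) =
  ⟦ carry g vf vt true ⇔ᵇ carry x af at false ⟧ * (⟦ carry x af at true ⇔ᵇ carry z bf bt false ⟧
  * (⟦ carry z bf bt true ⇔ᵇ carry g vf vt false ⟧ * 1))
extensions (above ∷ S) (g ∷ y ∷ d ∷ τ) st =
  ∑ᵇ λ k → ⟦ checkAbove₁ g y d k st ⇔ᵇ checkAbove₂ g y d k st ⟧ * extensions S τ (afterAbove g y d k st)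
extensions (below ∷ S) (g ∷ y ∷ d ∷ τ) st =
  ∑ᵇ λ k → ⟦ checkBelow₁ g y d k st ⇔ᵇ checkBelow₂ g y d k st ⟧ * extensions S τ (afterBelow g y d k st)

Extension-size : ∀ S τ st → ≡-Setoid (Extension S τ st) hasSize extensions S τ st
Extension-size [] (g ∷ x ∷ z ∷ []) (state vf vt af at bf bt) =
  guard-size _ _ (guard-size _ _ (guard-size _ _ ⊤-size))
Extension-size (above ∷ S) (g ∷ y ∷ d ∷ τ) st = ∑ᵇ-size λ k → guard-size _ _ (Extension-size S τ _)
Extension-size (below ∷ S) (g ∷ y ∷ d ∷ τ) st = ∑ᵇ-size λ k → guard-size _ _ (Extension-size S τ _)

-- Flag functions and their extension data

LFlag : List Side → Set
LFlag S = LDart S × Bool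

liftFlag : ∀ {n} → (Fin n × Bool) × Bool → (Fin (3 + n) × Bool) × Bool
liftFlag (d , s) = lift d , s

Corner : ∀ S → (LFlag S → Bool) → Hub S → Set
Corner S h x = ∀ j → h (place S (x , rotate j) , false) ≡ h (place S (x , j) , true)

-- There is no corner condition at `start`: inside the recursion its three darts belong to different
-- vertices further left, and `st` prescribes their values.
record Extends S (τ : Vec Bool (slots S)) (st : State) (h : LFlag S → Bool) : Set where
  field
    edge   : ∀ k s → h ((k , true) , not (s xor Vec.lookup τ k)) ≡ h ((k , false) , s)
    atPath : ∀ i → Corner S h (path i)
    atLeaf : ∀ i → Corner S h (leaf i)
    bound  : ∀ j s → h (place S (start , j) , s) ≡ value st j s

  opposite-edge : ∀ k s → h ((k , false) , not (s xor Vec.lookup τ k)) ≡ h ((k , true) , s)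
  opposite-edge k s = trans (sym (edge k _)) (cong (λ b → h ((k , true) , b))
    (boolean 2 (λ s t → not (not (s xor t) xor t)) (λ s t → s) refl s (Vec.lookup τ k)))

open Extends

select-η : ∀ {x y} (f : Bool → Bool) → f false ≡ x → f true ≡ y → ∀ s → f s ≡ select x y s
select-η f p q false = p
select-η f p q true  = q

grow : ∀ S τ st → Extension S τ st → LFlag S → Bool
grow [] (g ∷ x ∷ z ∷ []) (state vf vt af at bf bt) _ ((0F , false) , s) = select vf vt s
grow [] (g ∷ x ∷ z ∷ []) (state vf vt af at bf bt) _ ((0F , true)  , s) = carry g vf vt s
grow [] (g ∷ x ∷ z ∷ []) (state vf vt af at bf bt) _ ((1F , false) , s) = select af at s
grow [] (g ∷ x ∷ z ∷ []) (state vf vt af at bf bt) _ ((1F , true)  , s) = carry x af at s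
grow [] (g ∷ x ∷ z ∷ []) (state vf vt af at bf bt) _ ((2F , true)  , s) = select bf bt s
grow [] (g ∷ x ∷ z ∷ []) (state vf vt af at bf bt) _ ((2F , false) , s) = carry z bf bt s
grow (above ∷ S) (g ∷ y ∷ d ∷ τ) (state vf vt af at bf bt) (k , _) ((0F , false) , s) = select vf vt s
grow (above ∷ S) (g ∷ y ∷ d ∷ τ) (state vf vt af at bf bt) (k , _) ((0F , true)  , s) = carry g vf vt s
grow (above ∷ S) (g ∷ y ∷ d ∷ τ) (state vf vt af at bf bt) (k , _) ((1F , false) , s) = select (carry g vf vt true) k s
grow (above ∷ S) (g ∷ y ∷ d ∷ τ) (state vf vt af at bf bt) (k , _) ((1F , true)  , s) = carry y (carry g vf vt true) k s
grow (above ∷ S) (g ∷ y ∷ d ∷ τ) (state vf vt af at bf bt) (k , _) ((2F , false) , s) = select af at s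
grow (above ∷ S) (g ∷ y ∷ d ∷ τ) (state vf vt af at bf bt) (k , _) ((2F , true)  , s) = carry d af at s
grow (above ∷ S) (g ∷ y ∷ d ∷ τ) st@(state _ _ _ _ _ _)    (k , _ , ext) ((inner i , b) , s) = grow S τ (afterAbove g y d k st) ext ((i , b) , s)
grow (below ∷ S) (g ∷ y ∷ d ∷ τ) (state vf vt af at bf bt) (k , _) ((0F , false) , s) = select vf vt s
grow (below ∷ S) (g ∷ y ∷ d ∷ τ) (state vf vt af at bf bt) (k , _) ((0F , true)  , s) = carry g vf vt s
grow (below ∷ S) (g ∷ y ∷ d ∷ τ) (state vf vt af at bf bt) (k , _) ((1F , false) , s) = select k (carry g vf vt false) s
grow (below ∷ S) (g ∷ y ∷ d ∷ τ) (state vf vt af at bf bt) (k , _) ((1F , true)  , s) = carry y k (carry g vf vt false) s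
grow (below ∷ S) (g ∷ y ∷ d ∷ τ) (state vf vt af at bf bt) (k , _) ((2F , true)  , s) = select bf bt s
grow (below ∷ S) (g ∷ y ∷ d ∷ τ) (state vf vt af at bf bt) (k , _) ((2F , false) , s) = carry d bf bt s
grow (below ∷ S) (g ∷ y ∷ d ∷ τ) st@(state _ _ _ _ _ _)    (k , _ , ext) ((inner i , b) , s) = grow S τ (afterBelow g y d k st) ext ((i , b) , s)

grow-extends : ∀ S τ st ext → Extends S τ st (grow S τ st ext)
grow-extends [] (g ∷ x ∷ z ∷ []) (state vf vt af at bf bt) (p , q , r , _) = record
  { edge   = λ { 0F s → carry-edge g vf vt s ; 1F s → carry-edge x af at s ; 2F s → refl }
  ; atPath = λ { 0F 0F → sym p ; 0F 1F → sym q ; 0F 2F → sym r }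
  ; atLeaf = λ ()
  ; bound  = λ { 0F s → refl ; 1F s → refl ; 2F s → refl } }
grow-extends (above ∷ S) (g ∷ y ∷ d ∷ τ) st@(state vf vt af at bf bt) (k , p , ext) = record
  { edge   = λ { 0F s → carry-edge g vf vt s ; 1F s → carry-edge y (carry g vf vt true) k s ; 2F s → carry-edge d af at s
               ; (inner i) s → edge rec i s }
  ; atPath = λ { 0F 0F → refl ; 0F 1F → bound rec 1F false ; 0F 2F → sym (bound rec 1F true) ; (suc i) j → atPath rec i j }
  ; atLeaf = λ { 0F 0F → bound rec 0F false ; 0F 1F → sym (bound rec 0F true) ; 0F 2F → sym p ; (suc i) j → atLeaf rec i j }
  ; bound  = λ { 0F s → refl ; 1F s → refl ; 2F s → bound rec 2F s } }
  where rec = grow-extends S τ (afterAbove g y d k st) ext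
grow-extends (below ∷ S) (g ∷ y ∷ d ∷ τ) st@(state vf vt af at bf bt) (k , p , ext) = record
  { edge   = λ { 0F s → carry-edge g vf vt s ; 1F s → carry-edge y k (carry g vf vt false) s ; 2F s → refl
               ; (inner i) s → edge rec i s }
  ; atPath = λ { 0F 0F → bound rec 1F false ; 0F 1F → sym (bound rec 1F true) ; 0F 2F → refl ; (suc i) j → atPath rec i j }
  ; atLeaf = λ { 0F 0F → bound rec 2F false ; 0F 1F → sym (bound rec 2F true) ; 0F 2F → p ; (suc i) j → atLeaf rec i j }
  ; bound  = λ { 0F s → bound rec 0F s ; 1F s → refl ; 2F s → refl } }
  where rec = grow-extends S τ (afterBelow g y d k st) ext

carried : ∀ {S τ st h} → Extends S τ st h → ∀ k {x y} → h ((k , false) , false) ≡ x → h ((k , false) , true) ≡ y →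
          ∀ s → h ((k , true) , s) ≡ carry (Vec.lookup τ k) x y s
carried {h = h} E k p q = carry-unique {f = λ s → h ((k , true) , s)} (edge E k) (select-η (λ s → h ((k , false) , s)) p q)

carried′ : ∀ {S τ st h} → Extends S τ st h → ∀ k {x y} → h ((k , true) , false) ≡ x → h ((k , true) , true) ≡ y →
           ∀ s → h ((k , false) , s) ≡ carry (Vec.lookup τ k) x y s
carried′ {h = h} E k p q = carry-unique {f = λ s → h ((k , false) , s)} (opposite-edge E k) (select-η (λ s → h ((k , true) , s)) p q)

module Above {S g y d τ vf vt af at bf bt} {h : LFlag (above ∷ S) → Bool}
  (E : Extends (above ∷ S) (g ∷ y ∷ d ∷ τ) (state vf vt af at bf bt) h) where

  free : Bool
  free = h ((1F , false) , true)

  left : ∀ s → h ((0F , true) , s) ≡ carry g vf vt s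
  left = carried E 0F (bound E 1F false) (bound E 1F true)

  spoke : ∀ s → h ((1F , false) , s) ≡ select (carry g vf vt true) free s
  spoke = select-η (λ s → h ((1F , false) , s)) (trans (atPath E 0F 0F) (left true)) refl

  down : ∀ s → h ((1F , true) , s) ≡ carry y (carry g vf vt true) free s
  down = carried E 1F (spoke false) (spoke true)

  rim-left : ∀ s → h ((2F , true) , s) ≡ carry d af at s
  rim-left = carried E 2F (bound E 0F false) (bound E 0F true)

  check : carry y (carry g vf vt true) free true ≡ carry d af at false
  check = trans (sym (down true)) (trans (sym (atLeaf E 0F 2F)) (rim-left false))

  rest : Extends S τ (afterAbove g y d free (state vf vt af at bf bt)) (h ∘ liftFlag)
  rest = record
    { edge   = λ k s → edge E (inner k) s
    ; atPath = λ i → atPath E (suc i)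
    ; atLeaf = λ i → atLeaf E (suc i)
    ; bound  = λ { 0F false → trans (atLeaf E 0F 0F) (rim-left true) ; 0F true → trans (sym (atLeaf E 0F 1F)) (down false)
                 ; 1F false → atPath E 0F 1F ; 1F true → trans (sym (atPath E 0F 2F)) (left false)
                 ; 2F s → bound E 2F s } }

module Below {S g y d τ vf vt af at bf bt} {h : LFlag (below ∷ S) → Bool}
  (E : Extends (below ∷ S) (g ∷ y ∷ d ∷ τ) (state vf vt af at bf bt) h) where

  free : Bool
  free = h ((1F , false) , false)

  left : ∀ s → h ((0F , true) , s) ≡ carry g vf vt s
  left = carried E 0F (bound E 1F false) (bound E 1F true)

  spoke : ∀ s → h ((1F , false) , s) ≡ select free (carry g vf vt false) s
  spoke = select-η (λ s → h ((1F , false) , s)) refl (trans (sym (atPath E 0F 2F)) (left false))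

  up : ∀ s → h ((1F , true) , s) ≡ carry y free (carry g vf vt false) s
  up = carried E 1F (spoke false) (spoke true)

  rim-left : ∀ s → h ((2F , false) , s) ≡ carry d bf bt s
  rim-left = carried′ E 2F (bound E 2F false) (bound E 2F true)

  check : carry y free (carry g vf vt false) false ≡ carry d bf bt true
  check = trans (sym (up false)) (trans (atLeaf E 0F 2F) (rim-left true))

  rest : Extends S τ (afterBelow g y d free (state vf vt af at bf bt)) (h ∘ liftFlag)
  rest = record
    { edge   = λ k s → edge E (inner k) s
    ; atPath = λ i → atPath E (suc i)
    ; atLeaf = λ i → atLeaf E (suc i)
    ; bound  = λ { 0F s → bound E 0F s
                 ; 1F false → trans (atPath E 0F 0F) (left true) ; 1F true → sym (atPath E 0F 1F)
                 ; 2F false → trans (atLeaf E 0F 0F) (up true) ; 2F true → trans (sym (atLeaf E 0F 1F)) (rim-left false) } }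

module Last {g x z vf vt af at bf bt} {h : LFlag [] → Bool}
  (E : Extends [] (g ∷ x ∷ z ∷ []) (state vf vt af at bf bt) h) where

  left : ∀ s → h ((0F , true) , s) ≡ carry g vf vt s
  left = carried E 0F (bound E 1F false) (bound E 1F true)

  up : ∀ s → h ((1F , true) , s) ≡ carry x af at s
  up = carried E 1F (bound E 0F false) (bound E 0F true)

  down : ∀ s → h ((2F , false) , s) ≡ carry z bf bt s
  down = carried′ E 2F (bound E 2F false) (bound E 2F true)

shrink : ∀ S τ st {h} → Extends S τ st h → Extension S τ st
shrink [] (g ∷ x ∷ z ∷ []) (state vf vt af at bf bt) E =
    trans (sym (left true)) (trans (sym (atPath E 0F 0F)) (up false))
  , trans (sym (up true)) (trans (sym (atPath E 0F 1F)) (down false))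
  , trans (sym (down true)) (trans (sym (atPath E 0F 2F)) (left false)) , tt
  where open Last E
shrink (above ∷ S) (g ∷ y ∷ d ∷ τ) (state vf vt af at bf bt) E = free , check , shrink S τ _ rest
  where open Above E
shrink (below ∷ S) (g ∷ y ∷ d ∷ τ) (state vf vt af at bf bt) E = free , check , shrink S τ _ rest
  where open Below E

grow-shrink : ∀ S τ st {h} (E : Extends S τ st h) → ∀ x → grow S τ st (shrink S τ st E) x ≡ h x
grow-shrink [] (g ∷ x ∷ z ∷ []) (state vf vt af at bf bt) E ((0F , false) , s) = sym (bound E 1F s)
grow-shrink [] (g ∷ x ∷ z ∷ []) (state vf vt af at bf bt) E ((0F , true)  , s) = sym (Last.left E s)
grow-shrink [] (g ∷ x ∷ z ∷ []) (state vf vt af at bf bt) E ((1F , false) , s) = sym (bound E 0F s)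
grow-shrink [] (g ∷ x ∷ z ∷ []) (state vf vt af at bf bt) E ((1F , true)  , s) = sym (Last.up E s)
grow-shrink [] (g ∷ x ∷ z ∷ []) (state vf vt af at bf bt) E ((2F , false) , s) = sym (Last.down E s)
grow-shrink [] (g ∷ x ∷ z ∷ []) (state vf vt af at bf bt) E ((2F , true)  , s) = sym (bound E 2F s)
grow-shrink (above ∷ S) (g ∷ y ∷ d ∷ τ) (state vf vt af at bf bt) E ((0F , false) , s) = sym (bound E 1F s)
grow-shrink (above ∷ S) (g ∷ y ∷ d ∷ τ) (state vf vt af at bf bt) E ((0F , true)  , s) = sym (Above.left E s)
grow-shrink (above ∷ S) (g ∷ y ∷ d ∷ τ) (state vf vt af at bf bt) E ((1F , false) , s) = sym (Above.spoke E s)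
grow-shrink (above ∷ S) (g ∷ y ∷ d ∷ τ) (state vf vt af at bf bt) E ((1F , true)  , s) = sym (Above.down E s)
grow-shrink (above ∷ S) (g ∷ y ∷ d ∷ τ) (state vf vt af at bf bt) E ((2F , false) , s) = sym (bound E 0F s)
grow-shrink (above ∷ S) (g ∷ y ∷ d ∷ τ) (state vf vt af at bf bt) E ((2F , true)  , s) = sym (Above.rim-left E s)
grow-shrink (above ∷ S) (g ∷ y ∷ d ∷ τ) (state vf vt af at bf bt) E ((inner i , b) , s) =
  grow-shrink S τ _ (Above.rest E) ((i , b) , s)
grow-shrink (below ∷ S) (g ∷ y ∷ d ∷ τ) (state vf vt af at bf bt) E ((0F , false) , s) = sym (bound E 1F s)
grow-shrink (below ∷ S) (g ∷ y ∷ d ∷ τ) (state vf vt af at bf bt) E ((0F , true)  , s) = sym (Below.left E s)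
grow-shrink (below ∷ S) (g ∷ y ∷ d ∷ τ) (state vf vt af at bf bt) E ((1F , false) , s) = sym (Below.spoke E s)
grow-shrink (below ∷ S) (g ∷ y ∷ d ∷ τ) (state vf vt af at bf bt) E ((1F , true)  , s) = sym (Below.up E s)
grow-shrink (below ∷ S) (g ∷ y ∷ d ∷ τ) (state vf vt af at bf bt) E ((2F , false) , s) = sym (Below.rim-left E s)
grow-shrink (below ∷ S) (g ∷ y ∷ d ∷ τ) (state vf vt af at bf bt) E ((2F , true)  , s) = sym (bound E 2F s)
grow-shrink (below ∷ S) (g ∷ y ∷ d ∷ τ) (state vf vt af at bf bt) E ((inner i , b) , s) =
  grow-shrink S τ _ (Below.rest E) ((i , b) , s)

-- Each bit `k` is the value at one side of a spoke; all other components are equations between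
-- Booleans, which have at most one proof.
grow-injective : ∀ S τ st ext ext′ → grow S τ st ext ≗ grow S τ st ext′ → ext ≡ ext′
grow-injective [] (g ∷ x ∷ z ∷ []) (state vf vt af at bf bt) (p , q , r , _) (p′ , q′ , r′ , _) eq =
  cong₂ _,_ (uip p p′) (cong₂ _,_ (uip q q′) (cong (_, tt) (uip r r′)))
grow-injective (above ∷ S) (g ∷ y ∷ d ∷ τ) (state vf vt af at bf bt) (k , p , ext) (k′ , p′ , ext′) eq
  with eq ((1F , false) , true)
... | refl = cong (k ,_) (cong₂ _,_ (uip p p′)
  (grow-injective S τ _ ext ext′ λ { ((i , b) , s) → eq ((inner i , b) , s) }))
grow-injective (below ∷ S) (g ∷ y ∷ d ∷ τ) (state vf vt af at bf bt) (k , p , ext) (k′ , p′ , ext′) eq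
  with eq ((1F , false) , false)
... | refl = cong (k ,_) (cong₂ _,_ (uip p p′)
  (grow-injective S τ _ ext ext′ λ { ((i , b) , s) → eq ((inner i , b) , s) }))

-- The three corners at the left end are the upper face, the lower face and the outer face.
initial : (U L O : Bool) → State
initial U L O = state U L O U L O

flagFunctions : ∀ S → Vec Bool (slots S) → ℕ
flagFunctions S τ = ∑ᵇ λ U → ∑ᵇ λ L → ∑ᵇ λ O → extensions S τ (initial U L O)

module HalinFlags (S : List Side) (σ : Vec Bool (Graph.size (Caterpillar.halin S))) where
  open Caterpillar S using (halin)
  open Graph halin
  open Halin S
  open CubicCount halin cubic

  ladderTwists : Vec Bool (slots S)
  ladderTwists = Vec.tabulate (Vec.lookup σ ∘ edgeAt)

  private
    τ = ladderTwists

    lookup-τ : ∀ k → Vec.lookup τ k ≡ Vec.lookup σ (edgeAt k)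
    lookup-τ = Vec.lookup∘tabulate (Vec.lookup σ ∘ edgeAt)

    lookup-τ′ : ∀ k → Vec.lookup τ (slotOf k) ≡ Vec.lookup σ k
    lookup-τ′ k = trans (lookup-τ (slotOf k)) (cong (Vec.lookup σ) (edgeAt-slotOf k))

    Total : Set
    Total = Σ Bool λ U → Σ Bool λ L → Σ Bool λ O → Extension S τ (initial U L O)

    fromFlag : Flag halin → LFlag S
    fromFlag (d , s) = fromDart d , s

    toFlag : LFlag S → Flag halin
    toFlag (d , s) = toDart d , s

    balanced⇒extends : ∀ {h} → Balanced (Vec.lookup σ) h →
      Extends S τ (initial (h (dartAt (start , 1F) , false)) (h (dartAt (start , 2F) , false)) (h (dartAt (start , 0F) , false)))
        (h ∘ toFlag)
    balanced⇒extends {h} (hα , hκ) = record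
      { edge   = λ k s → trans (cong (λ t → h ((edgeAt k , true) , not (s xor t))) (lookup-τ k)) (hα (edgeAt k , false) s)
      ; atPath = λ i → corner (path i)
      ; atLeaf = λ i → corner (leaf i)
      ; bound  = λ { 0F false → refl ; 0F true → sym (corner start 0F) ; 1F false → refl ; 1F true → sym (corner start 1F)
                   ; 2F false → refl ; 2F true → sym (corner start 2F) } }
      where
      corner : ∀ x → Corner S (h ∘ toFlag) x
      corner x j = trans (cong (λ p → h (dartAt (turnPlace p) , false)) (sym (placeOf-dartAt (x , j)))) (hκ (dartAt (x , j)))

    restrict : Σ (Flag halin → Bool) (Balanced (Vec.lookup σ)) → Total
    restrict (h , bal) = _ , _ , _ , shrink S τ _ (balanced⇒extends bal)

    extend : Total → Flag halin → Bool
    extend (U , L , O , ext) = grow S τ (initial U L O) ext ∘ fromFlag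

    extend-balanced : ∀ t → Balanced (Vec.lookup σ) (extend t)
    extend-balanced (U , L , O , ext) = along , λ d → trans (cong (λ p → h (p , false)) (fromDart-toDart _))
        (trans (corner (proj₁ (placeOf d)) (proj₂ (placeOf d))) (cong (λ p → h (p , true)) (place-locate S (fromDart d))))
      where
      h = grow S τ (initial U L O) ext
      E = grow-extends S τ (initial U L O) ext
      along : ∀ d s → h (fromDart (opposite d) , not (s xor Vec.lookup σ (proj₁ d))) ≡ h (fromDart d , s)
      along (k , false) s = trans (cong (λ t → h ((slotOf k , true) , not (s xor t))) (sym (lookup-τ′ k))) (edge E (slotOf k) s)
      along (k , true)  s = trans (cong (λ t → h ((slotOf k , false) , not (s xor t))) (sym (lookup-τ′ k))) (opposite-edge E (slotOf k) s)
      corner : ∀ x → Corner S h x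
      corner start    0F = trans (bound E 1F false) (sym (bound E 0F true))
      corner start    1F = trans (bound E 2F false) (sym (bound E 1F true))
      corner start    2F = trans (bound E 0F false) (sym (bound E 2F true))
      corner (path i) j  = atPath E i j
      corner (leaf i) j  = atLeaf E i j

    extend-restrict : ∀ h x → extend (restrict h) x ≡ proj₁ h x
    extend-restrict (h , bal) (d , s) =
      trans (grow-shrink S τ _ (balanced⇒extends bal) (fromDart d , s)) (cong (λ d′ → h (d′ , s)) (toDart-fromDart d))

    extend-injective : ∀ {t t′} → extend t ≗ extend t′ → t ≡ t′
    extend-injective {U , L , O , ext} {U′ , L′ , O′ , ext′} eq with corner 1F | corner 2F | corner 0F
      where
      eq′ : grow S τ (initial U L O) ext ≗ grow S τ (initial U′ L′ O′) ext′
      eq′ (d , s) = subst (λ d′ → grow S τ (initial U L O) ext (d′ , s) ≡ grow S τ (initial U′ L′ O′) ext′ (d′ , s))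
        (fromDart-toDart d) (eq (toDart d , s))
      corner : ∀ j → value (initial U L O) j false ≡ value (initial U′ L′ O′) j false
      corner j = trans (sym (bound (grow-extends S τ (initial U L O) ext) j false))
        (trans (eq′ (place S (start , j) , false)) (bound (grow-extends S τ (initial U′ L′ O′) ext′) j false))
    ... | refl | refl | refl = cong (λ e → U , L , O , e) (grow-injective S τ (initial U L O) ext ext′ λ (d , s) →
        subst (λ d′ → grow S τ (initial U L O) ext (d′ , s) ≡ grow S τ (initial U L O) ext′ (d′ , s))
          (fromDart-toDart d) (eq (toDart d , s)))

  balanced-count : Solutions (Flag halin) (Balanced (Vec.lookup σ)) hasSize flagFunctions S τ
  balanced-count = mkInverse {B = ≡-Setoid Total} restrict (λ t → extend t , extend-balanced t)
      (λ {h} {h′} eq → extend-injective λ x → trans (extend-restrict h x) (trans (eq x) (sym (extend-restrict h′ x))))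
      (λ { refl x → refl })
      (λ t → extend-injective (extend-restrict (extend t , extend-balanced t)))
      extend-restrict
    ⨾ ∑ᵇ-size (λ U → ∑ᵇ-size λ L → ∑ᵇ-size λ O → Extension-size S τ (initial U L O))

-- The transfer of kernel vectors

Transfer : Set
Transfer = (a b r t : Bool) → ℕ

-- One face is completed: `d` is its diagonal entry, `y` its entry with the next face `c` on the
-- same side and `g` that with the face across the path. Its equation is now checked, and its
-- contributions to the equations of the two faces that stay open are passed on as partial sums.
step : Side → (g y d : Bool) → Transfer → Transfer
step above g y d W a b r t = ∑ᵇ λ c → ⟦ r ⇔ᵇ ((d ∧ a) xor ((y ∧ c) xor (g ∧ b))) ⟧ * W c b (y ∧ a) (t xor (g ∧ a))
step below g y d W a b r t = ∑ᵇ λ c → ⟦ t ⇔ᵇ ((d ∧ b) xor ((y ∧ c) xor (g ∧ a))) ⟧ * W a c (r xor (g ∧ b)) (y ∧ b)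

run : ((g x z : Bool) → Transfer) → ∀ S → Vec Bool (slots S) → Transfer
run K []      (g ∷ x ∷ z ∷ []) = K g x z
run K (s ∷ S) (g ∷ y ∷ d ∷ τ)  = step s g y d (run K S τ)

close : (g x z : Bool) → Transfer
close g x z a b r t = ⟦ r ⇔ᵇ ((x ∧ a) xor (g ∧ b)) ⟧ * ⟦ t ⇔ᵇ ((z ∧ b) xor (g ∧ a)) ⟧

-- transfer S τ a b r t counts the ways to continue a vector with the values a and b on the current faces
-- above and below the path, whose equations have the partial sums r and t, to a kernel vector.
transfer : ∀ S → Vec Bool (slots S) → Transfer
transfer = run close

total : Transfer → ℕ
total W = ∑ᵇ λ a → ∑ᵇ λ b → W a b false false

kernelSize : ∀ S → Vec Bool (slots S) → ℕ
kernelSize S τ = total (transfer S τ)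

-- Turns Laplacian weights into matrix entries: the diagonal entries collect the weights of the
-- adjacent off-diagonal entries, those of earlier steps being collected in p and q.
laplacian : ∀ S (p q : Bool) → Vec Bool (slots S) → Vec Bool (slots S)
laplacian []          p q (g ∷ x ∷ z ∷ []) = g ∷ (x xor (g xor p)) ∷ (z xor (g xor q)) ∷ []
laplacian (above ∷ S) p q (g ∷ y ∷ d ∷ τ)  = g ∷ y ∷ (d xor (g xor (y xor p))) ∷ laplacian S y (q xor g) τ
laplacian (below ∷ S) p q (g ∷ y ∷ d ∷ τ)  = g ∷ y ∷ (d xor (g xor (y xor q))) ∷ laplacian S (p xor g) y τ

-- The change of coordinates is triangular: once the preceding slots are fixed, each slot is kept or
-- shifted by a constant.
laplacian-sum : ∀ S p q F → ∑ⱽ (slots S) (F ∘ laplacian S p q) ≡ ∑ⱽ (slots S) F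
laplacian-sum [] p q F = ∑ᵇ-cong λ g → trans
  (∑ᵇ-cong λ x → ∑ᵇ-xor (g xor q) (λ z → F (g ∷ (x xor (g xor p)) ∷ z ∷ [])))
  (∑ᵇ-xor (g xor p) (λ x → ∑ᵇ λ z → F (g ∷ x ∷ z ∷ [])))
laplacian-sum (above ∷ S) p q F = ∑ᵇ-cong λ g → ∑ᵇ-cong λ y → trans
  (∑ᵇ-cong λ d → laplacian-sum S y (q xor g) (λ τ → F (g ∷ y ∷ (d xor (g xor (y xor p))) ∷ τ)))
  (∑ᵇ-xor (g xor (y xor p)) (λ d → ∑ⱽ (slots S) λ τ → F (g ∷ y ∷ d ∷ τ)))
laplacian-sum (below ∷ S) p q F = ∑ᵇ-cong λ g → ∑ᵇ-cong λ y → trans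
  (∑ᵇ-cong λ d → laplacian-sum S (p xor g) y (λ τ → F (g ∷ y ∷ (d xor (g xor (y xor q))) ∷ τ)))
  (∑ᵇ-xor (g xor (y xor q)) (λ d → ∑ⱽ (slots S) λ τ → F (g ∷ y ∷ d ∷ τ)))

-- Flag functions against kernel vectors

guard-cong : ∀ {B B′ m n} → B ≡ B′ → (B ≡ true → m ≡ n) → ⟦ B ⟧ * m ≡ ⟦ B′ ⟧ * n
guard-cong {false} refl eq = refl
guard-cong {true}  refl eq = cong (1 *_) (eq refl)

-- The state of the transfer is read off the boundary values: a and b are the differences across the cut
-- edges of the cycle, r and t the differences along the two faces.
upper lower upperSum lowerSum : State → Bool
upper    (state vf vt af at bf bt) = af xor at
lower    (state vf vt af at bf bt) = bf xor bt
upperSum (state vf vt af at bf bt) = vf xor at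
lowerSum (state vf vt af at bf bt) = vt xor bf

-- The conservation law for the cut: the differences on its three edges sum to zero. Hence the path
-- edge has the difference `upper xor lower`, which is how the two face values determine it.
consistent : State → Bool
consistent (state vf vt af at bf bt) = not ((vf xor vt) xor ((af xor at) xor (bf xor bt)))

-- `upperSum` sums weight times difference over the edges passed on the open face, including the
-- share of the face's own value. Since `laplacian` moves that share to the diagonal, `p ∧ upper` is
-- taken off here, and likewise with `q` below.
transferAt : ∀ S → Vec Bool (slots S) → Bool → Bool → State → ℕ
transferAt S τ p q st = transfer S (laplacian S p q τ) (upper st) (lower st)
  (upperSum st xor (p ∧ upper st)) (lowerSum st xor (q ∧ lower st))

transfer-cong : ∀ S τ {a a′ b b′ r r′ t t′} → a ≡ a′ → b ≡ b′ → r ≡ r′ → t ≡ t′ →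
                transfer S τ a b r t ≡ transfer S τ a′ b′ r′ t′
transfer-cong S τ refl refl refl refl = refl

private
  state₆ : ∀ {A : Set} → (State → A) → Fn 6 A
  state₆ f vf vt af at bf bt = f (state vf vt af at bf bt)

  sumAbove sumBelow : (g y d p c : Bool) → State → Bool
  sumAbove g y d p c st = (upperSum st xor (p ∧ upper st)) ⇔ᵇ
    (((d xor (g xor (y xor p))) ∧ upper st) xor ((y ∧ c) xor (g ∧ lower st)))
  sumBelow g y d q c st = (lowerSum st xor (q ∧ lower st)) ⇔ᵇ
    (((d xor (g xor (y xor q))) ∧ lower st) xor ((y ∧ c) xor (g ∧ upper st)))

  shiftAbove shiftBelow : Bool → State → Bool
  shiftAbove g (state vf vt af at bf bt) = carry g vf vt true xor (af xor at)
  shiftBelow g (state vf vt af at bf bt) = carry g vf vt false xor (bf xor bt)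

  goodAbove goodBelow : (g y d k : Bool) → State → Bool
  goodAbove g y d k st = checkAbove₁ g y d k st ⇔ᵇ checkAbove₂ g y d k st
  goodBelow g y d k st = checkBelow₁ g y d k st ⇔ᵇ checkBelow₂ g y d k st

  above-good : Everywhere 11 (λ g y d k p → state₆ consistent)
    (λ g y d k p → state₆ (goodAbove g y d k))
    (λ g y d k p → state₆ λ st → sumAbove g y d p (k xor shiftAbove g st) st)
  above-good = booleanIf 11 _ _ _ refl

  above-consistent : Everywhere 10 (λ g y d k → state₆ λ st → consistent st ∧ goodAbove g y d k st)
    (λ g y d k → state₆ λ st → consistent (afterAbove g y d k st)) (λ g y d k → state₆ λ st → true)
  above-consistent = booleanIf 10 _ _ _ refl

  above-upper : Everywhere 10 (λ g y d k → state₆ λ st → consistent st ∧ goodAbove g y d k st)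
    (λ g y d k → state₆ λ st → upper (afterAbove g y d k st)) (λ g y d k → state₆ λ st → k xor shiftAbove g st)
  above-upper = booleanIf 10 _ _ _ refl

  above-upperSum : Everywhere 10 (λ g y d k → state₆ λ st → consistent st ∧ goodAbove g y d k st)
    (λ g y d k → state₆ λ st → upperSum (afterAbove g y d k st) xor (y ∧ upper (afterAbove g y d k st)))
    (λ g y d k → state₆ λ st → y ∧ upper st)
  above-upperSum = booleanIf 10 _ _ _ refl

  above-lowerSum : Everywhere 11 (λ g y d k q → state₆ λ st → consistent st ∧ goodAbove g y d k st)
    (λ g y d k q → state₆ λ st → lowerSum (afterAbove g y d k st) xor ((q xor g) ∧ lower st))
    (λ g y d k q → state₆ λ st → (lowerSum st xor (q ∧ lower st)) xor (g ∧ upper st))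
  above-lowerSum = booleanIf 11 _ _ _ refl

  below-good : Everywhere 11 (λ g y d k q → state₆ consistent)
    (λ g y d k q → state₆ (goodBelow g y d k))
    (λ g y d k q → state₆ λ st → sumBelow g y d q (k xor shiftBelow g st) st)
  below-good = booleanIf 11 _ _ _ refl

  below-consistent : Everywhere 10 (λ g y d k → state₆ λ st → consistent st ∧ goodBelow g y d k st)
    (λ g y d k → state₆ λ st → consistent (afterBelow g y d k st)) (λ g y d k → state₆ λ st → true)
  below-consistent = booleanIf 10 _ _ _ refl

  below-lower : Everywhere 10 (λ g y d k → state₆ λ st → consistent st ∧ goodBelow g y d k st)
    (λ g y d k → state₆ λ st → lower (afterBelow g y d k st)) (λ g y d k → state₆ λ st → k xor shiftBelow g st)
  below-lower = booleanIf 10 _ _ _ refl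

  below-upperSum : Everywhere 11 (λ g y d k p → state₆ λ st → consistent st ∧ goodBelow g y d k st)
    (λ g y d k p → state₆ λ st → upperSum (afterBelow g y d k st) xor ((p xor g) ∧ upper st))
    (λ g y d k p → state₆ λ st → (upperSum st xor (p ∧ upper st)) xor (g ∧ lower st))
  below-upperSum = booleanIf 11 _ _ _ refl

  below-lowerSum : Everywhere 10 (λ g y d k → state₆ λ st → consistent st ∧ goodBelow g y d k st)
    (λ g y d k → state₆ λ st → lowerSum (afterBelow g y d k st) xor (y ∧ lower (afterBelow g y d k st)))
    (λ g y d k → state₆ λ st → y ∧ lower st)
  below-lowerSum = booleanIf 10 _ _ _ refl

-- The free corner value `k` and the value `c` of the next face differ by a shift that the state
-- fixes, so summing over one is summing over the other. What remains are Boolean identities under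
-- the conservation law.
extensions≡transfer : ∀ S p q τ st → consistent st ≡ true → extensions S τ st ≡ transferAt S τ p q st
extensions≡transfer [] p q (g ∷ x ∷ z ∷ []) (state vf vt af at bf bt) =
  exhaust ℕ._≟_ 11 (λ g x z p q → state₆ consistent)
    (λ g x z p q → state₆ (extensions [] (g ∷ x ∷ z ∷ []))) (λ g x z p q → state₆ (transferAt [] (g ∷ x ∷ z ∷ []) p q))
    refl g x z p q vf vt af at bf bt
extensions≡transfer (above ∷ S) p q (g ∷ y ∷ d ∷ τ) st@(state vf vt af at bf bt) con = trans
  (∑ᵇ-cong λ k → guard-cong (above-good g y d k p vf vt af at bf bt con) λ good →
    let h = ∧-intro con good in trans
      (extensions≡transfer S y (q xor g) τ (afterAbove g y d k st) (above-consistent g y d k vf vt af at bf bt h))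
      (transfer-cong S _ (above-upper g y d k vf vt af at bf bt h) refl
        (above-upperSum g y d k vf vt af at bf bt h) (above-lowerSum g y d k q vf vt af at bf bt h)))
  (∑ᵇ-xor (shiftAbove g st) (λ c → ⟦ sumAbove g y d p c st ⟧ * transfer S (laplacian S y (q xor g) τ) c (lower st)
    (y ∧ upper st) ((lowerSum st xor (q ∧ lower st)) xor (g ∧ upper st))))
extensions≡transfer (below ∷ S) p q (g ∷ y ∷ d ∷ τ) st@(state vf vt af at bf bt) con = trans
  (∑ᵇ-cong λ k → guard-cong (below-good g y d k q vf vt af at bf bt con) λ good →
    let h = ∧-intro con good in trans
      (extensions≡transfer S (p xor g) y τ (afterBelow g y d k st) (below-consistent g y d k vf vt af at bf bt h))
      (transfer-cong S _ refl (below-lower g y d k vf vt af at bf bt h)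
        (below-upperSum g y d k p vf vt af at bf bt h) (below-lowerSum g y d k vf vt af at bf bt h)))
  (∑ᵇ-xor (shiftBelow g st) (λ c → ⟦ sumBelow g y d q c st ⟧ * transfer S (laplacian S (p xor g) y τ) (upper st) c
    ((upperSum st xor (p ∧ upper st)) xor (g ∧ lower st)) (y ∧ lower st)))

-- The initial face values are U + O and L + O. They are unchanged when U, L and O are all
-- complemented, so each pair of values arises from two triples.
flagFunctions≡kernelSize : ∀ S τ → flagFunctions S τ ≡ 2 * kernelSize S (laplacian S false false τ)
flagFunctions≡kernelSize S τ = trans
  (∑ᵇ-cong λ U → ∑ᵇ-cong λ L → ∑ᵇ-cong λ O → trans
    (extensions≡transfer S false false τ (initial U L O) (boolean 3 (λ U L O → consistent (initial U L O)) (λ U L O → true) refl U L O))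
    (transfer-cong S _ refl refl (boolean 1 (λ x → (x xor x) xor false) (λ x → false) refl U)
      (boolean 1 (λ x → (x xor x) xor false) (λ x → false) refl L)))
  (solve 4 (λ w x y z → ((w :+ z) :+ (y :+ x)) :+ ((x :+ y) :+ (z :+ w)) := con 2 :* ((w :+ y) :+ (x :+ z))) refl
    (F false false) (F true false) (F false true) (F true true))
  where
  open ℕSolver.+-*-Solver
  F : Bool → Bool → ℕ
  F a b = transfer S (laplacian S false false τ) a b false false

-- The Euler-genus polynomials as rank distributions

-- Rank-nullity without subtraction: `2 + length S` is the number of planar faces other than the
-- outer one.
hasRank? : ∀ S i → Decidable λ τ → kernelSize S τ * 2 ^ i ≡ 2 ^ (2 + length S)
hasRank? S i τ = kernelSize S τ * 2 ^ i ℕ.≟ 2 ^ (2 + length S)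

rankCount : ∀ S → Poly
rankCount S i = ∑ⱽ (slots S) λ τ → ⟦ does (hasRank? S i τ) ⟧

slots-length : ∀ S → slots S ≡ 3 + 3 * length S
slots-length []      = refl
slots-length (s ∷ S) = trans (cong (3 +_) (slots-length S))
  (solve 1 (λ n → con 6 :+ con 3 :* n := con 3 :+ con 3 :* (con 1 :+ n)) refl (length S))
  where open ℕSolver.+-*-Solver

does-cong : ∀ {P Q : Set} (P? : Dec P) (Q? : Dec Q) → (P → Q) → (Q → P) → does P? ≡ does Q?
does-cong (yes p) Q? to from = sym (dec-true Q? (to p))
does-cong (no ¬p) Q? to from = sym (dec-false Q? (¬p ∘ from))

2^-cancel : ∀ n {x y} → 2 ^ n * x ≡ 2 ^ n * y → x ≡ y
2^-cancel n {x} {y} = ℕ.*-cancelˡ-≡ x y (2 ^ n) {{ℕ.m^n≢0 2 n}}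

-- The graph has order 2 + 2ℓ and size 3 + 3ℓ. With twice the kernel size in place of 2 to the
-- number of faces, Euler's formula leaves kernel size times 2^i equal to 2^(2+ℓ): the Euler-genus
-- is the rank.
ℰ-halin : ∀ S T i → ℰ (Caterpillar.halin S) T i ≡ 2 * rankCount S i
ℰ-halin S T i = trans (CubicCount.ℰ-cubic halin cubic T (λ σ → flagFunctions S (HalinFlags.ladderTwists S σ))
    (λ σ → HalinFlags.balanced-count S σ) (v zero) i) (cong (2 *_) (begin
  count condition? (vectors bits size)
    ≡⟨ count-bijection condition? condition′? (vectors-unique bits-unique size) (vectors-unique bits-unique (slots S))
         toLadder fromLadder (λ _ c → ∈-vectors ∈-bits _ , c)
         (λ {τ} _ c → ∈-vectors ∈-bits _ , subst Condition (sym (toLadder-fromLadder τ)) c)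
         (λ {σ} _ _ → fromLadder-toLadder σ) (λ {τ} _ _ → toLadder-fromLadder τ) ⟩
  count condition′? (vectors bits (slots S))
    ≡⟨ count-vectors (slots S) condition′? ⟩
  ∑ⱽ (slots S) (λ τ → ⟦ does (condition′? τ) ⟧)
    ≡⟨ ∑ⱽ-cong (slots S) (λ τ → cong ⟦_⟧ (does-cong (condition′? τ) (hasRank? S i (laplacian S false false τ))
         (condition⇒rank τ) (rank⇒condition τ))) ⟩
  ∑ⱽ (slots S) (λ τ → ⟦ does (hasRank? S i (laplacian S false false τ)) ⟧)
    ≡⟨ laplacian-sum S false false (λ τ → ⟦ does (hasRank? S i τ) ⟧) ⟩
  rankCount S i ∎))
  where
  open ≡-Reasoning
  open Caterpillar S using (halin; v)
  open Graph halin
  open Halin S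
  ℓ = length S
  size≡ : size ≡ 3 + 3 * ℓ
  size≡ = trans (sym (↔⇒≡ edgePermutation)) (slots-length S)
  Condition : Vec Bool (slots S) → Set
  Condition τ = 2 ^ order * flagFunctions S τ * 2 ^ i ≡ 2 ^ (2 + size)
  condition′? : Decidable Condition
  condition′? τ = 2 ^ order * flagFunctions S τ * 2 ^ i ℕ.≟ 2 ^ (2 + size)
  toLadder : Vec Bool size → Vec Bool (slots S)
  toLadder = HalinFlags.ladderTwists S
  condition? : Decidable (Condition ∘ toLadder)
  condition? = condition′? ∘ toLadder
  fromLadder : Vec Bool (slots S) → Vec Bool size
  fromLadder τ = Vec.tabulate (Vec.lookup τ ∘ slotOf)
  toLadder-fromLadder : ∀ τ → toLadder (fromLadder τ) ≡ τ
  toLadder-fromLadder τ = trans (Vec.tabulate-cong λ k → trans (Vec.lookup∘tabulate (Vec.lookup τ ∘ slotOf) (edgeAt k))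
    (cong (Vec.lookup τ) (slotOf-edgeAt k))) (Vec.tabulate∘lookup τ)
  fromLadder-toLadder : ∀ σ → fromLadder (toLadder σ) ≡ σ
  fromLadder-toLadder σ = trans (Vec.tabulate-cong λ k → trans (Vec.lookup∘tabulate (Vec.lookup σ ∘ edgeAt) (slotOf k))
    (cong (Vec.lookup σ) (edgeAt-slotOf k))) (Vec.tabulate∘lookup σ)
  scale : ∀ τ → 2 ^ order * flagFunctions S τ * 2 ^ i
              ≡ 2 ^ suc order * (kernelSize S (laplacian S false false τ) * 2 ^ i)
  scale τ = trans (cong (λ n → 2 ^ order * n * 2 ^ i) (flagFunctions≡kernelSize S τ))
    (solve 3 (λ o n j → (o :* (con 2 :* n)) :* j := (con 2 :* o) :* (n :* j)) refl
      (2 ^ order) (kernelSize S (laplacian S false false τ)) (2 ^ i))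
    where open ℕSolver.+-*-Solver
  scale′ : 2 ^ (2 + size) ≡ 2 ^ suc order * 2 ^ (2 + ℓ)
  scale′ = trans (cong (2 ^_) (trans (cong (2 +_) size≡)
      (solve 1 (λ n → con 5 :+ con 3 :* n := (con 1 :+ ((con 2 :+ n) :+ n)) :+ (con 2 :+ n)) refl ℓ)))
    (ℕ.^-distribˡ-+-* 2 (suc order) (2 + ℓ))
    where open ℕSolver.+-*-Solver
  condition⇒rank : ∀ τ → Condition τ → kernelSize S (laplacian S false false τ) * 2 ^ i ≡ 2 ^ (2 + ℓ)
  condition⇒rank τ c = 2^-cancel (suc order) (trans (sym (scale τ)) (trans c scale′))
  rank⇒condition : ∀ τ → kernelSize S (laplacian S false false τ) * 2 ^ i ≡ 2 ^ (2 + ℓ) → Condition τ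
  rank⇒condition τ r = trans (scale τ) (trans (cong (2 ^ suc order *_) r) (sym scale′))

-- Removing the last faces

infix 4 _≋_
_≋_ : Transfer → Transfer → Set
W ≋ W′ = ∀ a b r t → W a b r t ≡ W′ a b r t

-- Transfer functions are only compared pointwise, so whatever is computed from them has to respect
-- that equality.
Extensional : (Transfer → ℕ) → Set
Extensional Ψ = ∀ {W W′} → W ≋ W′ → Ψ W ≡ Ψ W′

double : Transfer → Transfer
double W a b r t = 2 * W a b r t

step-cong : ∀ s g y d {W W′} → W ≋ W′ → step s g y d W ≋ step s g y d W′
step-cong above g y d eq a b r t =
  ∑ᵇ-cong λ c → cong (⟦ r ⇔ᵇ ((d ∧ a) xor ((y ∧ c) xor (g ∧ b))) ⟧ *_) (eq c b (y ∧ a) (t xor (g ∧ a)))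
step-cong below g y d eq a b r t =
  ∑ᵇ-cong λ c → cong (⟦ t ⇔ᵇ ((d ∧ b) xor ((y ∧ c) xor (g ∧ a))) ⟧ *_) (eq a c (r xor (g ∧ b)) (y ∧ b))

guard-double : ∀ (B : Bool → Bool) (F : Bool → ℕ) → ∑ᵇ (λ c → ⟦ B c ⟧ * (2 * F c)) ≡ 2 * ∑ᵇ (λ c → ⟦ B c ⟧ * F c)
guard-double B F = solve 4 (λ p x q y → p :* (con 2 :* x) :+ q :* (con 2 :* y) := con 2 :* (p :* x :+ q :* y)) refl
  ⟦ B false ⟧ (F false) ⟦ B true ⟧ (F true)
  where open ℕSolver.+-*-Solver using (solve; _:+_; _:*_; _:=_; con)

step-double : ∀ s g y d W → step s g y d (double W) ≋ double (step s g y d W)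
step-double above g y d W a b r t = guard-double
  (λ c → r ⇔ᵇ ((d ∧ a) xor ((y ∧ c) xor (g ∧ b)))) (λ c → W c b (y ∧ a) (t xor (g ∧ a)))
step-double below g y d W a b r t = guard-double
  (λ c → t ⇔ᵇ ((d ∧ b) xor ((y ∧ c) xor (g ∧ a)))) (λ c → W a c (r xor (g ∧ b)) (y ∧ b))

sumOver : ((g x z : Bool) → Transfer) → ∀ S → (Transfer → ℕ) → ℕ
sumOver K S Ψ = ∑ⱽ (slots S) (Ψ ∘ run K S)

-- The face across the path from the last side s is deleted: its value is 0 and its equation is dropped.
closeDeleted : Side → (g x z : Bool) → Transfer
closeDeleted above g x z a b r t = ⟦ not b ⟧ * ⟦ r ⇔ᵇ (x ∧ a) ⟧
closeDeleted below g x z a b r t = ⟦ not a ⟧ * ⟦ t ⇔ᵇ (z ∧ b) ⟧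

-- Eliminating the last face w; its diagonal entry is the pivot in the first case, and in the last case the
-- pivot is its entry with the face before it.
above-diagonal : ∀ g y d g′ z → step above g y d (close g′ true z) ≋ close (g xor (g′ ∧ y)) (d xor y) (z xor g′)
above-diagonal = exhaust′ ℕ._≟_ 9 (λ g y d g′ z → step above g y d (close g′ true z))
  (λ g y d g′ z → close (g xor (g′ ∧ y)) (d xor y) (z xor g′)) refl

above-isolated : ∀ g d z → step above g false d (close false false z) ≋ double (close g d z)
above-isolated = exhaust′ ℕ._≟_ 7 (λ g d z → step above g false d (close false false z)) (λ g d z → double (close g d z)) refl

above-deleted : ∀ g d z → step above g false d (close true false z) ≋ closeDeleted above g d z
above-deleted = exhaust′ ℕ._≟_ 7 (λ g d z → step above g false d (close true false z)) (closeDeleted above) refl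

above-pair : ∀ g₁ y₁ d₁ g d g′ z → step above g₁ y₁ d₁ (step above g true d (close g′ false z))
                                 ≋ close (g₁ xor (g′ ∧ y₁)) d₁ (z xor (g′ ∧ d))
above-pair = exhaust′ ℕ._≟_ 11 (λ g₁ y₁ d₁ g d g′ z → step above g₁ y₁ d₁ (step above g true d (close g′ false z)))
  (λ g₁ y₁ d₁ g d g′ z → close (g₁ xor (g′ ∧ y₁)) d₁ (z xor (g′ ∧ d))) refl

below-diagonal : ∀ g y d g′ x → step below g y d (close g′ x true) ≋ close (g xor (g′ ∧ y)) (x xor g′) (d xor y)
below-diagonal = exhaust′ ℕ._≟_ 9 (λ g y d g′ x → step below g y d (close g′ x true))
  (λ g y d g′ x → close (g xor (g′ ∧ y)) (x xor g′) (d xor y)) refl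

below-isolated : ∀ g x d → step below g false d (close false x false) ≋ double (close g x d)
below-isolated = exhaust′ ℕ._≟_ 7 (λ g x d → step below g false d (close false x false)) (λ g x d → double (close g x d)) refl

below-deleted : ∀ g x d → step below g false d (close true x false) ≋ closeDeleted below g x d
below-deleted = exhaust′ ℕ._≟_ 7 (λ g x d → step below g false d (close true x false)) (closeDeleted below) refl

below-pair : ∀ g₁ y₁ d₁ g d g′ x → step below g₁ y₁ d₁ (step below g true d (close g′ x false))
                                 ≋ close (g₁ xor (g′ ∧ y₁)) (x xor (g′ ∧ d)) d₁
below-pair = exhaust′ ℕ._≟_ 11 (λ g₁ y₁ d₁ g d g′ x → step below g₁ y₁ d₁ (step below g true d (close g′ x false)))
  (λ g₁ y₁ d₁ g d g′ x → close (g₁ xor (g′ ∧ y₁)) (x xor (g′ ∧ d)) d₁) refl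

∑³ : (Bool → Bool → Bool → ℕ) → ℕ
∑³ F = ∑ᵇ λ x → ∑ᵇ λ y → ∑ᵇ λ z → F x y z

∑³-cong : ∀ {F G} → (∀ x y z → F x y z ≡ G x y z) → ∑³ F ≡ ∑³ G
∑³-cong eq = ∑ᵇ-cong λ x → ∑ᵇ-cong λ y → ∑ᵇ-cong λ z → eq x y z

∑³-shift : ∀ i j k F → ∑³ (λ x y z → F (x xor i) (y xor j) (z xor k)) ≡ ∑³ F
∑³-shift i j k F = trans (∑ᵇ-cong λ x → trans (∑ᵇ-cong λ y → ∑ᵇ-xor k (F (x xor i) (y xor j)))
  (∑ᵇ-xor j (λ y → ∑ᵇ (F (x xor i) y)))) (∑ᵇ-xor i (λ x → ∑ᵇ λ y → ∑ᵇ (F x y)))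

∑ᵇ-comm : ∀ (F : Bool → Bool → ℕ) → (∑ᵇ λ x → ∑ᵇ λ y → F x y) ≡ (∑ᵇ λ y → ∑ᵇ λ x → F x y)
∑ᵇ-comm F = CommutativeSemigroup.interchange ℕ.+-commutativeSemigroup
  (F false false) (F false true) (F true false) (F true true)

∑ᵇ-const : ∀ n → ∑ᵇ (λ _ → n) ≡ 2 * n
∑ᵇ-const n = cong (n +_) (sym (ℕ.+-identityʳ n))

∑ᵇ-* : ∀ c F → ∑ᵇ (λ b → c * F b) ≡ c * ∑ᵇ F
∑ᵇ-* c F = sym (ℕ.*-distribˡ-+ c (F false) (F true))

-- This brings to the front the whole row of the last face: `y` with the face before it, `x` on the
-- diagonal and `g′` with the face across the path. These entries distinguish the cases of the
-- elimination.
reorder-above : ∀ (F : Bool → Bool → Bool → Bool → Bool → Bool → ℕ) →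
  (∑³ λ g y d → ∑³ λ g′ x z → F g y d g′ x z) ≡ (∑³ λ y x g′ → ∑³ λ g d z → F g y d g′ x z)
reorder-above F = trans (∑ᵇ-comm λ g y → ∑ᵇ λ d → ∑³ λ g′ x z → F g y d g′ x z) (∑ᵇ-cong λ y → trans
  (∑ᵇ-cong λ g → trans (∑ᵇ-cong λ d → ∑ᵇ-comm λ g′ x → ∑ᵇ (F g y d g′ x))
    (∑ᵇ-comm λ d x → ∑ᵇ λ g′ → ∑ᵇ (F g y d g′ x)))
  (trans (∑ᵇ-comm λ g x → ∑ᵇ λ d → ∑ᵇ λ g′ → ∑ᵇ (F g y d g′ x)) (∑ᵇ-cong λ x → trans
    (∑ᵇ-cong λ g → ∑ᵇ-comm λ d g′ → ∑ᵇ (F g y d g′ x))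
    (∑ᵇ-comm λ g g′ → ∑ᵇ λ d → ∑ᵇ (F g y d g′ x)))))

reorder-below : ∀ (F : Bool → Bool → Bool → Bool → Bool → Bool → ℕ) →
  (∑³ λ g y d → ∑³ λ g′ x z → F g y d g′ x z) ≡ (∑³ λ y z g′ → ∑³ λ g x d → F g y d g′ x z)
reorder-below F = trans
  (∑³-cong λ g y d → ∑ᵇ-cong λ g′ → ∑ᵇ-comm λ x z → F g y d g′ x z)
  (trans (reorder-above λ g y d g′ z x → F g y d g′ x z)
    (∑³-cong λ y z g′ → ∑ᵇ-cong λ g → ∑ᵇ-comm λ d x → F g y d g′ x z))

∑³-linear : ∀ {F A B C D : Bool → Bool → Bool → ℕ} →
  (∀ x y z → F x y z ≡ 4 * A x y z + B x y z + C x y z + D x y z) →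
  ∑³ F ≡ 4 * ∑³ A + ∑³ B + ∑³ C + ∑³ D
∑³-linear {F} {A} {B} {C} {D} eq = lift₁
  {λ x → ∑ᵇ λ y → ∑ᵇ (F x y)} {λ x → ∑ᵇ λ y → ∑ᵇ (A x y)} {λ x → ∑ᵇ λ y → ∑ᵇ (B x y)}
  {λ x → ∑ᵇ λ y → ∑ᵇ (C x y)} {λ x → ∑ᵇ λ y → ∑ᵇ (D x y)}
  λ x → lift₁ {λ y → ∑ᵇ (F x y)} {λ y → ∑ᵇ (A x y)} {λ y → ∑ᵇ (B x y)} {λ y → ∑ᵇ (C x y)} {λ y → ∑ᵇ (D x y)}
  λ y → lift₁ {F x y} {A x y} {B x y} {C x y} {D x y} (eq x y)
  where
  lift₁ : ∀ {F A B C D : Bool → ℕ} → (∀ x → F x ≡ 4 * A x + B x + C x + D x) →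
          ∑ᵇ F ≡ 4 * ∑ᵇ A + ∑ᵇ B + ∑ᵇ C + ∑ᵇ D
  lift₁ {F} {A} {B} {C} {D} eq = trans (cong₂ _+_ (eq false) (eq true))
    (solve 8 (λ a b c d a′ b′ c′ d′ → (con 4 :* a :+ b :+ c :+ d) :+ (con 4 :* a′ :+ b′ :+ c′ :+ d′)
        := con 4 :* (a :+ a′) :+ (b :+ b′) :+ (c :+ c′) :+ (d :+ d′)) refl
      (A false) (B false) (C false) (D false) (A true) (B true) (C true) (D true))
    where open ℕSolver.+-*-Solver using (solve; _:+_; _:*_; _:=_; con)

∑³-* : ∀ c F → ∑³ (λ x y z → c * F x y z) ≡ c * ∑³ F
∑³-* c F = trans (∑ᵇ-cong λ x → trans (∑ᵇ-cong λ y → ∑ᵇ-* c (F x y)) (∑ᵇ-* c (λ y → ∑ᵇ (F x y))))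
  (∑ᵇ-* c (λ x → ∑ᵇ λ y → ∑ᵇ (F x y)))

module _ (Ψ : Transfer → ℕ) (ext : Extensional Ψ) where

  -- After the elimination `g` has disappeared, while `d` and `y₁` merely shift `z` and `g₁`. These
  -- three bits give the 8; the remaining factor 2 of the 16 is the sum over `g′`.
  pair-above : ∀ g′ → (∑³ λ g₁ y₁ d₁ → ∑³ λ g d z → Ψ (step above g₁ y₁ d₁ (step above g true d (close g′ false z))))
                    ≡ 8 * sumOver close [] Ψ
  pair-above g′ = begin
    (∑³ λ g₁ y₁ d₁ → ∑³ λ g d z → Ψ (step above g₁ y₁ d₁ (step above g true d (close g′ false z))))
      ≡⟨ ∑³-cong (λ g₁ y₁ d₁ → ∑³-cong λ g d z → ext (above-pair g₁ y₁ d₁ g d g′ z)) ⟩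
    (∑³ λ g₁ y₁ d₁ → ∑³ λ g d z → Ψ (close (g₁ xor (g′ ∧ y₁)) d₁ (z xor (g′ ∧ d))))
      ≡⟨ ∑³-cong (λ g₁ y₁ d₁ → trans (∑ᵇ-const (∑ᵇ λ d → ∑ᵇ λ z → Ψ (close (g₁ xor (g′ ∧ y₁)) d₁ (z xor (g′ ∧ d))))) (cong (2 *_)
           (∑ᵇ-cong λ d → ∑ᵇ-xor (g′ ∧ d) (λ z → Ψ (close (g₁ xor (g′ ∧ y₁)) d₁ z))))) ⟩
    (∑³ λ g₁ y₁ d₁ → 2 * ∑ᵇ λ d → ∑ᵇ λ z → Ψ (close (g₁ xor (g′ ∧ y₁)) d₁ z))
      ≡⟨ ∑³-cong (λ g₁ y₁ d₁ → trans (cong (2 *_) (∑ᵇ-const (∑ᵇ λ z → Ψ (close (g₁ xor (g′ ∧ y₁)) d₁ z)))) (sym (ℕ.*-assoc 2 2 (∑ᵇ λ z → Ψ (close (g₁ xor (g′ ∧ y₁)) d₁ z))))) ⟩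
    (∑³ λ g₁ y₁ d₁ → 4 * ∑ᵇ λ z → Ψ (close (g₁ xor (g′ ∧ y₁)) d₁ z))
      ≡⟨ ∑³-* 4 (λ g₁ y₁ d₁ → ∑ᵇ λ z → Ψ (close (g₁ xor (g′ ∧ y₁)) d₁ z)) ⟩
    4 * (∑³ λ g₁ y₁ d₁ → ∑ᵇ λ z → Ψ (close (g₁ xor (g′ ∧ y₁)) d₁ z))
      ≡⟨ cong (4 *_) (trans (∑ᵇ-comm λ g₁ y₁ → ∑ᵇ λ d₁ → ∑ᵇ λ z → Ψ (close (g₁ xor (g′ ∧ y₁)) d₁ z)) (trans
           (∑ᵇ-cong λ y₁ → ∑ᵇ-xor (g′ ∧ y₁) (λ g → ∑ᵇ λ x → ∑ᵇ λ z → Ψ (close g x z))) (∑ᵇ-const (sumOver close [] Ψ)))) ⟩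
    4 * (2 * sumOver close [] Ψ)
      ≡⟨ ℕ.*-assoc 4 2 (sumOver close [] Ψ) ⟨
    8 * sumOver close [] Ψ ∎
    where open ≡-Reasoning

  pair-below : ∀ g′ → (∑³ λ g₁ y₁ d₁ → ∑³ λ g x d → Ψ (step below g₁ y₁ d₁ (step below g true d (close g′ x false))))
                    ≡ 8 * sumOver close [] Ψ
  pair-below g′ = begin
    (∑³ λ g₁ y₁ d₁ → ∑³ λ g x d → Ψ (step below g₁ y₁ d₁ (step below g true d (close g′ x false))))
      ≡⟨ ∑³-cong (λ g₁ y₁ d₁ → ∑³-cong λ g x d → ext (below-pair g₁ y₁ d₁ g d g′ x)) ⟩
    (∑³ λ g₁ y₁ d₁ → ∑³ λ g x d → Ψ (close (g₁ xor (g′ ∧ y₁)) (x xor (g′ ∧ d)) d₁))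
      ≡⟨ ∑³-cong (λ g₁ y₁ d₁ → trans (∑ᵇ-const (∑ᵇ λ x → ∑ᵇ λ d → Ψ (close (g₁ xor (g′ ∧ y₁)) (x xor (g′ ∧ d)) d₁))) (cong (2 *_) (trans (∑ᵇ-comm λ x d → Ψ (close (g₁ xor (g′ ∧ y₁)) (x xor (g′ ∧ d)) d₁))
           (∑ᵇ-cong λ d → ∑ᵇ-xor (g′ ∧ d) (λ x → Ψ (close (g₁ xor (g′ ∧ y₁)) x d₁)))))) ⟩
    (∑³ λ g₁ y₁ d₁ → 2 * ∑ᵇ λ d → ∑ᵇ λ x → Ψ (close (g₁ xor (g′ ∧ y₁)) x d₁))
      ≡⟨ ∑³-cong (λ g₁ y₁ d₁ → trans (cong (2 *_) (∑ᵇ-const (∑ᵇ λ x → Ψ (close (g₁ xor (g′ ∧ y₁)) x d₁)))) (sym (ℕ.*-assoc 2 2 (∑ᵇ λ x → Ψ (close (g₁ xor (g′ ∧ y₁)) x d₁))))) ⟩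
    (∑³ λ g₁ y₁ d₁ → 4 * ∑ᵇ λ x → Ψ (close (g₁ xor (g′ ∧ y₁)) x d₁))
      ≡⟨ ∑³-* 4 (λ g₁ y₁ d₁ → ∑ᵇ λ x → Ψ (close (g₁ xor (g′ ∧ y₁)) x d₁)) ⟩
    4 * (∑³ λ g₁ y₁ d₁ → ∑ᵇ λ x → Ψ (close (g₁ xor (g′ ∧ y₁)) x d₁))
      ≡⟨ cong (4 *_) (trans (∑ᵇ-comm λ g₁ y₁ → ∑ᵇ λ d₁ → ∑ᵇ λ x → Ψ (close (g₁ xor (g′ ∧ y₁)) x d₁)) (trans
           (∑ᵇ-cong λ y₁ → trans (∑ᵇ-xor (g′ ∧ y₁) (λ g → ∑ᵇ λ d → ∑ᵇ λ x → Ψ (close g x d)))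
             (∑ᵇ-cong λ g → ∑ᵇ-comm λ d x → Ψ (close g x d))) (∑ᵇ-const (sumOver close [] Ψ)))) ⟩
    4 * (2 * sumOver close [] Ψ)
      ≡⟨ ℕ.*-assoc 4 2 (sumOver close [] Ψ) ⟨
    8 * sumOver close [] Ψ ∎
    where open ≡-Reasoning

  -- The terms belong to a nonzero diagonal entry of the last face, to a zero row, to a row with
  -- only the entry across the path, and to a pivot with the face before. `double` stays inside `Ψ`
  -- because `Ψ` will be a test of the kernel size and is not linear.
  EarRemoval : Side → Set
  EarRemoval s = sumOver close (s ∷ s ∷ []) Ψ
    ≡ 4 * sumOver close (s ∷ []) Ψ + sumOver close (s ∷ []) (Ψ ∘ double)
    + sumOver (closeDeleted s) (s ∷ []) Ψ + 16 * sumOver close [] Ψ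

  private
    collect : ∀ {P : Bool → Bool → Bool → ℕ} {A X D} → (∀ g′ → P false true g′ ≡ A) → (∀ g′ → P true true g′ ≡ A) →
              P false false false ≡ X → P false false true ≡ D →
              ∑³ P ≡ 4 * A + X + D + (P true false false + P true false true)
    collect {P} {A} {X} {D} p q r s = trans
      (cong₂ _+_ (cong₂ _+_ (cong₂ _+_ r s) (cong₂ _+_ (p false) (p true)))
        (cong (P true false false + P true false true +_) (cong₂ _+_ (q false) (q true))))
      (solve 5 (λ a x d e f → ((x :+ d) :+ (a :+ a)) :+ ((e :+ f) :+ (a :+ a)) := con 4 :* a :+ x :+ d :+ (e :+ f)) refl
        A X D (P true false false) (P true false true))
      where open ℕSolver.+-*-Solver using (solve; _:+_; _:*_; _:=_; con)

    twice : ∀ {m n k} → m ≡ 8 * k → n ≡ 8 * k → m + n ≡ 16 * k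
    twice {k = k} refl refl = sym (ℕ.*-distribʳ-+ k 8 8)

    ∑³-+ : ∀ F G → (∑³ λ x y z → F x y z + G x y z) ≡ ∑³ F + ∑³ G
    ∑³-+ F G = trans (∑ᵇ-cong λ x → trans (∑ᵇ-cong λ y → ∑ᵇ-+ (F x y) (G x y)) (∑ᵇ-+ (λ y → ∑ᵇ (F x y)) (λ y → ∑ᵇ (G x y))))
      (∑ᵇ-+ (λ x → ∑ᵇ λ y → ∑ᵇ (F x y)) (λ x → ∑ᵇ λ y → ∑ᵇ (G x y)))

  ear-above : EarRemoval above
  ear-above = trans
    (∑³-linear
      {A = λ g₁ y₁ d₁ → ∑³ λ g x z → Ψ (step above g₁ y₁ d₁ (close g x z))}
      {B = λ g₁ y₁ d₁ → ∑³ λ g x z → Ψ (double (step above g₁ y₁ d₁ (close g x z)))}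
      {C = λ g₁ y₁ d₁ → ∑³ λ g x z → Ψ (step above g₁ y₁ d₁ (closeDeleted above g x z))}
      {D = λ g₁ y₁ d₁ → (pair g₁ y₁ d₁ false) + (pair g₁ y₁ d₁ true)}
      λ g₁ y₁ d₁ → trans
      (reorder-above λ g y d g′ x z → Ψ (step above g₁ y₁ d₁ (step above g y d (close g′ x z))))
      (collect {P = λ y x g′ → ∑³ λ g d z → Ψ (step above g₁ y₁ d₁ (step above g y d (close g′ x z)))}
        (diagonal g₁ y₁ d₁ false) (diagonal g₁ y₁ d₁ true)
        (∑³-cong λ g d z → ext λ a b r t → trans (step-cong above g₁ y₁ d₁ (above-isolated g d z) a b r t)
          (step-double above g₁ y₁ d₁ (close g d z) a b r t))
        (∑³-cong λ g d z → ext (step-cong above g₁ y₁ d₁ (above-deleted g d z)))))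
    (cong (λ n → 4 * sumOver close (above ∷ []) Ψ + sumOver close (above ∷ []) (Ψ ∘ double)
        + sumOver (closeDeleted above) (above ∷ []) Ψ + n)
      (trans (∑³-+ (λ g₁ y₁ d₁ → pair g₁ y₁ d₁ false) (λ g₁ y₁ d₁ → pair g₁ y₁ d₁ true))
        (twice {k = sumOver close [] Ψ} (pair-above false) (pair-above true))))
    where
    pair : Bool → Bool → Bool → Bool → ℕ
    pair g₁ y₁ d₁ g′ = ∑³ λ g d z → Ψ (step above g₁ y₁ d₁ (step above g true d (close g′ false z)))
    diagonal : ∀ g₁ y₁ d₁ y g′ → (∑³ λ g d z → Ψ (step above g₁ y₁ d₁ (step above g y d (close g′ true z))))
                               ≡ (∑³ λ g x z → Ψ (step above g₁ y₁ d₁ (close g x z)))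
    diagonal g₁ y₁ d₁ y g′ = trans (∑³-cong λ g d z → ext (step-cong above g₁ y₁ d₁ (above-diagonal g y d g′ z)))
      (∑³-shift (g′ ∧ y) y g′ λ g x z → Ψ (step above g₁ y₁ d₁ (close g x z)))

  ear-below : EarRemoval below
  ear-below = trans
    (∑³-linear
      {A = λ g₁ y₁ d₁ → ∑³ λ g x z → Ψ (step below g₁ y₁ d₁ (close g x z))}
      {B = λ g₁ y₁ d₁ → ∑³ λ g x z → Ψ (double (step below g₁ y₁ d₁ (close g x z)))}
      {C = λ g₁ y₁ d₁ → ∑³ λ g x z → Ψ (step below g₁ y₁ d₁ (closeDeleted below g x z))}
      {D = λ g₁ y₁ d₁ → (pair g₁ y₁ d₁ false) + (pair g₁ y₁ d₁ true)}
      λ g₁ y₁ d₁ → trans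
      (reorder-below λ g y d g′ x z → Ψ (step below g₁ y₁ d₁ (step below g y d (close g′ x z))))
      (collect {P = λ y z g′ → ∑³ λ g x d → Ψ (step below g₁ y₁ d₁ (step below g y d (close g′ x z)))}
        (diagonal g₁ y₁ d₁ false) (diagonal g₁ y₁ d₁ true)
        (∑³-cong λ g x d → ext λ a b r t → trans (step-cong below g₁ y₁ d₁ (below-isolated g x d) a b r t)
          (step-double below g₁ y₁ d₁ (close g x d) a b r t))
        (∑³-cong λ g x d → ext (step-cong below g₁ y₁ d₁ (below-deleted g x d)))))
    (cong (λ n → 4 * sumOver close (below ∷ []) Ψ + sumOver close (below ∷ []) (Ψ ∘ double)
        + sumOver (closeDeleted below) (below ∷ []) Ψ + n)
      (trans (∑³-+ (λ g₁ y₁ d₁ → pair g₁ y₁ d₁ false) (λ g₁ y₁ d₁ → pair g₁ y₁ d₁ true))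
        (twice {k = sumOver close [] Ψ} (pair-below false) (pair-below true))))
    where
    pair : Bool → Bool → Bool → Bool → ℕ
    pair g₁ y₁ d₁ g′ = ∑³ λ g x d → Ψ (step below g₁ y₁ d₁ (step below g true d (close g′ x false)))
    diagonal : ∀ g₁ y₁ d₁ y g′ → (∑³ λ g x d → Ψ (step below g₁ y₁ d₁ (step below g y d (close g′ x true))))
                               ≡ (∑³ λ g x z → Ψ (step below g₁ y₁ d₁ (close g x z)))
    diagonal g₁ y₁ d₁ y g′ = trans (∑³-cong λ g x d → ext (step-cong below g₁ y₁ d₁ (below-diagonal g y d g′ x)))
      (∑³-shift (g′ ∧ y) g′ y λ g x z → Ψ (step below g₁ y₁ d₁ (close g x z)))

-- Only the right end of the ladder changes. The induction absorbs the steps of the untouched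
-- beginning into `Ψ`, which is why `Ψ` is arbitrary; `double` commutes with every step.
ear-removal : ∀ S s Ψ → Extensional Ψ → sumOver close (S ++ s ∷ s ∷ []) Ψ
  ≡ 4 * sumOver close (S ++ s ∷ []) Ψ + sumOver close (S ++ s ∷ []) (Ψ ∘ double)
  + sumOver (closeDeleted s) (S ++ s ∷ []) Ψ + 16 * sumOver close (S ++ []) Ψ
ear-removal []       above Ψ ext = ear-above Ψ ext
ear-removal []       below Ψ ext = ear-below Ψ ext
ear-removal (s′ ∷ S) s     Ψ ext = trans
  (∑³-linear
    {A = λ g y d → sumOver close (S ++ s ∷ []) (Ψ ∘ step s′ g y d)}
    {B = λ g y d → sumOver close (S ++ s ∷ []) (Ψ ∘ double ∘ step s′ g y d)}
    {C = λ g y d → sumOver (closeDeleted s) (S ++ s ∷ []) (Ψ ∘ step s′ g y d)}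
    {D = λ g y d → 16 * sumOver close (S ++ []) (Ψ ∘ step s′ g y d)}
    λ g y d → trans (ear-removal S s (Ψ ∘ step s′ g y d) (ext ∘ step-cong s′ g y d))
    (cong (λ n → 4 * sumOver close (S ++ s ∷ []) (Ψ ∘ step s′ g y d) + n
        + sumOver (closeDeleted s) (S ++ s ∷ []) (Ψ ∘ step s′ g y d)
        + 16 * sumOver close (S ++ []) (Ψ ∘ step s′ g y d))
      (∑ⱽ-cong (slots (S ++ s ∷ [])) λ τ → ext (step-double s′ g y d (transfer (S ++ s ∷ []) τ)))))
  (cong (4 * sumOver close (s′ ∷ S ++ s ∷ []) Ψ + sumOver close (s′ ∷ S ++ s ∷ []) (Ψ ∘ double)
      + sumOver (closeDeleted s) (s′ ∷ S ++ s ∷ []) Ψ +_)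
    (∑³-* 16 λ g y d → sumOver close (S ++ []) (Ψ ∘ step s′ g y d)))

-- Bounds on kernel sizes

total-cong : Extensional total
total-cong eq = ∑ᵇ-cong λ a → ∑ᵇ-cong λ b → eq a b false false

total-double : ∀ W → total (double W) ≡ 2 * total W
total-double W = trans (∑ᵇ-cong λ a → ∑ᵇ-* 2 (λ b → W a b false false)) (∑ᵇ-* 2 (λ a → ∑ᵇ λ b → W a b false false))

guard-≤ : ∀ B {m n} → m ≤ n → ⟦ B ⟧ * m ≤ n
guard-≤ false m≤n = z≤n
guard-≤ true  m≤n = ℕ.≤-trans (ℕ.≤-reflexive (ℕ.+-identityʳ _)) m≤n

∑ᵇ-≤ : ∀ {F n} → (∀ b → F b ≤ n) → ∑ᵇ F ≤ 2 * n
∑ᵇ-≤ {F} {n} le = ℕ.+-mono-≤ (le false) (ℕ.≤-trans (le true) (ℕ.≤-reflexive (sym (ℕ.+-identityʳ n))))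

⟦⟧-≤ : ∀ B → ⟦ B ⟧ ≤ 1
⟦⟧-≤ false = z≤n
⟦⟧-≤ true  = s≤s z≤n

step-≤ : ∀ s g y d {W n} → (∀ a b r t → W a b r t ≤ n) → ∀ a b r t → step s g y d W a b r t ≤ 2 * n
step-≤ above g y d le a b r t =
  ∑ᵇ-≤ λ c → guard-≤ (r ⇔ᵇ ((d ∧ a) xor ((y ∧ c) xor (g ∧ b)))) (le c b (y ∧ a) (t xor (g ∧ a)))
step-≤ below g y d le a b r t =
  ∑ᵇ-≤ λ c → guard-≤ (t ⇔ᵇ ((d ∧ b) xor ((y ∧ c) xor (g ∧ a)))) (le a c (r xor (g ∧ b)) (y ∧ b))

transfer-≤ : ∀ S τ a b r t → transfer S τ a b r t ≤ 2 ^ length S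
transfer-≤ []      (g ∷ x ∷ z ∷ []) a b r t =
  guard-≤ (r ⇔ᵇ ((x ∧ a) xor (g ∧ b))) (⟦⟧-≤ (t ⇔ᵇ ((z ∧ b) xor (g ∧ a))))
transfer-≤ (s ∷ S) (g ∷ y ∷ d ∷ τ)  = step-≤ s g y d (transfer-≤ S τ)

-- This excludes negative ranks, which is what makes the multiplication by a power of z in
-- `isRank-shift` correct at its lowest coefficients.
kernelSize-≤ : ∀ S τ → kernelSize S τ ≤ 2 ^ (2 + length S)
kernelSize-≤ S τ = ∑ᵇ-≤ {λ a → ∑ᵇ λ b → transfer S τ a b false false}
  λ a → ∑ᵇ-≤ {λ b → transfer S τ a b false false} λ b → transfer-≤ S τ a b false false

-- Masks

infixr 7 _∧ⱽ_
_∧ⱽ_ : ∀ {n} → Vec Bool n → Vec Bool n → Vec Bool n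
_∧ⱽ_ = Vec.zipWith _∧_

zeros : ∀ {n} → Vec Bool n → ℕ
zeros []          = 0
zeros (true  ∷ m) = zeros m
zeros (false ∷ m) = suc (zeros m)

allowed : Bool → List Bool
allowed true  = bits
allowed false = [ false ]

masked : ∀ {n} → Vec Bool n → List (Vec Bool n)
masked m = choices (Vec.map allowed m)

∈-masked : ∀ {n} (m v : Vec Bool n) → (∀ i → Vec.lookup v i ≡ true → Vec.lookup m i ≡ true) → v ∈ masked m
∈-masked m v le = ∈-choices (Vec.map allowed m) v λ i →
  subst (Vec.lookup v i ∈_) (sym (Vec.lookup-map i allowed m)) (in-allowed (Vec.lookup m i) (Vec.lookup v i) (le i))
  where
  in-allowed : ∀ x y → (y ≡ true → x ≡ true) → y ∈ allowed x
  in-allowed true  y     _  = ∈-bits y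
  in-allowed false false _  = here refl
  in-allowed false true  le = contradiction (le refl) λ ()

∈-masked⁻ : ∀ {n} (m : Vec Bool n) {v} → v ∈ masked m → ∀ i → Vec.lookup v i ≡ true → Vec.lookup m i ≡ true
∈-masked⁻ m {v} v∈ i eq = allowed-true (Vec.lookup m i)
  (subst₂ _∈_ eq (Vec.lookup-map i allowed m) (∈-choices⁻ (Vec.map allowed m) v∈ i))
  where
  allowed-true : ∀ x → true ∈ allowed x → x ≡ true
  allowed-true true  _         = refl
  allowed-true false (here ())

masked-unique : ∀ {n} (m : Vec Bool n) → Unique (masked m)
masked-unique m = choices-unique (Vec.map allowed m) λ i →
  subst Unique (sym (Vec.lookup-map i allowed m)) (allowed-unique (Vec.lookup m i))
  where
  allowed-unique : ∀ x → Unique (allowed x)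
  allowed-unique true  = bits-unique
  allowed-unique false = [] ∷ []

-- Each vector below the mask is the image of 2 to the `zeros m` vectors. This is the source of the
-- power of 2 in front of λ.
masked-sum : ∀ {n} (m : Vec Bool n) {P : Pred (Vec Bool n) 0ℓ} (P? : Decidable P) →
             ∑ⱽ n (λ τ → ⟦ does (P? (m ∧ⱽ τ)) ⟧) ≡ 2 ^ zeros m * count P? (masked m)
masked-sum [] P? with does (P? [])
... | true  = refl
... | false = refl
masked-sum {suc n} (false ∷ m) P? = trans (∑ᵇ-const (∑ⱽ n λ τ → ⟦ does (P? (false ∷ (m ∧ⱽ τ))) ⟧)) (trans (cong (2 *_) (masked-sum m (P? ∘ (false ∷_))))
  (trans (sym (ℕ.*-assoc 2 (2 ^ zeros m) _)) (cong (2 ^ suc (zeros m) *_)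
    (trans (sym (count-map P? (false ∷_) (masked m))) (sym (cong (count P?) (List.++-identityʳ (map (false ∷_) (masked m)))))))))
masked-sum (true ∷ m) P? = trans (cong₂ _+_ (masked-sum m (P? ∘ (false ∷_))) (masked-sum m (P? ∘ (true ∷_))))
  (trans (sym (ℕ.*-distribˡ-+ (2 ^ zeros m) _ _)) (cong (2 ^ zeros m *_) (sym (begin
    count P? (map (false ∷_) (masked m) ++ map (true ∷_) (masked m) ++ [])
      ≡⟨ count-++ P? (map (false ∷_) (masked m)) _ ⟩
    count P? (map (false ∷_) (masked m)) + count P? (map (true ∷_) (masked m) ++ [])
      ≡⟨ cong₂ _+_ (count-map P? (false ∷_) (masked m))
           (trans (cong (count P?) (List.++-identityʳ (map (true ∷_) (masked m)))) (count-map P? (true ∷_) (masked m))) ⟩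
    count (P? ∘ (false ∷_)) (masked m) + count (P? ∘ (true ∷_)) (masked m) ∎))))
  where open ≡-Reasoning

-- Throughout the last block the face across the path stays open. It meets each step in the slot
-- `g`, and the closing triple also in its diagonal slot.
blockMask : ∀ s j → Vec Bool (slots (replicate j s))
blockMask above zero    = false ∷ true  ∷ false ∷ []
blockMask below zero    = false ∷ false ∷ true  ∷ []
blockMask s     (suc j) = false ∷ true  ∷ true  ∷ blockMask s j

-- The slots that do not touch the face across the path from the last block of sides.
faceMask : ∀ S s j → Vec Bool (slots (S ++ flip s ∷ replicate j s))
faceMask []       s j = true ∷ false ∷ true ∷ blockMask s j
faceMask (s′ ∷ S) s j = true ∷ true  ∷ true ∷ faceMask S s j

zeros-blockMask : ∀ s j → zeros (blockMask s j) ≡ 2 + j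
zeros-blockMask above zero    = refl
zeros-blockMask below zero    = refl
zeros-blockMask above (suc j) = cong suc (zeros-blockMask above j)
zeros-blockMask below (suc j) = cong suc (zeros-blockMask below j)

zeros-faceMask : ∀ S s j → zeros (faceMask S s j) ≡ 3 + j
zeros-faceMask []       s j = cong suc (zeros-blockMask s j)
zeros-faceMask (s′ ∷ S) s j = zeros-faceMask S s j

-- `M` has the row of the lower face masked out, `D` has the face deleted. In `M` the value `b` is
-- without influence and the equation of the face reads t = 0; in `D` the value is forced to be
-- false and the equation is dropped.
record Above-block (M D : Transfer) : Set where
  field
    masked≡ : ∀ a b r t → M a b r t ≡ ⟦ not t ⟧ * D a false r false
    dead    : ∀ a r t → D a true r t ≡ 0
    free    : ∀ a r t → D a false r t ≡ D a false r false

record Below-block (M D : Transfer) : Set where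
  field
    masked≡ : ∀ a b r t → M a b r t ≡ ⟦ not r ⟧ * D false b false t
    dead    : ∀ b r t → D true b r t ≡ 0
    free    : ∀ b r t → D false b r t ≡ D false b false t

private
  guard-distribute : ∀ n (B : Bool → Bool) (F : Bool → ℕ) → (∑ᵇ λ c → ⟦ B c ⟧ * (n * F c)) ≡ n * ∑ᵇ λ c → ⟦ B c ⟧ * F c
  guard-distribute n B F = solve 5 (λ n p x q y → p :* (n :* x) :+ q :* (n :* y) := n :* (p :* x :+ q :* y)) refl
    n ⟦ B false ⟧ (F false) ⟦ B true ⟧ (F true)
    where open ℕSolver.+-*-Solver using (solve; _:+_; _:*_; _:=_; con)

  guards-zero : ∀ {B : Bool → Bool} {F : Bool → ℕ} → (∀ c → F c ≡ 0) → (∑ᵇ λ c → ⟦ B c ⟧ * F c) ≡ 0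
  guards-zero {B} eq = cong₂ _+_ (trans (cong (⟦ B false ⟧ *_) (eq false)) (ℕ.*-zeroʳ ⟦ B false ⟧))
    (trans (cong (⟦ B true ⟧ *_) (eq true)) (ℕ.*-zeroʳ ⟦ B true ⟧))

above-block : ∀ j τ → Above-block (transfer (replicate j above) (blockMask above j ∧ⱽ τ))
                                  (run (closeDeleted above) (replicate j above) τ)
above-block zero (g ∷ x ∷ z ∷ []) = record
  { masked≡ = exhaust′ ℕ._≟_ 5 (λ x → close false x false) (λ x a b r t → ⟦ not t ⟧ * closeDeleted above false x false a false r false) refl x
  ; dead    = λ a r t → refl
  ; free    = λ a r t → refl }
above-block (suc j) (g ∷ y ∷ d ∷ τ) = record
  { masked≡ = λ a b r t → trans
      (∑ᵇ-cong λ c → cong₂ (λ B n → ⟦ B ⟧ * n)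
        (boolean 7 (λ g y d a b r c → r ⇔ᵇ ((d ∧ a) xor ((y ∧ c) xor (false ∧ b))))
          (λ g y d a b r c → r ⇔ᵇ ((d ∧ a) xor ((y ∧ c) xor (g ∧ false)))) refl g y d a b r c)
        (trans (masked≡ c b (y ∧ a) (t xor false)) (cong₂ (λ t n → ⟦ not t ⟧ * n) (Bool.xor-identityʳ t)
          (sym (free c (y ∧ a) (false xor (g ∧ a)))))))
      (guard-distribute ⟦ not t ⟧ (λ c → r ⇔ᵇ ((d ∧ a) xor ((y ∧ c) xor (g ∧ false))))
        (λ c → run (closeDeleted above) (replicate j above) τ c false (y ∧ a) (false xor (g ∧ a))))
  ; dead    = λ a r t → guards-zero {λ c → r ⇔ᵇ ((d ∧ a) xor ((y ∧ c) xor (g ∧ true)))} λ c → dead c (y ∧ a) (t xor (g ∧ a))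
  ; free    = λ a r t → ∑ᵇ-cong λ c → cong (⟦ r ⇔ᵇ ((d ∧ a) xor ((y ∧ c) xor (g ∧ false))) ⟧ *_)
      (trans (free c (y ∧ a) (t xor (g ∧ a))) (sym (free c (y ∧ a) (false xor (g ∧ a))))) }
  where open Above-block (above-block j τ)

below-block : ∀ j τ → Below-block (transfer (replicate j below) (blockMask below j ∧ⱽ τ))
                                  (run (closeDeleted below) (replicate j below) τ)
below-block zero (g ∷ x ∷ z ∷ []) = record
  { masked≡ = exhaust′ ℕ._≟_ 5 (λ z → close false false z) (λ z a b r t → ⟦ not r ⟧ * closeDeleted below false false z false b false t) refl z
  ; dead    = λ b r t → refl
  ; free    = λ b r t → refl }
below-block (suc j) (g ∷ y ∷ d ∷ τ) = record
  { masked≡ = λ a b r t → trans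
      (∑ᵇ-cong λ c → cong₂ (λ B n → ⟦ B ⟧ * n)
        (boolean 7 (λ g y d a b t c → t ⇔ᵇ ((d ∧ b) xor ((y ∧ c) xor (false ∧ a))))
          (λ g y d a b t c → t ⇔ᵇ ((d ∧ b) xor ((y ∧ c) xor (g ∧ false)))) refl g y d a b t c)
        (trans (masked≡ a c (r xor false) (y ∧ b)) (cong₂ (λ r n → ⟦ not r ⟧ * n) (Bool.xor-identityʳ r)
          (sym (free c (false xor (g ∧ b)) (y ∧ b))))))
      (guard-distribute ⟦ not r ⟧ (λ c → t ⇔ᵇ ((d ∧ b) xor ((y ∧ c) xor (g ∧ false))))
        (λ c → run (closeDeleted below) (replicate j below) τ false c (false xor (g ∧ b)) (y ∧ b)))
  ; dead    = λ b r t → guards-zero {λ c → t ⇔ᵇ ((d ∧ b) xor ((y ∧ c) xor (g ∧ true)))} λ c → dead c (r xor (g ∧ b)) (y ∧ b)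
  ; free    = λ b r t → ∑ᵇ-cong λ c → cong (⟦ t ⇔ᵇ ((d ∧ b) xor ((y ∧ c) xor (g ∧ false))) ⟧ *_)
      (trans (free c (r xor (g ∧ b)) (y ∧ b)) (sym (free c (false xor (g ∧ b)) (y ∧ b)))) }
  where open Below-block (below-block j τ)

-- A face with a zero row contributes a free bit to the kernel, a deleted face does not; hence
-- `double`. The face enters at the step of `flip s`, where the masked side sums over both values of
-- `c` and the deleted side keeps only `c = false`.
transfer-faceMask : ∀ S s j τ → transfer (S ++ flip s ∷ replicate j s) (faceMask S s j ∧ⱽ τ)
                              ≋ double (run (closeDeleted s) (S ++ flip s ∷ replicate j s) τ)
transfer-faceMask [] above j (g ∷ y ∷ d ∷ τ) a b r t = trans
  (∑ᵇ-cong λ c → cong (⟦ t ⇔ᵇ ((d ∧ b) xor (false xor (g ∧ a))) ⟧ *_)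
    (trans (masked≡ a c (r xor (g ∧ b)) false) (trans (ℕ.*-identityˡ _) (sym (free a (r xor (g ∧ b)) (y ∧ b))))))
  (trans (∑ᵇ-const N) (cong (2 *_) (trans (sym (ℕ.+-identityʳ N)) (cong₂ _+_
    (cong (λ x → ⟦ t ⇔ᵇ ((d ∧ b) xor (x xor (g ∧ a))) ⟧ * run (closeDeleted above) (replicate j above) τ a false (r xor (g ∧ b)) (y ∧ b))
      (sym (Bool.∧-zeroʳ y)))
    (sym (trans (cong (⟦ B ⟧ *_) (dead a (r xor (g ∧ b)) (y ∧ b))) (ℕ.*-zeroʳ ⟦ B ⟧)))))))
  where
  open Above-block (above-block j τ)
  B = t ⇔ᵇ ((d ∧ b) xor ((y ∧ true) xor (g ∧ a)))
  N = ⟦ t ⇔ᵇ ((d ∧ b) xor (false xor (g ∧ a))) ⟧ * run (closeDeleted above) (replicate j above) τ a false (r xor (g ∧ b)) (y ∧ b)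
transfer-faceMask [] below j (g ∷ y ∷ d ∷ τ) a b r t = trans
  (∑ᵇ-cong λ c → cong (⟦ r ⇔ᵇ ((d ∧ a) xor (false xor (g ∧ b))) ⟧ *_)
    (trans (masked≡ c b false (t xor (g ∧ a))) (trans (ℕ.*-identityˡ _) (sym (free b (y ∧ a) (t xor (g ∧ a)))))))
  (trans (∑ᵇ-const N) (cong (2 *_) (trans (sym (ℕ.+-identityʳ N)) (cong₂ _+_
    (cong (λ x → ⟦ r ⇔ᵇ ((d ∧ a) xor (x xor (g ∧ b))) ⟧ * run (closeDeleted below) (replicate j below) τ false b (y ∧ a) (t xor (g ∧ a)))
      (sym (Bool.∧-zeroʳ y)))
    (sym (trans (cong (⟦ B ⟧ *_) (dead b (y ∧ a) (t xor (g ∧ a)))) (ℕ.*-zeroʳ ⟦ B ⟧)))))))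
  where
  open Below-block (below-block j τ)
  B = r ⇔ᵇ ((d ∧ a) xor ((y ∧ true) xor (g ∧ b)))
  N = ⟦ r ⇔ᵇ ((d ∧ a) xor (false xor (g ∧ b))) ⟧ * run (closeDeleted below) (replicate j below) τ false b (y ∧ a) (t xor (g ∧ a))
transfer-faceMask (s′ ∷ S) s j (g ∷ y ∷ d ∷ τ) a b r t = trans
  (step-cong s′ g y d (transfer-faceMask S s j τ) a b r t)
  (step-double s′ g y d (run (closeDeleted s) (S ++ flip s ∷ replicate j s) τ) a b r t)

-- The recursion for rank distributions

shift : ℕ → Poly → Poly
shift zero    p i       = p i
shift (suc d) p zero    = 0
shift (suc d) p (suc i) = shift d p i

shift-cong : ∀ d {p q} → p ≗ q → shift d p ≗ shift d q
shift-cong zero    eq i       = eq i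
shift-cong (suc d) eq zero    = refl
shift-cong (suc d) eq (suc i) = shift-cong d eq i

shift-* : ∀ d c p i → c * shift d p i ≡ shift d (λ k → c * p k) i
shift-* zero    c p i       = refl
shift-* (suc d) c p zero    = ℕ.*-zeroʳ c
shift-* (suc d) c p (suc i) = shift-* d c p i

∑ⱽ-shift : ∀ n d (p : Vec Bool n → Poly) i → ∑ⱽ n (λ τ → shift d (p τ) i) ≡ shift d (λ k → ∑ⱽ n λ τ → p τ k) i
∑ⱽ-shift n zero    p i       = refl
∑ⱽ-shift n (suc d) p zero    = ∑ⱽ-zero n λ τ → refl
∑ⱽ-shift n (suc d) p (suc i) = ∑ⱽ-shift n d p i

isRank : ℕ → ℕ → Poly
isRank n N i = ⟦ does (N * 2 ^ i ℕ.≟ 2 ^ n) ⟧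

isRank-double : ∀ n N i → isRank (suc n) (2 * N) i ≡ isRank n N i
isRank-double n N i = cong ⟦_⟧ (does-cong (2 * N * 2 ^ i ℕ.≟ 2 ^ suc n) (N * 2 ^ i ℕ.≟ 2 ^ n)
  (λ eq → 2^-cancel 1 (trans (sym (ℕ.*-assoc 2 N (2 ^ i))) eq))
  (λ eq → trans (ℕ.*-assoc 2 N (2 ^ i)) (cong (2 *_) eq)))

-- For `i` below `d` the equation would force `N` above 2^n, so the bound yields the coefficients 0
-- there; for larger `i` the factor 2^d cancels.
isRank-shift : ∀ d n N i → N ≤ 2 ^ n → isRank (d + n) N i ≡ shift d (isRank n N) i
isRank-shift zero    n N i       N≤ = refl
isRank-shift (suc d) n N zero    N≤ = cong ⟦_⟧ (dec-false (N * 1 ℕ.≟ 2 ^ suc (d + n)) λ eq →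
  ℕ.<⇒≢ (ℕ.≤-<-trans (ℕ.≤-trans (ℕ.≤-reflexive (ℕ.*-identityʳ N)) N≤)
    (ℕ.^-monoʳ-< 2 (s≤s (s≤s z≤n)) (s≤s (ℕ.m≤n+m n d)))) eq)
isRank-shift (suc d) n N (suc i) N≤ = trans (cong ⟦_⟧ (does-cong (N * 2 ^ suc i ℕ.≟ 2 ^ suc (d + n)) (N * 2 ^ i ℕ.≟ 2 ^ (d + n))
  (λ eq → 2^-cancel 1 (trans swap-2 eq)) (λ eq → trans (sym swap-2) (cong (2 *_) eq)))) (isRank-shift d n N i N≤)
  where
  swap-2 : 2 * (N * 2 ^ i) ≡ N * 2 ^ suc i
  swap-2 = solve 2 (λ n p → con 2 :* (n :* p) := n :* (con 2 :* p)) refl N (2 ^ i)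
    where open ℕSolver.+-*-Solver using (solve; _:+_; _:*_; _:=_; con)

Masked : Set
Masked = Σ (List Side) λ S → Vec Bool (slots S)

maskedCount : Masked → Poly
maskedCount (S , m) i = count (hasRank? S i) (masked m)

module _ (S : List Side) (s : Side) (j : ℕ) where
  private
    S₂ S₁ S₁′ S₀ : List Side
    S₂  = S ++ flip s ∷ replicate j s
    S₁  = S₂ ++ s ∷ []
    S₁′ = S ++ flip s ∷ replicate (suc j) s
    S₀  = S₂ ++ s ∷ s ∷ []
    n : ℕ
    n = length S₂
    mask : Vec Bool (slots S₁′)
    mask = faceMask S s (suc j)

    replicate-snoc : ∀ k → replicate k s ++ s ∷ [] ≡ s ∷ replicate k s
    replicate-snoc zero    = refl
    replicate-snoc (suc k) = cong (s ∷_) (replicate-snoc k)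

  S₁≡ : S₁ ≡ S₁′
  S₁≡ = trans (List.++-assoc S (flip s ∷ replicate j s) (s ∷ [])) (cong (λ R → S ++ flip s ∷ R) (replicate-snoc j))

  S₀≡ : S₀ ≡ S ++ flip s ∷ replicate (2 + j) s
  S₀≡ = trans (sym (List.++-assoc S₂ (s ∷ []) (s ∷ []))) (trans (cong (_++ s ∷ []) S₁≡)
    (trans (List.++-assoc S (flip s ∷ replicate (suc j) s) (s ∷ [])) (cong (λ R → S ++ flip s ∷ R) (replicate-snoc (suc j)))))

  private
    length₁ : length S₁ ≡ 1 + n
    length₁ = trans (List.length-++ S₂) (ℕ.+-comm n 1)

    length₀ : length S₀ ≡ 2 + n
    length₀ = trans (List.length-++ S₂) (ℕ.+-comm n 2)

    -- The exponent is the dimension for `S₀`. The dimensions 3 + n for `S₁` and 2 + n for `S₂` lie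
    -- below it by the powers of z in the recursion; a doubled kernel for `S₁` makes up for the
    -- missing dimension.
    Ψ : ℕ → Transfer → ℕ
    Ψ i W = isRank (4 + n) (total W) i

    ext : ∀ i → Extensional (Ψ i)
    ext i eq = cong (λ N → isRank (4 + n) N i) (total-cong eq)

    rankCount≡ : ∀ R {m} i → 2 + length R ≡ m → rankCount R i ≡ ∑ⱽ (slots R) λ τ → isRank m (kernelSize R τ) i
    rankCount≡ R i refl = refl

    kernel-≤ : ∀ R {m} → 2 + length R ≡ m → ∀ τ → kernelSize R τ ≤ 2 ^ m
    kernel-≤ R refl = kernelSize-≤ R

    by-shift : ∀ d R {m} i → 2 + length R ≡ m →
               ∑ⱽ (slots R) (λ τ → isRank (d + m) (kernelSize R τ) i) ≡ shift d (rankCount R) i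
    by-shift d R {m} i len = trans
      (∑ⱽ-cong (slots R) λ τ → isRank-shift d m (kernelSize R τ) i (kernel-≤ R len τ))
      (trans (∑ⱽ-shift (slots R) d (λ τ → isRank m (kernelSize R τ)) i)
        (shift-cong d (λ k → sym (rankCount≡ R k len)) i))

    -- Restoring the deleted face with a zero row doubles the kernel, so 5 + n is compared with the
    -- dimension 3 + n; this is the z² at λ. The 4 + j slots masked out are the entries in the row
    -- of that face: its diagonal, two with the preceding fan, and one with each of the j + 1 faces
    -- of its own fan.
    deleted : ∀ i → sumOver (closeDeleted s) S₁ (Ψ i) ≡ 2 ^ (4 + j) * shift 2 (maskedCount (S₁′ , mask)) i
    deleted i = begin
      sumOver (closeDeleted s) S₁ (Ψ i)  ≡⟨ cong (λ R → sumOver (closeDeleted s) R (Ψ i)) S₁≡ ⟩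
      sumOver (closeDeleted s) S₁′ (Ψ i)
        ≡⟨ ∑ⱽ-cong (slots S₁′) (λ τ → trans (sym (isRank-double (4 + n) (total (run (closeDeleted s) S₁′ τ)) i))
             (cong (λ N → isRank (5 + n) N i) (trans (sym (total-double (run (closeDeleted s) S₁′ τ)))
               (sym (total-cong (transfer-faceMask S s (suc j) τ)))))) ⟩
      ∑ⱽ (slots S₁′) (λ τ → isRank (5 + n) (kernelSize S₁′ (mask ∧ⱽ τ)) i)
        ≡⟨ ∑ⱽ-cong (slots S₁′) (λ τ → isRank-shift 2 (3 + n) _ i (kernel-≤ S₁′ length₁′ (mask ∧ⱽ τ))) ⟩
      ∑ⱽ (slots S₁′) (λ τ → shift 2 (isRank (3 + n) (kernelSize S₁′ (mask ∧ⱽ τ))) i)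
        ≡⟨ ∑ⱽ-shift (slots S₁′) 2 (λ τ → isRank (3 + n) (kernelSize S₁′ (mask ∧ⱽ τ))) i ⟩
      shift 2 (λ k → ∑ⱽ (slots S₁′) λ τ → isRank (3 + n) (kernelSize S₁′ (mask ∧ⱽ τ)) k) i
        ≡⟨ shift-cong 2 (λ k → trans
             (∑ⱽ-cong (slots S₁′) λ τ → cong (λ m → isRank m (kernelSize S₁′ (mask ∧ⱽ τ)) k) (sym length₁′))
             (trans (masked-sum mask (hasRank? S₁′ k))
               (cong (λ m → 2 ^ m * count (hasRank? S₁′ k) (masked mask)) (zeros-faceMask S s (suc j))))) i ⟩
      shift 2 (λ k → 2 ^ (4 + j) * maskedCount (S₁′ , mask) k) i
        ≡⟨ shift-* 2 (2 ^ (4 + j)) (maskedCount (S₁′ , mask)) i ⟨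
      2 ^ (4 + j) * shift 2 (maskedCount (S₁′ , mask)) i ∎
      where
      open ≡-Reasoning
      length₁′ : 2 + length S₁′ ≡ 3 + n
      length₁′ = cong (2 +_) (trans (cong length (sym S₁≡)) length₁)

  rankCount-recursion : ∀ i → rankCount (S ++ flip s ∷ replicate (2 + j) s) i
    ≡ 4 * shift 1 (rankCount (S ++ flip s ∷ replicate (1 + j) s)) i + rankCount (S ++ flip s ∷ replicate (1 + j) s) i
    + 2 ^ (4 + j) * shift 2 (maskedCount (S ++ flip s ∷ replicate (1 + j) s , faceMask S s (1 + j))) i
    + 16 * shift 2 (rankCount (S ++ flip s ∷ replicate j s)) i
  rankCount-recursion i = begin
    rankCount (S ++ flip s ∷ replicate (2 + j) s) i ≡⟨ cong (λ R → rankCount R i) S₀≡ ⟨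
    rankCount S₀ i                                  ≡⟨ rankCount≡ S₀ i (cong (2 +_) length₀) ⟩
    sumOver close S₀ (Ψ i)                          ≡⟨ ear-removal S₂ s (Ψ i) (ext i) ⟩
    4 * sumOver close S₁ (Ψ i) + sumOver close S₁ (Ψ i ∘ double) + sumOver (closeDeleted s) S₁ (Ψ i)
      + 16 * sumOver close (S₂ ++ []) (Ψ i)
      ≡⟨ cong₂ _+_ (cong₂ _+_ (cong₂ _+_
           (cong (4 *_) (trans (by-shift 1 S₁ i (cong (2 +_) length₁)) (cong (λ R → shift 1 (rankCount R) i) S₁≡)))
           (trans (∑ⱽ-cong (slots S₁) λ τ → trans (cong (λ N → isRank (4 + n) N i) (total-double (transfer S₁ τ)))
               (isRank-double (3 + n) (kernelSize S₁ τ) i))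
             (trans (sym (rankCount≡ S₁ i (cong (2 +_) length₁))) (cong (λ R → rankCount R i) S₁≡))))
           (deleted i))
           (cong (16 *_) (trans (cong (λ R → sumOver close R (Ψ i)) (List.++-identityʳ S₂)) (by-shift 2 S₂ i refl))) ⟩
    _ ∎
    where open ≡-Reasoning

-- Rank and kernel

open MonoidSum (CommutativeRing.+-commutativeMonoid Bool.xor-∧-commutativeRing)
  using () renaming (sum to ⨁; sum-permute to ⨁-permute; sum-cong-≗ to ⨁-cong; ∑-distrib-+ to ⨁-xor)

infixr 6 _⊕ⱽ_
_⊕ⱽ_ : ∀ {n} → Vec Bool n → Vec Bool n → Vec Bool n
_⊕ⱽ_ = Vec.zipWith _xor_

⊕ⱽ-identityʳ : ∀ {n} (v : Vec Bool n) → v ⊕ⱽ zeroRow ≡ v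
⊕ⱽ-identityʳ = Vec.zipWith-identityʳ Bool.xor-identityʳ

⊕ⱽ-self : ∀ {n} (v : Vec Bool n) → v ⊕ⱽ v ≡ zeroRow
⊕ⱽ-self []      = refl
⊕ⱽ-self (x ∷ v) = cong₂ _∷_ (Bool.xor-same x) (⊕ⱽ-self v)

⊕ⱽ-assoc : ∀ {n} (u v w : Vec Bool n) → (u ⊕ⱽ v) ⊕ⱽ w ≡ u ⊕ⱽ (v ⊕ⱽ w)
⊕ⱽ-assoc = Vec.zipWith-assoc Bool.xor-assoc

⊕ⱽ-cancel : ∀ {n} (u v : Vec Bool n) → (u ⊕ⱽ v) ⊕ⱽ v ≡ u
⊕ⱽ-cancel u v = trans (⊕ⱽ-assoc u v v) (trans (cong (u ⊕ⱽ_) (⊕ⱽ-self v)) (⊕ⱽ-identityʳ u))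

⊕ⱽ-zero : ∀ {n} {u v : Vec Bool n} → u ⊕ⱽ v ≡ zeroRow → u ≡ v
⊕ⱽ-zero {u = u} {v} eq = trans (sym (⊕ⱽ-cancel u v)) (trans (cong (_⊕ⱽ v) eq)
  (Vec.zipWith-identityˡ Bool.xor-identityˡ v))

lookup-⊕ⱽ : ∀ {n} (u v : Vec Bool n) i → Vec.lookup (u ⊕ⱽ v) i ≡ Vec.lookup u i xor Vec.lookup v i
lookup-⊕ⱽ u v i = Vec.lookup-zipWith _xor_ i u v

lookup-rowSum : ∀ {m n} (M : Vec (Vec Bool n) m) C q →
                Vec.lookup (rowSum M C) q ≡ ⨁ λ p → Vec.lookup C p ∧ Vec.lookup (Vec.lookup M p) q
lookup-rowSum []      []          q = Vec.lookup-replicate q false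
lookup-rowSum (r ∷ M) (true ∷ C)  q = trans (lookup-⊕ⱽ r (rowSum M C) q) (cong (Vec.lookup r q xor_) (lookup-rowSum M C q))
lookup-rowSum (r ∷ M) (false ∷ C) q = lookup-rowSum M C q

lookup-injectiveⱽ : ∀ {n} {u v : Vec Bool n} → (∀ i → Vec.lookup u i ≡ Vec.lookup v i) → u ≡ v
lookup-injectiveⱽ {u = u} {v} eq = trans (sym (Vec.tabulate∘lookup u)) (trans (Vec.tabulate-cong eq) (Vec.tabulate∘lookup v))

rowSum-⊕ⱽ : ∀ {m n} (M : Vec (Vec Bool n) m) C D → rowSum M (C ⊕ⱽ D) ≡ rowSum M C ⊕ⱽ rowSum M D
rowSum-⊕ⱽ M C D = lookup-injectiveⱽ λ q → begin
  Vec.lookup (rowSum M (C ⊕ⱽ D)) q ≡⟨ lookup-rowSum M (C ⊕ⱽ D) q ⟩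
  ⨁ (λ p → Vec.lookup (C ⊕ⱽ D) p ∧ m p q)
    ≡⟨ ⨁-cong (λ p → trans (cong (_∧ m p q) (lookup-⊕ⱽ C D p)) (Bool.∧-distribʳ-xor (m p q) (Vec.lookup C p) (Vec.lookup D p))) ⟩
  ⨁ (λ p → (Vec.lookup C p ∧ m p q) xor (Vec.lookup D p ∧ m p q))
    ≡⟨ ⨁-xor (λ p → Vec.lookup C p ∧ m p q) (λ p → Vec.lookup D p ∧ m p q) ⟩
  ⨁ (λ p → Vec.lookup C p ∧ m p q) xor ⨁ (λ p → Vec.lookup D p ∧ m p q)
    ≡⟨ cong₂ _xor_ (lookup-rowSum M C q) (lookup-rowSum M D q) ⟨
  Vec.lookup (rowSum M C) q xor Vec.lookup (rowSum M D) q ≡⟨ lookup-⊕ⱽ (rowSum M C) (rowSum M D) q ⟨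
  Vec.lookup (rowSum M C ⊕ⱽ rowSum M D) q ∎
  where
  open ≡-Reasoning
  m : _ → _ → Bool
  m p q = Vec.lookup (Vec.lookup M p) q

rowSum-zero : ∀ {m n} (M : Vec (Vec Bool n) m) → rowSum M zeroRow ≡ zeroRow
rowSum-zero []      = refl
rowSum-zero (r ∷ M) = rowSum-zero M

single : ∀ {n} → Fin n → Vec Bool n
single zero    = true ∷ zeroRow
single (suc i) = false ∷ single i

rowSum-single : ∀ {m n} (M : Vec (Vec Bool n) m) i → rowSum M (single i) ≡ Vec.lookup M i
rowSum-single (r ∷ M) zero    = trans (cong (r ⊕ⱽ_) (rowSum-zero M)) (⊕ⱽ-identityʳ r)
rowSum-single (r ∷ M) (suc i) = rowSum-single M i

lookup-single : ∀ {n} (i j : Fin n) → Vec.lookup (single i) j ≡ does (j Fin.≟ i)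
lookup-single zero    zero    = refl
lookup-single zero    (suc j) = Vec.lookup-replicate j false
lookup-single (suc i) zero    = refl
lookup-single (suc i) (suc j) = lookup-single i j

infix 4 _⊑_
_⊑_ : ∀ {n} → Vec Bool n → Vec Bool n → Set
u ⊑ v = ∀ i → Vec.lookup u i ≡ true → Vec.lookup v i ≡ true

⊑⇒⊆ : ∀ {n} {C S : Subset n} → C ⊑ S → C ⊆ S
⊑⇒⊆ {S = S} le {i} i∈ = Vec.lookup⇒[]= i S (le i (Vec.[]=⇒lookup i∈))

⊆⇒⊑ : ∀ {n} {C S : Subset n} → C ⊆ S → C ⊑ S
⊆⇒⊑ {C = C} le i eq = Vec.[]=⇒lookup (le (Vec.lookup⇒[]= i C eq))

xor-true : ∀ x y → x xor y ≡ true → x ≡ true ⊎ y ≡ true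
xor-true true  y eq = inj₁ refl
xor-true false y eq = inj₂ eq

⊕ⱽ-⊑ : ∀ {n} (C D S : Vec Bool n) → C ⊑ S → D ⊑ S → C ⊕ⱽ D ⊑ S
⊕ⱽ-⊑ C D S p q i eq with xor-true (Vec.lookup C i) (Vec.lookup D i) (trans (sym (lookup-⊕ⱽ C D i)) eq)
... | inj₁ c = p i c
... | inj₂ d = q i d

zeroRow-⊑ : ∀ {n} (S : Vec Bool n) → zeroRow ⊑ S
zeroRow-⊑ S i eq = contradiction (trans (sym eq) (Vec.lookup-replicate i false)) λ ()

length-masked : ∀ {n} (S : Vec Bool n) → length (masked S) ≡ 2 ^ ∣ S ∣
length-masked []          = refl
length-masked (true ∷ S)  = trans (List.length-++ (map (true′ false) (masked S))) (trans (cong₂ _+_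
  (trans (List.length-map (true′ false) (masked S)) (length-masked S))
  (trans (cong length (List.++-identityʳ (map (true′ true) (masked S)))) (trans (List.length-map (true′ true) (masked S)) (length-masked S))))
  (∑ᵇ-const (2 ^ ∣ S ∣)))
  where
  true′ : Bool → Vec Bool _ → Vec Bool _
  true′ = _∷_
length-masked (false ∷ S) = trans (cong length (List.++-identityʳ (map (false ∷_) (masked S))))
  (trans (List.length-map (false ∷_) (masked S)) (length-masked S))

insert : ∀ {n} → Fin n → Vec Bool n → Vec Bool n
insert i S = S Vec.[ i ]≔ true

∣insert∣ : ∀ {n} (i : Fin n) S → Vec.lookup S i ≡ false → ∣ insert i S ∣ ≡ suc ∣ S ∣
∣insert∣ zero    (false ∷ S) eq = refl
∣insert∣ (suc i) (true  ∷ S) eq = cong suc (∣insert∣ i S eq)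
∣insert∣ (suc i) (false ∷ S) eq = ∣insert∣ i S eq

module RankKernel {n} (M : Matrix n) where

  kernel? : Decidable (λ C → rowSum M C ≡ zeroRow)
  kernel? C = Vec.≡-dec Bool._≟_ (rowSum M C) zeroRow

  independent-zero : ∀ {S} → Independent M S → ∀ {C} → C ⊑ S → rowSum M C ≡ zeroRow → C ≡ zeroRow
  independent-zero {S} ind {C} C⊑S eq = lookup-injectiveⱽ λ i → trans (empty i) (sym (Vec.lookup-replicate i false))
    where
    empty : ∀ i → Vec.lookup C i ≡ false
    empty i with Vec.lookup C i in eqᵢ
    ... | false = refl
    ... | true  = contradiction (C , (λ {x} → ⊑⇒⊆ {C = C} {S} C⊑S {x}) , (i , Vec.lookup⇒[]= i C eqᵢ) , eq) ind

  dependent : ∀ {S} → ¬ Independent M S → ∃ λ C → C ⊑ S × C ≢ zeroRow × rowSum M C ≡ zeroRow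
  dependent {S} dep with anySubset? (λ C → (C ⊆? S) ×-dec nonempty? C ×-dec Vec.≡-dec Bool._≟_ (rowSum M C) zeroRow)
  ... | no ¬∃ = contradiction ¬∃ dep
  ... | yes (C , C⊆S , (i , i∈) , eq) = C , ⊆⇒⊑ {C = C} {S} (λ {x} → C⊆S {x}) , (λ C≡0 → contradiction
          (trans (sym (Vec.[]=⇒lookup i∈)) (trans (cong (λ D → Vec.lookup D i) C≡0) (Vec.lookup-replicate i false))) λ ()) , eq

  sizes : List ℕ
  sizes = map ∣_∣ (filter (independent? M) (vectors bits n))

  independent-≤ : ∀ {S} → Independent M S → ∣ S ∣ ≤ rank M
  independent-≤ {S} ind = All.lookup (xs≤max 0 sizes)
    (Membership.∈-map⁺ ∣_∣ (Membership.∈-filter⁺ (independent? M) (∈-vectors ∈-bits S) ind))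

  maximal : ∃ λ S → Independent M S × ∣ S ∣ ≡ rank M
  maximal with argmax-sel id 0 sizes
  -- The default 0 of `max` is attained by the empty set of rows.
  ... | inj₁ rank≡0 = zeroRow , ind , ℕ.≤-antisym (independent-≤ ind) (ℕ.≤-trans (ℕ.≤-reflexive rank≡0) z≤n)
    where
    ind : Independent M zeroRow
    ind (C , C⊆ , (i , i∈) , _) = contradiction
      (trans (sym (Vec.[]=⇒lookup (C⊆ i∈))) (Vec.lookup-replicate i false)) λ ()
  ... | inj₂ rank∈ with Membership.∈-map⁻ ∣_∣ rank∈
  ...   | S , S∈ , eq = S , proj₂ (Membership.∈-filter⁻ (independent? M) {xs = vectors bits n} S∈) , sym eq

  private
    S = proj₁ maximal
    S-independent = proj₁ (proj₂ maximal)

    Spanned : Vec Bool n → Set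
    Spanned r = ∃ λ C → C ⊑ S × rowSum M C ≡ r

    single-⊑ : ∀ {i} {T : Vec Bool n} → Vec.lookup T i ≡ true → single i ⊑ T
    single-⊑ {i} eq j eqⱼ with j Fin.≟ i | lookup-single i j
    ... | yes refl | _   = eq
    ... | no _     | eq′ = contradiction (trans (sym eqⱼ) eq′) λ ()

    -- By maximality of `S` the rows in `insert i S` satisfy a relation. It has to involve row `i`,
    -- which it thereby expresses by rows in `S`.
    row-spanned : ∀ i → Spanned (Vec.lookup M i)
    row-spanned i with Vec.lookup S i in eqᵢ
    ... | true  = single i , single-⊑ {i} {S} eqᵢ , rowSum-single M i
    ... | false with dependent {insert i S} (λ ind → ℕ.<⇒≱ (ℕ.n<1+n (rank M))
            (ℕ.≤-trans (ℕ.≤-reflexive (sym (trans (∣insert∣ i S eqᵢ) (cong suc (proj₂ (proj₂ maximal)))))) (independent-≤ ind)))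
    ...   | C , C⊑ , C≢0 , eq with Vec.lookup C i in eqC
    -- A relation without row `i` would be one among the independent rows in `S`.
    ...     | false = contradiction (independent-zero {S} S-independent {C} C⊑S eq) C≢0
      where
      C⊑S : C ⊑ S
      C⊑S j eqⱼ with j Fin.≟ i
      ... | yes refl = contradiction (trans (sym eqⱼ) eqC) λ ()
      ... | no j≢i   = trans (sym (Vec.lookup∘update′ j≢i S true)) (C⊑ j eqⱼ)
    ...     | true = C ⊕ⱽ single i , C⊕⊑S , trans (rowSum-⊕ⱽ M C (single i))
        (trans (cong₂ _⊕ⱽ_ eq (rowSum-single M i)) (Vec.zipWith-identityˡ Bool.xor-identityˡ (Vec.lookup M i)))
      where
      C⊕⊑S : C ⊕ⱽ single i ⊑ S
      C⊕⊑S j eqⱼ with j Fin.≟ i | lookup-single i j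
      ... | yes refl | eq₁ = contradiction (trans (sym eqⱼ) (trans (lookup-⊕ⱽ C (single i) i) (cong₂ _xor_ eqC eq₁))) λ ()
      ... | no j≢i   | eq₀ = trans (sym (Vec.lookup∘update′ j≢i S true)) (C⊑ j
          (trans (sym (Bool.xor-identityʳ (Vec.lookup C j))) (trans (cong (Vec.lookup C j xor_) (sym eq₀)) (trans (sym (lookup-⊕ⱽ C (single i) j)) eqⱼ))))

    spanned : ∀ {m} (R : Vec (Vec Bool n) m) → (∀ i → Spanned (Vec.lookup R i)) → ∀ D → Spanned (rowSum R D)
    spanned []      rows []          = zeroRow , zeroRow-⊑ S , rowSum-zero M
    spanned (r ∷ R) rows (false ∷ D) = spanned R (rows ∘ suc) D
    spanned (r ∷ R) rows (true ∷ D)  with rows zero | spanned R (rows ∘ suc) D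
    ... | C , C⊑ , eq | C′ , C′⊑ , eq′ = C ⊕ⱽ C′ , ⊕ⱽ-⊑ C C′ S C⊑ C′⊑ , trans (rowSum-⊕ⱽ M C C′) (cong₂ _⊕ⱽ_ eq eq′)

    project : Vec Bool n → Vec Bool n
    project D = proj₁ (spanned M row-spanned D)

    project-⊑ : ∀ D → project D ⊑ S
    project-⊑ D = proj₁ (proj₂ (spanned M row-spanned D))

    rowSum-project : ∀ D → rowSum M (project D) ≡ rowSum M D
    rowSum-project D = proj₂ (proj₂ (spanned M row-spanned D))

    same-rowSum : ∀ {C D} → C ⊑ S → D ⊑ S → rowSum M C ≡ rowSum M D → C ≡ D
    same-rowSum {C} {D} p q eq = ⊕ⱽ-zero (independent-zero {S} S-independent {C ⊕ⱽ D} (⊕ⱽ-⊑ C D S p q)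
      (trans (rowSum-⊕ⱽ M C D) (trans (cong (_⊕ⱽ rowSum M D) eq) (⊕ⱽ-self (rowSum M D)))))

  length-cartesianProduct : ∀ {A B : Set} (xs : List A) (ys : List B) → length (cartesianProduct xs ys) ≡ length xs * length ys
  length-cartesianProduct []       ys = refl
  length-cartesianProduct (x ∷ xs) ys = trans (List.length-++ (map (x ,_) ys))
    (cong₂ _+_ (List.length-map (x ,_) ys) (length-cartesianProduct xs ys))

  length-vectors : ∀ m → length (vectors bits m) ≡ 2 ^ m
  length-vectors zero    = refl
  length-vectors (suc m) = trans (List.length-++ (map (Vec._∷_ false) (vectors bits m))) (cong₂ _+_
    (trans (List.length-map (Vec._∷_ false) (vectors bits m)) (length-vectors m))
    (trans (List.length-++ (map (Vec._∷_ true) (vectors bits m))) (cong (_+ 0)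
      (trans (List.length-map (Vec._∷_ true) (vectors bits m)) (length-vectors m)))))

  -- Every coefficient vector `D` is the sum of a unique vector supported in `S` with the same row
  -- sum and a kernel vector. The former are the subsets of `S`, of which there are 2 to the rank.
  rank-kernel : count kernel? (vectors bits n) * 2 ^ rank M ≡ 2 ^ n
  rank-kernel = begin
    count kernel? (vectors bits n) * 2 ^ rank M
      ≡⟨ ℕ.*-comm (count kernel? (vectors bits n)) (2 ^ rank M) ⟩
    2 ^ rank M * count kernel? (vectors bits n)
      ≡⟨ cong (_* count kernel? (vectors bits n)) (trans (length-masked S) (cong (2 ^_) (proj₂ (proj₂ maximal)))) ⟨
    length (masked S) * count kernel? (vectors bits n)
      ≡⟨ length-cartesianProduct (masked S) (filter kernel? (vectors bits n)) ⟨
    length pairs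
      ≡⟨ length-bijection pairs! (vectors-unique bits-unique n) (λ (C , K) → C ⊕ⱽ K) (λ D → project D , project D ⊕ⱽ D)
           (λ _ → ∈-vectors ∈-bits _) (λ {D} _ → split-∈ D) (λ {p} → split-join {p}) (λ {D} _ → join-split D) ⟩
    length (vectors bits n)
      ≡⟨ length-vectors n ⟩
    2 ^ n ∎
    where
    open ≡-Reasoning
    pairs : List (Vec Bool n × Vec Bool n)
    pairs = cartesianProduct (masked S) (filter kernel? (vectors bits n))
    pairs! : Unique pairs
    pairs! = Unique.cartesianProduct⁺ (masked-unique S) (Unique.filter⁺ kernel? (vectors-unique bits-unique n))
    split-∈ : ∀ D → (project D , project D ⊕ⱽ D) ∈ pairs
    split-∈ D = Membership.∈-cartesianProduct⁺ (∈-masked S (project D) (project-⊑ D))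
      (Membership.∈-filter⁺ kernel? (∈-vectors ∈-bits _) (trans (rowSum-⊕ⱽ M (project D) D)
        (trans (cong (_⊕ⱽ rowSum M D) (rowSum-project D)) (⊕ⱽ-self (rowSum M D)))))
    join-split : ∀ D → project D ⊕ⱽ (project D ⊕ⱽ D) ≡ D
    join-split D = trans (sym (⊕ⱽ-assoc (project D) (project D) D)) (trans (cong (_⊕ⱽ D) (⊕ⱽ-self (project D)))
      (Vec.zipWith-identityˡ Bool.xor-identityˡ D))
    split-join : ∀ {p} → p ∈ pairs → (project (proj₁ p ⊕ⱽ proj₂ p) , project (proj₁ p ⊕ⱽ proj₂ p) ⊕ⱽ (proj₁ p ⊕ⱽ proj₂ p)) ≡ p
    split-join {C , K} p∈ = cong₂ _,_ eq (trans (cong (_⊕ⱽ (C ⊕ⱽ K)) eq)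
        (trans (sym (⊕ⱽ-assoc C C K)) (trans (cong (_⊕ⱽ K) (⊕ⱽ-self C)) (Vec.zipWith-identityˡ Bool.xor-identityˡ K))))
      where
      C∈ : C ∈ masked S
      C∈ = proj₁ (Membership.∈-cartesianProduct⁻ (masked S) _ p∈)
      K∈ : K ∈ filter kernel? (vectors bits n)
      K∈ = proj₂ (Membership.∈-cartesianProduct⁻ (masked S) _ p∈)
      eq : project (C ⊕ⱽ K) ≡ C
      eq = same-rowSum {project (C ⊕ⱽ K)} {C} (project-⊑ (C ⊕ⱽ K)) (∈-masked⁻ S C∈) (trans (rowSum-project (C ⊕ⱽ K)) (trans (rowSum-⊕ⱽ M C K)
        (trans (cong (rowSum M C ⊕ⱽ_) (proj₂ (Membership.∈-filter⁻ kernel? {xs = vectors bits n} K∈))) (⊕ⱽ-identityʳ (rowSum M C)))))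

  rank⇔kernel : ∀ j → (rank M ≡ j → count kernel? (vectors bits n) * 2 ^ j ≡ 2 ^ n)
                    × (count kernel? (vectors bits n) * 2 ^ j ≡ 2 ^ n → rank M ≡ j)
  rank⇔kernel j = (λ { refl → rank-kernel }) , λ eq → 2^-injective (ℕ.*-cancelˡ-≡ _ _ K {{K≢0}} (trans rank-kernel (sym eq)))
    where
    K = count kernel? (vectors bits n)
    K≢0 : ℕ.NonZero K
    K≢0 = ℕ.≢-nonZero λ K≡0 →
      ℕ.≢-nonZero⁻¹ (2 ^ n) {{ℕ.m^n≢0 2 n}} (trans (sym rank-kernel) (cong (_* 2 ^ rank M) K≡0))

-- Bordered matrices

dimension : List Side → ℕ
dimension []      = 2
dimension (s ∷ S) = suc (dimension S)

dimension-length : ∀ S → dimension S ≡ 2 + length S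
dimension-length []      = refl
dimension-length (s ∷ S) = cong suc (dimension-length S)

-- The faces are listed in the order in which they are left behind; current S t is the first face on the side t.
current : ∀ S → Side → Fin (dimension S)
current []          above = 0F
current []          below = 1F
current (above ∷ S) above = 0F
current (above ∷ S) below = suc (current S below)
current (below ∷ S) above = suc (current S above)
current (below ∷ S) below = 0F

current-distinct : ∀ S s → current S s ≢ current S (flip s)
current-distinct []          above ()
current-distinct []          below ()
current-distinct (above ∷ S) above ()
current-distinct (above ∷ S) below ()
current-distinct (below ∷ S) above ()
current-distinct (below ∷ S) below ()

is : ∀ {n} → Fin n → Fin n → Bool
is p v = does (v Fin.≟ p)

is-refl : ∀ {n} (p : Fin n) → is p p ≡ true
is-refl p = dec-true (p Fin.≟ p) refl

is-≢ : ∀ {n} {p v : Fin n} → v ≢ p → is p v ≡ false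
is-≢ {p = p} {v} = dec-false (v Fin.≟ p)

link : ∀ S → Side → (g y : Bool) → Fin (dimension S) → Bool
link S s g y v = if is (current S s) v then y else is (current S (flip s)) v ∧ g

-- Every step borders the matrix of the remaining ladder by the face it completes, which meets only
-- the two current faces of the rest. This is the matrix whose kernel the sweep of `transfer`
-- counts.
build : ∀ S → Vec Bool (slots S) → Fin (dimension S) → Fin (dimension S) → Bool
build []      (g ∷ x ∷ z ∷ []) 0F      0F      = x
build []      (g ∷ x ∷ z ∷ []) 0F      1F      = g
build []      (g ∷ x ∷ z ∷ []) 1F      0F      = g
build []      (g ∷ x ∷ z ∷ []) 1F      1F      = z
build (s ∷ S) (g ∷ y ∷ d ∷ τ)  zero    zero    = d
build (s ∷ S) (g ∷ y ∷ d ∷ τ)  zero    (suc w) = link S s g y w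
build (s ∷ S) (g ∷ y ∷ d ∷ τ)  (suc v) zero    = link S s g y v
build (s ∷ S) (g ∷ y ∷ d ∷ τ)  (suc v) (suc w) = build S τ v w

read : ∀ S → (Fin (dimension S) → Fin (dimension S) → Bool) → Vec Bool (slots S)
read []      m = m 0F 1F ∷ m 0F 0F ∷ m 1F 1F ∷ []
read (s ∷ S) m = m zero (suc (current S (flip s))) ∷ m zero (suc (current S s)) ∷ m zero zero
               ∷ read S (λ v w → m (suc v) (suc w))

link-flip : ∀ S s g y → link S s g y (current S (flip s)) ≡ g
link-flip S s g y = trans
  (cong (λ b → if b then y else is (current S (flip s)) (current S (flip s)) ∧ g) (is-≢ (current-distinct S s ∘ sym)))
  (cong (_∧ g) (is-refl (current S (flip s))))

link-same : ∀ S s g y → link S s g y (current S s) ≡ y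
link-same S s g y = cong (λ b → if b then y else is (current S (flip s)) (current S s) ∧ g) (is-refl (current S s))

link-xor : ∀ S s g y v → link S s g y v ≡ (is (current S s) v ∧ y) xor (is (current S (flip s)) v ∧ g)
link-xor S s g y v with v Fin.≟ current S s | v Fin.≟ current S (flip s)
... | yes p | yes q = contradiction (trans (sym p) q) (current-distinct S s)
... | yes p | no _  = sym (Bool.xor-identityʳ y)
... | no _  | yes q = refl
... | no _  | no _  = refl

read-cong : ∀ S {m m′} → (∀ v w → m v w ≡ m′ v w) → read S m ≡ read S m′
read-cong []      eq = cong₂ _∷_ (eq _ _) (cong₂ _∷_ (eq _ _) (cong (_∷ []) (eq _ _)))
read-cong (s ∷ S) eq = cong₂ _∷_ (eq _ _) (cong₂ _∷_ (eq _ _) (cong₂ _∷_ (eq _ _) (read-cong S λ v w → eq (suc v) (suc w))))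

read-build : ∀ S τ → read S (build S τ) ≡ τ
read-build []      (g ∷ x ∷ z ∷ []) = refl
read-build (s ∷ S) (g ∷ y ∷ d ∷ τ)  =
  cong₂ _∷_ (link-flip S s g y) (cong₂ _∷_ (link-same S s g y) (cong (d ∷_) (read-build S τ)))

build-symmetric : ∀ S τ v w → build S τ v w ≡ build S τ w v
build-symmetric []      (g ∷ x ∷ z ∷ []) 0F      0F      = refl
build-symmetric []      (g ∷ x ∷ z ∷ []) 0F      1F      = refl
build-symmetric []      (g ∷ x ∷ z ∷ []) 1F      0F      = refl
build-symmetric []      (g ∷ x ∷ z ∷ []) 1F      1F      = refl
build-symmetric (s ∷ S) (g ∷ y ∷ d ∷ τ)  zero    zero    = refl
build-symmetric (s ∷ S) (g ∷ y ∷ d ∷ τ)  zero    (suc w) = refl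
build-symmetric (s ∷ S) (g ∷ y ∷ d ∷ τ)  (suc v) zero    = refl
build-symmetric (s ∷ S) (g ∷ y ∷ d ∷ τ)  (suc v) (suc w) = build-symmetric S τ v w

link-mono : ∀ S s {g g′ y y′} v → (g ≡ true → g′ ≡ true) → (y ≡ true → y′ ≡ true) →
            link S s g y v ≡ true → link S s g′ y′ v ≡ true
link-mono S s v g≤ y≤ eq with is (current S s) v | is (current S (flip s)) v
... | true  | _    = y≤ eq
... | false | true = g≤ eq

build-mono : ∀ S {τ μ} → τ ⊑ μ → ∀ v w → build S τ v w ≡ true → build S μ v w ≡ true
build-mono []      {g ∷ x ∷ z ∷ []} {_ ∷ _ ∷ _ ∷ []} le 0F      0F      = le 1F
build-mono []      {g ∷ x ∷ z ∷ []} {_ ∷ _ ∷ _ ∷ []} le 0F      1F      = le 0F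
build-mono []      {g ∷ x ∷ z ∷ []} {_ ∷ _ ∷ _ ∷ []} le 1F      0F      = le 0F
build-mono []      {g ∷ x ∷ z ∷ []} {_ ∷ _ ∷ _ ∷ []} le 1F      1F      = le 2F
build-mono (s ∷ S) {g ∷ y ∷ d ∷ τ}  {_ ∷ _ ∷ _ ∷ μ}  le zero    zero    = le 2F
build-mono (s ∷ S) {g ∷ y ∷ d ∷ τ}  {_ ∷ _ ∷ _ ∷ μ}  le zero    (suc w) = link-mono S s w (le 0F) (le 1F)
build-mono (s ∷ S) {g ∷ y ∷ d ∷ τ}  {_ ∷ _ ∷ _ ∷ μ}  le (suc v) zero    = link-mono S s v (le 0F) (le 1F)
build-mono (s ∷ S) {g ∷ y ∷ d ∷ τ}  {_ ∷ _ ∷ _ ∷ μ}  le (suc v) (suc w) = build-mono S (λ i → le (inner i)) v w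

module _ where
  private
    false-unless : ∀ {x y} → (x ≡ true → y ≡ true) → y ≡ false → x ≡ false
    false-unless {false} le eq = refl
    false-unless {true}  le eq = contradiction (trans (sym (le refl)) eq) λ ()

    link-read : ∀ S s {g y} {f : Fin (dimension S) → Bool} → (∀ w → f w ≡ true → link S s g y w ≡ true) →
                ∀ w → link S s (f (current S (flip s))) (f (current S s)) w ≡ f w
    link-read S s le w with w Fin.≟ current S s | w Fin.≟ current S (flip s) | le w
    ... | yes refl | _        | _   = refl
    ... | no _     | yes refl | _   = refl
    ... | no _     | no _     | le′ = sym (false-unless le′ refl)

  -- `read` samples only the entries that have slots. The bound by the matrix of `μ` makes all other
  -- entries of `m` vanish, as they do in any matrix that is built.
  build-read : ∀ S μ {m} → (∀ v w → m v w ≡ m w v) → (∀ v w → m v w ≡ true → build S μ v w ≡ true) →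
               ∀ v w → build S (read S m) v w ≡ m v w
  build-read []      (_ ∷ _ ∷ _ ∷ []) symm le 0F      0F      = refl
  build-read []      (_ ∷ _ ∷ _ ∷ []) symm le 0F      1F      = refl
  build-read []      (_ ∷ _ ∷ _ ∷ []) symm le 1F      0F      = symm 0F 1F
  build-read []      (_ ∷ _ ∷ _ ∷ []) symm le 1F      1F      = refl
  build-read (s ∷ S) (g ∷ y ∷ d ∷ μ)  symm le zero    zero    = refl
  build-read (s ∷ S) (g ∷ y ∷ d ∷ μ)  {m} symm le zero    (suc w) = link-read S s {f = λ v → m zero (suc v)} (le zero ∘ suc) w
  build-read (s ∷ S) (g ∷ y ∷ d ∷ μ)  {m} symm le (suc v) zero    =
    trans (link-read S s {f = λ v → m zero (suc v)} (le zero ∘ suc) v) (symm zero (suc v))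
  build-read (s ∷ S) (g ∷ y ∷ d ∷ μ)  symm le (suc v) (suc w) =
    build-read S μ (λ v w → symm (suc v) (suc w)) (λ v w → le (suc v) (suc w)) v w

read-⊑ : ∀ S μ {m} → (∀ v w → m v w ≡ true → build S μ v w ≡ true) → read S m ⊑ μ
read-⊑ []      (_ ∷ _ ∷ _ ∷ []) le 0F        = le 0F 1F
read-⊑ []      (_ ∷ _ ∷ _ ∷ []) le 1F        = le 0F 0F
read-⊑ []      (_ ∷ _ ∷ _ ∷ []) le 2F        = le 1F 1F
read-⊑ (s ∷ S) (g ∷ y ∷ d ∷ μ)  le 0F        = λ eq → trans (sym (link-flip S s g y)) (le zero (suc (current S (flip s))) eq)
read-⊑ (s ∷ S) (g ∷ y ∷ d ∷ μ)  le 1F        = λ eq → trans (sym (link-same S s g y)) (le zero (suc (current S s)) eq)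
read-⊑ (s ∷ S) (g ∷ y ∷ d ∷ μ)  le 2F        = le zero zero
read-⊑ (s ∷ S) (g ∷ y ∷ d ∷ μ)  le (inner i) = read-⊑ S μ (λ v w → le (suc v) (suc w)) i

-- Kernel vectors of bordered matrices

valueAt : ∀ S → Vec Bool (dimension S) → Side → Bool
valueAt S φ t = Vec.lookup φ (current S t)

holds : ∀ S → Vec Bool (slots S) → (r t : Bool) → Vec Bool (dimension S) → Bool
holds []          (g ∷ x ∷ z ∷ []) r t (a ∷ b ∷ []) = (r ⇔ᵇ ((x ∧ a) xor (g ∧ b))) ∧ (t ⇔ᵇ ((z ∧ b) xor (g ∧ a)))
holds (above ∷ S) (g ∷ y ∷ d ∷ τ)  r t (a ∷ φ) =
  (r ⇔ᵇ ((d ∧ a) xor ((y ∧ valueAt S φ above) xor (g ∧ valueAt S φ below)))) ∧ holds S τ (y ∧ a) (t xor (g ∧ a)) φ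
holds (below ∷ S) (g ∷ y ∷ d ∷ τ)  r t (b ∷ φ) =
  (t ⇔ᵇ ((d ∧ b) xor ((y ∧ valueAt S φ below) xor (g ∧ valueAt S φ above)))) ∧ holds S τ (r xor (g ∧ b)) (y ∧ b) φ

∑ᵇ-∑ⱽ : ∀ n (F : Bool → Vec Bool n → ℕ) → (∑ᵇ λ c → ∑ⱽ n (F c)) ≡ ∑ⱽ n λ φ → ∑ᵇ λ c → F c φ
∑ᵇ-∑ⱽ n F = sym (∑ⱽ-+ n (F false) (F true))

∑ᵇ-select : ∀ n a (H : Bool → Vec Bool n → Bool) →
            (∑ᵇ λ x → ∑ⱽ n λ φ → ⟦ (x ⇔ᵇ a) ∧ H x φ ⟧) ≡ ∑ⱽ n λ φ → ⟦ H a φ ⟧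
∑ᵇ-select n false H = trans (cong (∑ⱽ n (λ φ → ⟦ H false φ ⟧) +_) (∑ⱽ-zero n λ φ → refl)) (ℕ.+-identityʳ _)
∑ᵇ-select n true  H = cong (_+ ∑ⱽ n (λ φ → ⟦ H true φ ⟧)) (∑ⱽ-zero n λ φ → refl)

-- The sweep sums over one face at a time, while `holds` tests a whole vector. The sum over `c`
-- picks the value that the vector has on the next face.
transfer-sum : ∀ S τ a b r t → transfer S τ a b r t ≡
  ∑ⱽ (dimension S) λ φ → ⟦ (valueAt S φ above ⇔ᵇ a) ∧ ((valueAt S φ below ⇔ᵇ b) ∧ holds S τ r t φ) ⟧
transfer-sum [] (g ∷ x ∷ z ∷ []) = exhaust′ ℕ._≟_ 7 close
  (λ g x z a b r t → ∑ᵇ λ p → ∑ᵇ λ q → ⟦ (p ⇔ᵇ a) ∧ ((q ⇔ᵇ b) ∧ holds [] (g ∷ x ∷ z ∷ []) r t (p ∷ q ∷ [])) ⟧) refl g x z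
transfer-sum (above ∷ S) (g ∷ y ∷ d ∷ τ) a b r t = begin
  (∑ᵇ λ c → ⟦ B c ⟧ * transfer S τ c b r′ t′)
    ≡⟨ ∑ᵇ-cong (λ c → trans (cong (⟦ B c ⟧ *_) (transfer-sum S τ c b r′ t′)) (sym (∑ⱽ-* (dimension S) ⟦ B c ⟧ (F c)))) ⟩
  (∑ᵇ λ c → ∑ⱽ (dimension S) λ φ → ⟦ B c ⟧ * F c φ)
    ≡⟨ ∑ᵇ-∑ⱽ (dimension S) (λ c φ → ⟦ B c ⟧ * F c φ) ⟩
  ∑ⱽ (dimension S) (λ φ → ∑ᵇ λ c → ⟦ B c ⟧ * F c φ)
    ≡⟨ ∑ⱽ-cong (dimension S) (λ φ → exhaust′ ℕ._≟_ 9
         (λ p q b r d a y g h → ∑ᵇ λ c → ⟦ r ⇔ᵇ ((d ∧ a) xor ((y ∧ c) xor (g ∧ b))) ⟧ * ⟦ (p ⇔ᵇ c) ∧ ((q ⇔ᵇ b) ∧ h) ⟧)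
         (λ p q b r d a y g h → ⟦ (q ⇔ᵇ b) ∧ ((r ⇔ᵇ ((d ∧ a) xor ((y ∧ p) xor (g ∧ q)))) ∧ h) ⟧) refl
         (valueAt S φ above) (valueAt S φ below) b r d a y g (holds S τ r′ t′ φ)) ⟩
  ∑ⱽ (dimension S) (λ φ → ⟦ K a φ ⟧)
    ≡⟨ ∑ᵇ-select (dimension S) a K ⟨
  (∑ᵇ λ x → ∑ⱽ (dimension S) λ φ → ⟦ (x ⇔ᵇ a) ∧ K x φ ⟧) ∎
  where
  open ≡-Reasoning
  r′ = y ∧ a
  t′ = t xor (g ∧ a)
  B : Bool → Bool
  B c = r ⇔ᵇ ((d ∧ a) xor ((y ∧ c) xor (g ∧ b)))
  F : Bool → Vec Bool (dimension S) → ℕ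
  F c φ = ⟦ (valueAt S φ above ⇔ᵇ c) ∧ ((valueAt S φ below ⇔ᵇ b) ∧ holds S τ r′ t′ φ) ⟧
  K : Bool → Vec Bool (dimension S) → Bool
  K x φ = (valueAt S φ below ⇔ᵇ b) ∧ holds (above ∷ S) (g ∷ y ∷ d ∷ τ) r t (x ∷ φ)
transfer-sum (below ∷ S) (g ∷ y ∷ d ∷ τ) a b r t = begin
  (∑ᵇ λ c → ⟦ B c ⟧ * transfer S τ a c r′ t′)
    ≡⟨ ∑ᵇ-cong (λ c → trans (cong (⟦ B c ⟧ *_) (transfer-sum S τ a c r′ t′)) (sym (∑ⱽ-* (dimension S) ⟦ B c ⟧ (F c)))) ⟩
  (∑ᵇ λ c → ∑ⱽ (dimension S) λ φ → ⟦ B c ⟧ * F c φ)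
    ≡⟨ ∑ᵇ-∑ⱽ (dimension S) (λ c φ → ⟦ B c ⟧ * F c φ) ⟩
  ∑ⱽ (dimension S) (λ φ → ∑ᵇ λ c → ⟦ B c ⟧ * F c φ)
    ≡⟨ ∑ⱽ-cong (dimension S) (λ φ → exhaust′ ℕ._≟_ 9
         (λ p q a t d b y g h → ∑ᵇ λ c → ⟦ t ⇔ᵇ ((d ∧ b) xor ((y ∧ c) xor (g ∧ a))) ⟧ * ⟦ (p ⇔ᵇ a) ∧ ((q ⇔ᵇ c) ∧ h) ⟧)
         (λ p q a t d b y g h → ⟦ (p ⇔ᵇ a) ∧ ((t ⇔ᵇ ((d ∧ b) xor ((y ∧ q) xor (g ∧ p)))) ∧ h) ⟧) refl
         (valueAt S φ above) (valueAt S φ below) a t d b y g (holds S τ r′ t′ φ)) ⟩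
  ∑ⱽ (dimension S) (λ φ → ⟦ K b φ ⟧)
    ≡⟨ ∑ᵇ-select (dimension S) b K ⟨
  (∑ᵇ λ x → ∑ⱽ (dimension S) λ φ → ⟦ (x ⇔ᵇ b) ∧ K x φ ⟧)
    ≡⟨ ∑ᵇ-cong (λ x → ∑ⱽ-cong (dimension S) λ φ → cong ⟦_⟧ (boolean 3 (λ u v w → u ∧ (v ∧ w)) (λ u v w → v ∧ (u ∧ w)) refl
         (x ⇔ᵇ b) (valueAt S φ above ⇔ᵇ a) (holds (below ∷ S) (g ∷ y ∷ d ∷ τ) r t (x ∷ φ)))) ⟩
  (∑ᵇ λ x → ∑ⱽ (dimension S) λ φ →
    ⟦ (valueAt S φ above ⇔ᵇ a) ∧ ((x ⇔ᵇ b) ∧ holds (below ∷ S) (g ∷ y ∷ d ∷ τ) r t (x ∷ φ)) ⟧) ∎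
  where
  open ≡-Reasoning
  r′ = r xor (g ∧ b)
  t′ = y ∧ b
  B : Bool → Bool
  B c = t ⇔ᵇ ((d ∧ b) xor ((y ∧ c) xor (g ∧ a)))
  F : Bool → Vec Bool (dimension S) → ℕ
  F c φ = ⟦ (valueAt S φ above ⇔ᵇ a) ∧ ((valueAt S φ below ⇔ᵇ c) ∧ holds S τ r′ t′ φ) ⟧
  K : Bool → Vec Bool (dimension S) → Bool
  K x φ = (valueAt S φ above ⇔ᵇ a) ∧ holds (below ∷ S) (g ∷ y ∷ d ∷ τ) r t (x ∷ φ)

kernelSize-holds : ∀ S τ → kernelSize S τ ≡ ∑ⱽ (dimension S) λ φ → ⟦ holds S τ false false φ ⟧
kernelSize-holds S τ = trans
  (∑ᵇ-cong λ a → trans (∑ᵇ-cong λ b → transfer-sum S τ a b false false) (∑ᵇ-∑ⱽ (dimension S) (F a)))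
  (trans (∑ᵇ-∑ⱽ (dimension S) (λ a φ → ∑ᵇ λ b → F a b φ))
    (∑ⱽ-cong (dimension S) λ φ → exhaust′ ℕ._≟_ 3 (λ p q h → ∑ᵇ λ a → ∑ᵇ λ b → ⟦ (p ⇔ᵇ a) ∧ ((q ⇔ᵇ b) ∧ h) ⟧)
      (λ p q h → ⟦ h ⟧) refl (valueAt S φ above) (valueAt S φ below) (holds S τ false false φ)))
  where
  F : Bool → Bool → Vec Bool (dimension S) → ℕ
  F a b φ = ⟦ (valueAt S φ above ⇔ᵇ a) ∧ ((valueAt S φ below ⇔ᵇ b) ∧ holds S τ false false φ) ⟧

⨁-false : ∀ {n} (f : Fin n → Bool) → (∀ i → f i ≡ false) → ⨁ f ≡ false
⨁-false {zero}  f eq = refl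
⨁-false {suc n} f eq = cong₂ _xor_ (eq zero) (⨁-false (f ∘ suc) (eq ∘ suc))

⨁-is : ∀ {n} (f : Fin n → Bool) p y → ⨁ (λ w → f w ∧ (is p w ∧ y)) ≡ f p ∧ y
⨁-is f zero y = trans (cong ((f zero ∧ y) xor_) (⨁-false _ λ i → Bool.∧-zeroʳ (f (suc i)))) (Bool.xor-identityʳ (f zero ∧ y))
⨁-is f (suc p) y = trans (cong (_xor ⨁ (λ w → f (suc w) ∧ (is p w ∧ y))) (Bool.∧-zeroʳ (f zero))) (⨁-is (f ∘ suc) p y)

⨁-link : ∀ S s g y (f : Fin (dimension S) → Bool) →
         ⨁ (λ w → f w ∧ link S s g y w) ≡ (f (current S s) ∧ y) xor (f (current S (flip s)) ∧ g)
⨁-link S s g y f = trans (⨁-cong λ w → trans (cong (f w ∧_) (link-xor S s g y w))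
    (Bool.∧-distribˡ-xor (f w) (is (current S s) w ∧ y) (is (current S (flip s)) w ∧ g)))
  (trans (⨁-xor (λ w → f w ∧ (is (current S s) w ∧ y)) (λ w → f w ∧ (is (current S (flip s)) w ∧ g)))
    (cong₂ _xor_ (⨁-is f (current S s) y) (⨁-is f (current S (flip s)) g)))

-- The faces already completed are adjacent only to the two current ones, so they act as right-hand
-- sides `r` and `t` of these two equations. With both false this is membership in the kernel.
Solves : ∀ S → Vec Bool (slots S) → (r t : Bool) → Vec Bool (dimension S) → Set
Solves S τ r t φ = ∀ v → ⨁ (λ w → Vec.lookup φ w ∧ build S τ w v)
                       ≡ (is (current S above) v ∧ r) xor (is (current S below) v ∧ t)

∧-elim : ∀ {x y} → x ∧ y ≡ true → x ≡ true × y ≡ true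
∧-elim {true} eq = refl , eq

holds⇒solves : ∀ S τ r t φ → holds S τ r t φ ≡ true → Solves S τ r t φ
holds⇒solves [] (g ∷ x ∷ z ∷ []) r t (a ∷ b ∷ []) h 0F =
  booleanIf 7 (λ g x z r t a b → holds [] (g ∷ x ∷ z ∷ []) r t (a ∷ b ∷ []))
    (λ g x z r t a b → (a ∧ x) xor ((b ∧ g) xor false)) (λ g x z r t a b → r xor false) refl g x z r t a b h
holds⇒solves [] (g ∷ x ∷ z ∷ []) r t (a ∷ b ∷ []) h 1F =
  booleanIf 7 (λ g x z r t a b → holds [] (g ∷ x ∷ z ∷ []) r t (a ∷ b ∷ []))
    (λ g x z r t a b → (a ∧ g) xor ((b ∧ z) xor false)) (λ g x z r t a b → t) refl g x z r t a b h
holds⇒solves (above ∷ S) (g ∷ y ∷ d ∷ τ) r t (a ∷ φ) h zero = trans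
  (cong ((a ∧ d) xor_) (⨁-link S above g y (Vec.lookup φ)))
  (booleanIf 7 (λ g y d r a p q → r ⇔ᵇ ((d ∧ a) xor ((y ∧ p) xor (g ∧ q))))
    (λ g y d r a p q → (a ∧ d) xor ((p ∧ y) xor (q ∧ g))) (λ g y d r a p q → r xor false) refl
    g y d r a (valueAt S φ above) (valueAt S φ below) (proj₁ (∧-elim h)))
holds⇒solves (above ∷ S) (g ∷ y ∷ d ∷ τ) r t (a ∷ φ) h (suc v) = trans
  (cong₂ (λ l s → (a ∧ l) xor s) (link-xor S above g y v) (holds⇒solves S τ (y ∧ a) (t xor (g ∧ a)) φ (proj₂ (∧-elim h)) v))
  (boolean 6 (λ g y a t p q → (a ∧ ((p ∧ y) xor (q ∧ g))) xor ((p ∧ (y ∧ a)) xor (q ∧ (t xor (g ∧ a))))) (λ g y a t p q → q ∧ t) refl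
    g y a t (is (current S above) v) (is (current S below) v))
holds⇒solves (below ∷ S) (g ∷ y ∷ d ∷ τ) r t (b ∷ φ) h zero = trans
  (cong ((b ∧ d) xor_) (⨁-link S below g y (Vec.lookup φ)))
  (booleanIf 7 (λ g y d t b p q → t ⇔ᵇ ((d ∧ b) xor ((y ∧ q) xor (g ∧ p))))
    (λ g y d t b p q → (b ∧ d) xor ((q ∧ y) xor (p ∧ g))) (λ g y d t b p q → t) refl
    g y d t b (valueAt S φ above) (valueAt S φ below) (proj₁ (∧-elim h)))
holds⇒solves (below ∷ S) (g ∷ y ∷ d ∷ τ) r t (b ∷ φ) h (suc v) = trans
  (cong₂ (λ l s → (b ∧ l) xor s) (link-xor S below g y v) (holds⇒solves S τ (r xor (g ∧ b)) (y ∧ b) φ (proj₂ (∧-elim h)) v))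
  (boolean 6 (λ g y b r p q → (b ∧ ((q ∧ y) xor (p ∧ g))) xor ((p ∧ (r xor (g ∧ b))) xor (q ∧ (y ∧ b)))) (λ g y b r p q → (p ∧ r) xor false) refl
    g y b r (is (current S above) v) (is (current S below) v))

solves⇒holds : ∀ S τ r t φ → Solves S τ r t φ → holds S τ r t φ ≡ true
solves⇒holds [] (g ∷ x ∷ z ∷ []) r t (a ∷ b ∷ []) sol =
  booleanIf 7 (λ g x z r t a b → (((a ∧ x) xor ((b ∧ g) xor false)) ⇔ᵇ (r xor false)) ∧ (((a ∧ g) xor ((b ∧ z) xor false)) ⇔ᵇ t))
    (λ g x z r t a b → holds [] (g ∷ x ∷ z ∷ []) r t (a ∷ b ∷ [])) (λ g x z r t a b → true) refl g x z r t a b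
    (∧-intro (⇔ᵇ-refl (sol 0F)) (⇔ᵇ-refl (sol 1F)))
solves⇒holds (above ∷ S) (g ∷ y ∷ d ∷ τ) r t (a ∷ φ) sol = ∧-intro
  (booleanIf 7 (λ g y d r a p q → ((a ∧ d) xor ((p ∧ y) xor (q ∧ g))) ⇔ᵇ (r xor false))
    (λ g y d r a p q → r ⇔ᵇ ((d ∧ a) xor ((y ∧ p) xor (g ∧ q)))) (λ g y d r a p q → true) refl
    g y d r a (valueAt S φ above) (valueAt S φ below)
    (⇔ᵇ-refl (trans (cong ((a ∧ d) xor_) (sym (⨁-link S above g y (Vec.lookup φ)))) (sol zero))))
  (solves⇒holds S τ (y ∧ a) (t xor (g ∧ a)) φ λ v → booleanIf 7
    (λ g y a t p q s → ((a ∧ ((p ∧ y) xor (q ∧ g))) xor s) ⇔ᵇ (q ∧ t))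
    (λ g y a t p q s → s) (λ g y a t p q s → (p ∧ (y ∧ a)) xor (q ∧ (t xor (g ∧ a)))) refl
    g y a t (is (current S above) v) (is (current S below) v) (⨁ λ w → Vec.lookup φ w ∧ build S τ w v)
    (⇔ᵇ-refl (trans (cong (λ l → (a ∧ l) xor (⨁ λ w → Vec.lookup φ w ∧ build S τ w v)) (sym (link-xor S above g y v))) (sol (suc v)))))
solves⇒holds (below ∷ S) (g ∷ y ∷ d ∷ τ) r t (b ∷ φ) sol = ∧-intro
  (booleanIf 7 (λ g y d t b p q → ((b ∧ d) xor ((q ∧ y) xor (p ∧ g))) ⇔ᵇ t)
    (λ g y d t b p q → t ⇔ᵇ ((d ∧ b) xor ((y ∧ q) xor (g ∧ p)))) (λ g y d t b p q → true) refl
    g y d t b (valueAt S φ above) (valueAt S φ below)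
    (⇔ᵇ-refl (trans (cong ((b ∧ d) xor_) (sym (⨁-link S below g y (Vec.lookup φ)))) (sol zero))))
  (solves⇒holds S τ (r xor (g ∧ b)) (y ∧ b) φ λ v → booleanIf 7
    (λ g y b r p q s → ((b ∧ ((q ∧ y) xor (p ∧ g))) xor s) ⇔ᵇ ((p ∧ r) xor false))
    (λ g y b r p q s → s) (λ g y b r p q s → (p ∧ (r xor (g ∧ b))) xor (q ∧ (y ∧ b))) refl
    g y b r (is (current S above) v) (is (current S below) v) (⨁ λ w → Vec.lookup φ w ∧ build S τ w v)
    (⇔ᵇ-refl (trans (cong (λ l → (b ∧ l) xor (⨁ λ w → Vec.lookup φ w ∧ build S τ w v)) (sym (link-xor S below g y v))) (sol (suc v)))))

-- Matrices of a given form, counted by rank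

module Bordered (S : List Side) (μ : Vec Bool (slots S)) {n} (ρ : Permutation n (dimension S))
  {Form : Matrix n → Set} (form? : Decidable Form)
  (form⇒symmetric : ∀ {M} → Form M → ∀ p q → entry M p q ≡ entry M q p)
  (form⇒below : ∀ {M} → Form M → ∀ p q → entry M p q ≡ true → build S μ (Inverse.to ρ p) (Inverse.to ρ q) ≡ true)
  (⇒form : ∀ {M} → (∀ p q → entry M p q ≡ entry M q p) →
           (∀ p q → entry M p q ≡ true → build S μ (Inverse.to ρ p) (Inverse.to ρ q) ≡ true) → Form M) where

  private
    to : Fin n → Fin (dimension S)
    to = Inverse.to ρ

    from : Fin (dimension S) → Fin n
    from = Inverse.from ρ

    to-from : ∀ v → to (from v) ≡ v
    to-from v = Inverse.inverseˡ ρ refl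

    from-to : ∀ p → from (to p) ≡ p
    from-to p = Inverse.inverseʳ ρ refl

    entries : Matrix n → Fin (dimension S) → Fin (dimension S) → Bool
    entries M v w = entry M (from v) (from w)

    encode : Matrix n → Vec Bool (slots S)
    encode M = read S (entries M)

    decode : Vec Bool (slots S) → Matrix n
    decode τ = Vec.tabulate λ p → Vec.tabulate λ q → build S τ (to p) (to q)

    entry-decode : ∀ τ p q → entry (decode τ) p q ≡ build S τ (to p) (to q)
    entry-decode τ p q = trans (cong (λ r → Vec.lookup r q) (Vec.lookup∘tabulate _ p)) (Vec.lookup∘tabulate _ q)

    encode-decode : ∀ τ → encode (decode τ) ≡ τ
    encode-decode τ = trans (read-cong S λ v w → trans (entry-decode τ (from v) (from w))
      (cong₂ (build S τ) (to-from v) (to-from w))) (read-build S τ)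

    below′ : ∀ {M} → Form M → ∀ v w → entries M v w ≡ true → build S μ v w ≡ true
    below′ form v w eq = subst₂ (λ v w → build S μ v w ≡ true) (to-from v) (to-from w) (form⇒below form (from v) (from w) eq)

    build-encode : ∀ {M} → Form M → ∀ p q → build S (encode M) (to p) (to q) ≡ entry M p q
    build-encode {M} form p q = trans
      (build-read S μ {entries M} (λ v w → form⇒symmetric form (from v) (from w)) (below′ form) (to p) (to q))
      (cong₂ (entry M) (from-to p) (from-to q))

    decode-encode : ∀ {M} → Form M → decode (encode M) ≡ M
    decode-encode {M} form = trans
      (Vec.tabulate-cong λ p → trans (Vec.tabulate-cong (build-encode form p)) (Vec.tabulate∘lookup (Vec.lookup M p)))
      (Vec.tabulate∘lookup M)

    decode-form : ∀ {τ} → τ ⊑ μ → Form (decode τ)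
    decode-form {τ} le = ⇒form
      (λ p q → trans (entry-decode τ p q) (trans (build-symmetric S τ (to p) (to q)) (sym (entry-decode τ q p))))
      (λ p q eq → build-mono S le (to p) (to q) (trans (sym (entry-decode τ p q)) eq))

    module _ (M : Matrix n) (τ : Vec Bool (slots S)) (M≡ : ∀ p q → entry M p q ≡ build S τ (to p) (to q)) where
      open RankKernel M

      push : Vec Bool n → Vec Bool (dimension S)
      push C = Vec.tabulate (Vec.lookup C ∘ from)

      pull : Vec Bool (dimension S) → Vec Bool n
      pull φ = Vec.tabulate (Vec.lookup φ ∘ to)

      push-pull : ∀ φ → push (pull φ) ≡ φ
      push-pull φ = trans (Vec.tabulate-cong λ v → trans (Vec.lookup∘tabulate (Vec.lookup φ ∘ to) (from v))
        (cong (Vec.lookup φ) (to-from v))) (Vec.tabulate∘lookup φ)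

      pull-push : ∀ C → pull (push C) ≡ C
      pull-push C = trans (Vec.tabulate-cong λ p → trans (Vec.lookup∘tabulate (Vec.lookup C ∘ from) (to p))
        (cong (Vec.lookup C) (from-to p))) (Vec.tabulate∘lookup C)

      lookup-pull : ∀ φ q → Vec.lookup (rowSum M (pull φ)) q ≡ ⨁ (λ w → Vec.lookup φ w ∧ build S τ w (to q))
      lookup-pull φ q = trans (lookup-rowSum M (pull φ) q) (trans
        (⨁-cong λ p → cong₂ _∧_ (Vec.lookup∘tabulate (Vec.lookup φ ∘ to) p) (M≡ p q))
        (sym (⨁-permute (λ w → Vec.lookup φ w ∧ build S τ w (to q)) ρ)))

      no-residue : ∀ p q → (p ∧ false) xor (q ∧ false) ≡ false
      no-residue = boolean 2 (λ p q → (p ∧ false) xor (q ∧ false)) (λ p q → false) refl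

      pull-kernel : ∀ φ → holds S τ false false φ ≡ true → rowSum M (pull φ) ≡ zeroRow
      pull-kernel φ h = lookup-injectiveⱽ λ q → trans (lookup-pull φ q)
        (trans (holds⇒solves S τ false false φ h (to q)) (trans (no-residue (is (current S above) (to q)) (is (current S below) (to q))) (sym (Vec.lookup-replicate q false))))

      kernel-holds : ∀ φ → rowSum M (pull φ) ≡ zeroRow → holds S τ false false φ ≡ true
      kernel-holds φ eq = solves⇒holds S τ false false φ λ v → trans
        (subst (λ u → ⨁ (λ w → Vec.lookup φ w ∧ build S τ w u) ≡ false) (to-from v)
          (trans (sym (lookup-pull φ (from v))) (trans (cong (λ r → Vec.lookup r (from v)) eq) (Vec.lookup-replicate (from v) false))))
        (sym (no-residue (is (current S above) v) (is (current S below) v)))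

      kernel-count : count kernel? (vectors bits n) ≡ kernelSize S τ
      kernel-count = begin
        count kernel? (vectors bits n)
          ≡⟨ count-bijection kernel? holds? (vectors-unique bits-unique n) (vectors-unique bits-unique (dimension S)) push pull
               (λ {C} _ eq → ∈-vectors ∈-bits _ , kernel-holds (push C) (trans (cong (rowSum M) (pull-push C)) eq))
               (λ {φ} _ h → ∈-vectors ∈-bits _ , pull-kernel φ h)
               (λ {C} _ _ → pull-push C) (λ {φ} _ _ → push-pull φ) ⟩
        count holds? (vectors bits (dimension S))
          ≡⟨ count-vectors (dimension S) holds? ⟩
        ∑ⱽ (dimension S) (λ φ → ⟦ does (holds? φ) ⟧)
          ≡⟨ ∑ⱽ-cong (dimension S) (λ φ → cong ⟦_⟧ (does-≟-true (holds S τ false false φ))) ⟩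
        ∑ⱽ (dimension S) (λ φ → ⟦ holds S τ false false φ ⟧)
          ≡⟨ kernelSize-holds S τ ⟨
        kernelSize S τ ∎
        where
        open ≡-Reasoning
        holds? : Decidable (λ φ → holds S τ false false φ ≡ true)
        holds? φ = holds S τ false false φ Bool.≟ true
        does-≟-true : ∀ b → does (b Bool.≟ true) ≡ b
        does-≟-true false = refl
        does-≟-true true  = refl

      n≡ : n ≡ 2 + length S
      n≡ = trans (↔⇒≡ ρ) (dimension-length S)

      rank⇒ : ∀ {j} → rank M ≡ j → kernelSize S τ * 2 ^ j ≡ 2 ^ (2 + length S)
      rank⇒ {j} eq = subst₂ (λ K m → K * 2 ^ j ≡ 2 ^ m) kernel-count n≡ (proj₁ (rank⇔kernel j) eq)

      ⇒rank : ∀ {j} → kernelSize S τ * 2 ^ j ≡ 2 ^ (2 + length S) → rank M ≡ j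
      ⇒rank {j} eq = proj₂ (rank⇔kernel j) (subst₂ (λ K m → K * 2 ^ j ≡ 2 ^ m) (sym kernel-count) (sym n≡) eq)

  -- Up to the order of the faces, the form consists of the symmetric matrices supported where the
  -- matrix of `μ` is nonzero. They correspond to the slot vectors below `μ`, and equal kernel sizes
  -- give equal ranks.
  form-count : ∀ j → count (λ M → rank M ℕ.≟ j) (filter form? (vectors (vectors bits n) n)) ≡ count (hasRank? S j) (masked μ)
  form-count j = count-bijection (λ M → rank M ℕ.≟ j) (hasRank? S j)
    (Unique.filter⁺ form? (vectors-unique (vectors-unique bits-unique n) n)) (masked-unique μ) encode decode
    (λ {M} M∈ eq → let form = has-form M∈ in ∈-masked μ (encode M) (read-⊑ S μ (below′ form))
      , rank⇒ M (encode M) (λ p q → sym (build-encode form p q)) eq)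
    (λ {τ} τ∈ eq → Membership.∈-filter⁺ form? (∈-vectors (∈-vectors ∈-bits) (decode τ)) (decode-form (∈-masked⁻ μ τ∈))
      , ⇒rank (decode τ) τ (entry-decode τ) eq)
    (λ {M} M∈ _ → decode-encode (has-form M∈)) (λ {τ} _ _ → encode-decode τ)
    where
    has-form : ∀ {M} → M ∈ filter form? (vectors (vectors bits n) n) → Form M
    has-form M∈ = proj₂ (Membership.∈-filter⁻ form? {xs = vectors (vectors bits n) n} M∈)

-- Matrices of the form Λ

-- All parameters are at least one; they are written as suc j for j in the list j ∷ js.
sidesOf : Side → ℕ → List ℕ → List Side
sidesOf s (suc j) js        = s ∷ sidesOf s j js
sidesOf s zero    (j′ ∷ js) = s ∷ flip s ∷ sidesOf (flip s) j′ js
sidesOf s zero    []        = []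

-- A centre is eₖ exactly when no fan follows its own; the entries in its row are then masked out.
kept : List ℕ → Bool
kept []       = false
kept (_ ∷ js) = true

-- Where one fan ends, two faces are completed. The last face of the fan meets its own centre and,
-- as next face on its side, the next centre; the old centre meets the next centre across the path
-- and the first face of the next fan on its side. Entries with the next centre are kept only if
-- that is not eₖ.
maskOf : ∀ s j js → Vec Bool (slots (sidesOf s j js))
maskOf s (suc j) js        = kept js ∷ true ∷ true ∷ maskOf s j js
maskOf s zero    (j′ ∷ js) = true ∷ kept js ∷ true ∷ kept js ∷ true ∷ true ∷ maskOf (flip s) j′ js
maskOf s zero    []        = blockMask s 0

-- The fans are left behind from left to right, every fan e′ i before its centre e i.
position : ∀ s j js → Index (map suc (j ∷ js)) → Fin (dimension (sidesOf s j js))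
position s (suc j) js        (e i)             = suc (position s j js (e i))
position s (suc j) js        (e′ zero zero)    = zero
position s (suc j) js        (e′ zero (suc l)) = suc (position s j js (e′ zero l))
position s (suc j) js        (e′ (suc i) l)    = suc (position s j js (e′ (suc i) l))
position s zero    (j′ ∷ js) (e zero)          = suc zero
position s zero    (j′ ∷ js) (e (suc i))       = suc (suc (position (flip s) j′ js (e i)))
position s zero    (j′ ∷ js) (e′ zero zero)    = zero
position s zero    (j′ ∷ js) (e′ (suc i) l)    = suc (suc (position (flip s) j′ js (e′ i l)))
position s zero    []        (e zero)          = current [] (flip s)
position s zero    []        (e′ zero zero)    = current [] s

widen : ∀ {j js} → Index (map suc (j ∷ js)) → Index (map suc (suc j ∷ js))
widen (e i)          = e i
widen (e′ zero l)    = e′ zero (suc l)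
widen (e′ (suc i) l) = e′ (suc i) l

prepend : ∀ {j′ js} → Index (map suc (j′ ∷ js)) → Index (map suc (zero ∷ j′ ∷ js))
prepend (e i)    = e (suc i)
prepend (e′ i l) = e′ (suc i) l

faceAt : ∀ s j js → Fin (dimension (sidesOf s j js)) → Index (map suc (j ∷ js))
faceAt s     (suc j) js        zero          = e′ zero zero
faceAt s     (suc j) js        (suc v)       = widen (faceAt s j js v)
faceAt s     zero    (j′ ∷ js) zero          = e′ zero zero
faceAt s     zero    (j′ ∷ js) (suc zero)    = e zero
faceAt s     zero    (j′ ∷ js) (suc (suc v)) = prepend (faceAt (flip s) j′ js v)
faceAt above zero    []        0F            = e′ zero zero
faceAt above zero    []        1F            = e zero
faceAt below zero    []        0F            = e zero
faceAt below zero    []        1F            = e′ zero zero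

position-widen : ∀ s j js a → position s (suc j) js (widen a) ≡ suc (position s j js a)
position-widen s j js (e i)          = refl
position-widen s j js (e′ zero l)    = refl
position-widen s j js (e′ (suc i) l) = refl

position-prepend : ∀ s j′ js a → position s zero (j′ ∷ js) (prepend a) ≡ suc (suc (position (flip s) j′ js a))
position-prepend s j′ js (e i)    = refl
position-prepend s j′ js (e′ i l) = refl

faceAt-position : ∀ s j js a → faceAt s j js (position s j js a) ≡ a
faceAt-position s     (suc j) js        (e i)             = cong widen (faceAt-position s j js (e i))
faceAt-position s     (suc j) js        (e′ zero zero)    = refl
faceAt-position s     (suc j) js        (e′ zero (suc l)) = cong widen (faceAt-position s j js (e′ zero l))
faceAt-position s     (suc j) js        (e′ (suc i) l)    = cong widen (faceAt-position s j js (e′ (suc i) l))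
faceAt-position s     zero    (j′ ∷ js) (e zero)          = refl
faceAt-position s     zero    (j′ ∷ js) (e (suc i))       = cong prepend (faceAt-position (flip s) j′ js (e i))
faceAt-position s     zero    (j′ ∷ js) (e′ zero zero)    = refl
faceAt-position s     zero    (j′ ∷ js) (e′ (suc i) l)    = cong prepend (faceAt-position (flip s) j′ js (e′ i l))
faceAt-position above zero    []        (e zero)          = refl
faceAt-position below zero    []        (e zero)          = refl
faceAt-position above zero    []        (e′ zero zero)    = refl
faceAt-position below zero    []        (e′ zero zero)    = refl

position-faceAt : ∀ s j js v → position s j js (faceAt s j js v) ≡ v
position-faceAt s     (suc j) js        zero          = refl
position-faceAt s     (suc j) js        (suc v)       =
  trans (position-widen s j js (faceAt s j js v)) (cong suc (position-faceAt s j js v))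
position-faceAt s     zero    (j′ ∷ js) zero          = refl
position-faceAt s     zero    (j′ ∷ js) (suc zero)    = refl
position-faceAt s     zero    (j′ ∷ js) (suc (suc v)) =
  trans (position-prepend s j′ js (faceAt (flip s) j′ js v)) (cong (λ u → suc (suc u)) (position-faceAt (flip s) j′ js v))
position-faceAt above zero    []        0F            = refl
position-faceAt above zero    []        1F            = refl
position-faceAt below zero    []        0F            = refl
position-faceAt below zero    []        1F            = refl

current-head : ∀ s S → current (s ∷ S) s ≡ zero
current-head above S = refl
current-head below S = refl

current-tail : ∀ s S → current (s ∷ S) (flip s) ≡ suc (current S (flip s))
current-tail above S = refl
current-tail below S = refl

flip-flip : ∀ s → flip (flip s) ≡ s
flip-flip above = refl
flip-flip below = refl

current-fan : ∀ s j js → current (sidesOf s j js) s ≡ position s j js (e′ zero zero)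
current-fan s (suc j) js        = current-head s (sidesOf s j js)
current-fan s zero    (j′ ∷ js) = current-head s (flip s ∷ sidesOf (flip s) j′ js)
current-fan s zero    []        = refl

current-centre : ∀ s j js → current (sidesOf s j js) (flip s) ≡ position s j js (e zero)
current-centre s (suc j) js        = trans (current-tail s (sidesOf s j js)) (cong suc (current-centre s j js))
current-centre s zero    (j′ ∷ js) =
  trans (current-tail s (flip s ∷ sidesOf (flip s) j′ js)) (cong suc (current-head (flip s) (sidesOf (flip s) j′ js)))
current-centre s zero    []        = refl

infix 0 _iff_
_iff_ : Set → Set → Set
P iff Q = (P → Q) × (Q → P)

iff-trans : ∀ {P Q R} → P iff Q → Q iff R → P iff R
iff-trans (f , g) (f′ , g′) = f′ ∘ f , g ∘ g′

iff-sym : ∀ {P Q} → P iff Q → Q iff P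
iff-sym (f , g) = g , f

is-position : ∀ s j js a b → is (position s j js a) (position s j js b) ≡ true iff b ≡ a
is-position s j js a b with position s j js b Fin.≟ position s j js a
... | yes eq = (λ _ → trans (sym (faceAt-position s j js b)) (trans (cong (faceAt s j js) eq) (faceAt-position s j js a)))
             , λ _ → refl
... | no neq = (λ ()) , λ { refl → contradiction refl neq }

if-iff : ∀ {x y z} → (if x then y else z) ≡ true → (x ≡ true × y ≡ true) ⊎ z ≡ true
if-iff {true}  eq = inj₁ (refl , eq)
if-iff {false} eq = inj₂ eq

link-position : ∀ s j js g y b → link (sidesOf s j js) s g y (position s j js b) ≡ true
  iff (b ≡ e′ zero zero × y ≡ true) ⊎ (b ≡ e zero × g ≡ true)
link-position s j js g y b = to , from
  where
  S = sidesOf s j js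
  fan = is-position s j js (e′ zero zero) b
  centre = is-position s j js (e zero) b
  to : link S s g y (position s j js b) ≡ true → (b ≡ e′ zero zero × y ≡ true) ⊎ (b ≡ e zero × g ≡ true)
  to eq with if-iff {is (current S s) (position s j js b)} eq
  ... | inj₁ (p , q) = inj₁ (proj₁ fan (subst (λ v → is v (position s j js b) ≡ true) (current-fan s j js) p) , q)
  ... | inj₂ pq with ∧-elim pq
  ...   | p , q = inj₂ (proj₁ centre (subst (λ v → is v (position s j js b) ≡ true) (current-centre s j js) p) , q)
  from : (b ≡ e′ zero zero × y ≡ true) ⊎ (b ≡ e zero × g ≡ true) → link S s g y (position s j js b) ≡ true
  from (inj₁ (refl , q)) = trans (cong (link S s g y) (sym (current-fan s j js))) (trans (link-same S s g y) q)
  from (inj₂ (refl , q)) = trans (cong (link S s g y) (sym (current-centre s j js))) (trans (link-flip S s g y) q)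

-- The support of the form Λ

Allowed : ∀ ms → Index ms → Index ms → Set
Allowed ms a b = (Supported ms a b ⊎ Supported ms b a) × ¬ IsLast ms a × ¬ IsLast ms b

allowed-sym : ∀ {ms a b} → Allowed ms a b → Allowed ms b a
allowed-sym (inj₁ p , q , r) = inj₂ p , r , q
allowed-sym (inj₂ p , q , r) = inj₁ p , r , q

kept⇒notLast : ∀ {j js} → kept js ≡ true → ¬ IsLast (map suc (j ∷ js)) (e zero)
kept⇒notLast {js = _ ∷ js} _ ()

notLast⇒kept : ∀ {j js} → ¬ IsLast (map suc (j ∷ js)) (e zero) → kept js ≡ true
notLast⇒kept {js = []}     ¬last = contradiction refl ¬last
notLast⇒kept {js = _ ∷ js} ¬last = refl

supported-widen : ∀ {j js} a b →
  Supported (map suc (suc j ∷ js)) (widen a) (widen b) iff Supported (map suc (j ∷ js)) a b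
supported-widen (e i)          (e i′)          = id , id
supported-widen (e i)          (e′ zero l)     =
    (λ { (inj₁ p) → inj₁ p ; (inj₂ (inj₁ (p , q))) → inj₂ (inj₁ (p , ℕ.suc-injective q)) ; (inj₂ (inj₂ (() , _))) })
  , (λ { (inj₁ p) → inj₁ p ; (inj₂ (inj₁ (p , q))) → inj₂ (inj₁ (p , cong suc q)) ; (inj₂ (inj₂ (() , _))) })
supported-widen (e i)          (e′ (suc i′) l) = id , id
supported-widen (e′ zero l)    (e i)           = id , id
supported-widen (e′ (suc _) l) (e i)           = id , id
supported-widen (e′ zero l)    (e′ zero l′)    =
    (λ { (p , inj₁ q) → refl , inj₁ (ℕ.suc-injective q) ; (p , inj₂ q) → refl , inj₂ (ℕ.suc-injective q) })
  , (λ { (p , inj₁ q) → refl , inj₁ (cong suc q) ; (p , inj₂ q) → refl , inj₂ (cong suc q) })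
supported-widen (e′ zero l)    (e′ (suc i) l′) = (λ ()) , (λ ())
supported-widen (e′ (suc i) l) (e′ zero l′)    = (λ ()) , (λ ())
supported-widen (e′ (suc i) l) (e′ (suc i′) l′) = id , id

last-widen : ∀ {j js} a → IsLast (map suc (suc j ∷ js)) (widen a) iff IsLast (map suc (j ∷ js)) a
last-widen (e i)          = id , id
last-widen (e′ zero l)    = id , id
last-widen (e′ (suc i) l) = id , id

supported-prepend : ∀ {j′ js} a b →
  Supported (map suc (zero ∷ j′ ∷ js)) (prepend a) (prepend b) iff Supported (map suc (j′ ∷ js)) a b
supported-prepend (e i) (e i′) =
    (λ { (inj₁ p) → inj₁ (Fin.suc-injective p) ; (inj₂ p) → inj₂ (ℕ.suc-injective p) })
  , (λ { (inj₁ p) → inj₁ (cong suc p) ; (inj₂ p) → inj₂ (cong suc p) })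
supported-prepend (e i) (e′ i′ l) =
    (λ { (inj₁ p) → inj₁ (Fin.suc-injective p) ; (inj₂ (inj₁ (p , q))) → inj₂ (inj₁ (ℕ.suc-injective p , q))
       ; (inj₂ (inj₂ (p , q))) → inj₂ (inj₂ (ℕ.suc-injective p , q)) })
  , (λ { (inj₁ p) → inj₁ (cong suc p) ; (inj₂ (inj₁ (p , q))) → inj₂ (inj₁ (cong suc p , q))
       ; (inj₂ (inj₂ (p , q))) → inj₂ (inj₂ (cong suc p , q)) })
supported-prepend (e′ i l) (e i′)      = id , id
supported-prepend (e′ i l) (e′ i′ l′) =
    (λ (p , q) → Fin.suc-injective p , q) , (λ (p , q) → cong suc p , q)

last-prepend : ∀ {j′ js} a → IsLast (map suc (zero ∷ j′ ∷ js)) (prepend a) iff IsLast (map suc (j′ ∷ js)) a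
last-prepend (e i)    = ℕ.suc-injective , cong suc
last-prepend (e′ i l) = id , id

allowed-iff : ∀ {ms ms′} {a b : Index ms} {a′ b′ : Index ms′} →
  Supported ms a b iff Supported ms′ a′ b′ → Supported ms b a iff Supported ms′ b′ a′ →
  IsLast ms a iff IsLast ms′ a′ → IsLast ms b iff IsLast ms′ b′ → Allowed ms a b iff Allowed ms′ a′ b′
allowed-iff p q r t = (λ (u , v , w) → Sum.map (proj₁ p) (proj₁ q) u , v ∘ proj₂ r , w ∘ proj₂ t)
                    , (λ (u , v , w) → Sum.map (proj₂ p) (proj₂ q) u , v ∘ proj₁ r , w ∘ proj₁ t)

data Widened {j js} : Index (map suc (suc j ∷ js)) → Set where
  first : Widened (e′ zero zero)
  later : ∀ a → Widened (widen a)

widened : ∀ {j js} a → Widened {j} {js} a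
widened (e i)             = later (e i)
widened (e′ zero zero)    = first
widened (e′ zero (suc l)) = later (e′ zero l)
widened (e′ (suc i) l)    = later (e′ (suc i) l)

data Prepended {j′ js} : Index (map suc (zero ∷ j′ ∷ js)) → Set where
  fan    : Prepended (e′ zero zero)
  centre : Prepended (e zero)
  later  : ∀ a → Prepended (prepend a)

prepended : ∀ {j′ js} a → Prepended {j′} {js} a
prepended (e zero)       = centre
prepended (e (suc i))    = later (e i)
prepended (e′ zero zero) = fan
prepended (e′ (suc i) l) = later (e′ i l)

first-widen : ∀ {j js} b → Allowed (map suc (suc j ∷ js)) (e′ zero zero) (widen b)
  iff (b ≡ e′ zero zero × true ≡ true) ⊎ (b ≡ e zero × kept js ≡ true)
first-widen {j} {js} b = to b , from
  where
  to : ∀ b → Allowed (map suc (suc j ∷ js)) (e′ zero zero) (widen b) →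
       (b ≡ e′ zero zero × true ≡ true) ⊎ (b ≡ e zero × kept js ≡ true)
  to (e zero)          (_ , _ , ¬last) = inj₂ (refl , notLast⇒kept {j} ¬last)
  to (e (suc i))       (inj₁ () , _)
  to (e (suc i))       (inj₂ (inj₁ ()) , _)
  to (e (suc i))       (inj₂ (inj₂ (inj₁ (_ , ()))) , _)
  to (e (suc i))       (inj₂ (inj₂ (inj₂ (() , _))) , _)
  to (e′ zero zero)    _ = inj₁ (refl , refl)
  to (e′ zero (suc l)) (inj₁ (_ , inj₁ ()) , _)
  to (e′ zero (suc l)) (inj₁ (_ , inj₂ ()) , _)
  to (e′ zero (suc l)) (inj₂ (_ , inj₁ ()) , _)
  to (e′ zero (suc l)) (inj₂ (_ , inj₂ ()) , _)
  to (e′ (suc i) l)    (inj₁ (() , _) , _)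
  to (e′ (suc i) l)    (inj₂ (() , _) , _)
  from : (b ≡ e′ zero zero × true ≡ true) ⊎ (b ≡ e zero × kept js ≡ true) →
         Allowed (map suc (suc j ∷ js)) (e′ zero zero) (widen b)
  from (inj₁ (refl , _)) = inj₁ (refl , inj₂ refl) , (λ ()) , (λ ())
  from (inj₂ (refl , k)) = inj₂ (inj₁ refl) , (λ ()) , kept⇒notLast {j} k

fan-prepend : ∀ {j′ js} b → Allowed (map suc (zero ∷ j′ ∷ js)) (e′ zero zero) (prepend b) iff (b ≡ e zero × kept js ≡ true)
fan-prepend {j′} {js} b = to b , from
  where
  to : ∀ b → Allowed (map suc (zero ∷ j′ ∷ js)) (e′ zero zero) (prepend b) → b ≡ e zero × kept js ≡ true
  to (e zero)    (_ , _ , ¬last) = refl , notLast⇒kept {j′} (¬last ∘ cong suc)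
  to (e (suc i)) (inj₁ () , _)
  to (e (suc i)) (inj₂ (inj₁ ()) , _)
  to (e (suc i)) (inj₂ (inj₂ (inj₁ (() , _))) , _)
  to (e (suc i)) (inj₂ (inj₂ (inj₂ (() , _))) , _)
  to (e′ i l)    (inj₁ (() , _) , _)
  to (e′ i l)    (inj₂ (() , _) , _)
  from : b ≡ e zero × kept js ≡ true → Allowed (map suc (zero ∷ j′ ∷ js)) (e′ zero zero) (prepend b)
  from (refl , k) = inj₂ (inj₂ (inj₁ (refl , refl))) , (λ ()) , kept⇒notLast {j′} k ∘ ℕ.suc-injective

centre-prepend : ∀ {j′ js} b → Allowed (map suc (zero ∷ j′ ∷ js)) (e zero) (prepend b)
  iff (b ≡ e′ zero zero × true ≡ true) ⊎ (b ≡ e zero × kept js ≡ true)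
centre-prepend {j′} {js} b = to b , from
  where
  to : ∀ b → Allowed (map suc (zero ∷ j′ ∷ js)) (e zero) (prepend b) →
       (b ≡ e′ zero zero × true ≡ true) ⊎ (b ≡ e zero × kept js ≡ true)
  to (e zero)          (_ , _ , ¬last) = inj₂ (refl , notLast⇒kept {j′} (¬last ∘ cong suc))
  to (e (suc i))       (inj₁ (inj₁ ()) , _)
  to (e (suc i))       (inj₁ (inj₂ ()) , _)
  to (e (suc i))       (inj₂ (inj₁ ()) , _)
  to (e (suc i))       (inj₂ (inj₂ ()) , _)
  to (e′ zero zero)    _ = inj₁ (refl , refl)
  to (e′ zero (suc l)) (inj₁ (inj₁ ()) , _)
  to (e′ zero (suc l)) (inj₁ (inj₂ (inj₁ (() , _))) , _)
  to (e′ zero (suc l)) (inj₁ (inj₂ (inj₂ (_ , ()))) , _)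
  to (e′ zero (suc l)) (inj₂ () , _)
  to (e′ (suc i) l)    (inj₁ (inj₁ ()) , _)
  to (e′ (suc i) l)    (inj₁ (inj₂ (inj₁ (() , _))) , _)
  to (e′ (suc i) l)    (inj₁ (inj₂ (inj₂ (() , _))) , _)
  to (e′ (suc i) l)    (inj₂ () , _)
  from : (b ≡ e′ zero zero × true ≡ true) ⊎ (b ≡ e zero × kept js ≡ true) →
         Allowed (map suc (zero ∷ j′ ∷ js)) (e zero) (prepend b)
  from (inj₁ (refl , _)) = inj₁ (inj₂ (inj₂ (refl , refl))) , (λ ()) , (λ ())
  from (inj₂ (refl , k)) = inj₁ (inj₂ refl) , (λ ()) , kept⇒notLast {j′} k ∘ ℕ.suc-injective

Entry : ∀ s j js → Index (map suc (j ∷ js)) → Index (map suc (j ∷ js)) → Set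
Entry s j js a b = build (sidesOf s j js) (maskOf s j js) (position s j js a) (position s j js b) ≡ true

entry-sym : ∀ s j js {a b} → Entry s j js a b → Entry s j js b a
entry-sym s j js eq = trans (build-symmetric (sidesOf s j js) (maskOf s j js) _ _) eq

entry-first : ∀ s j js b → Entry s (suc j) js (e′ zero zero) (widen b) iff Allowed (map suc (suc j ∷ js)) (e′ zero zero) (widen b)
entry-first s j js b = iff-trans (trans (sym entry≡) , trans entry≡) (iff-trans (link-position s j js (kept js) true b) (iff-sym (first-widen {j} {js} b)))
  where
  entry≡ : build (s ∷ sidesOf s j js) (maskOf s (suc j) js) zero (position s (suc j) js (widen b))
         ≡ link (sidesOf s j js) s (kept js) true (position s j js b)
  entry≡ = cong (build (s ∷ sidesOf s j js) (maskOf s (suc j) js) zero) (position-widen s j js b)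

entry-fan-centre : ∀ s j′ js → Entry s zero (j′ ∷ js) (e′ zero zero) (e zero)
entry-fan-centre s j′ js = trans (cong (link (flip s ∷ sidesOf (flip s) j′ js) s true (kept js))
  (sym (current-head (flip s) (sidesOf (flip s) j′ js)))) (link-flip (flip s ∷ sidesOf (flip s) j′ js) s true (kept js))

link-behind : ∀ s S g y w → link (flip s ∷ S) s g y (suc w) ≡ is (current S s) w ∧ y
link-behind above S g y w with is (current S above) w
... | true  = refl
... | false = refl
link-behind below S g y w with is (current S below) w
... | true  = refl
... | false = refl

entry-fan : ∀ s j′ js b → Entry s zero (j′ ∷ js) (e′ zero zero) (prepend b)
  iff Allowed (map suc (zero ∷ j′ ∷ js)) (e′ zero zero) (prepend b)
entry-fan s j′ js b = iff-trans (to , from) (iff-sym (fan-prepend {j′} {js} b))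
  where
  S = sidesOf (flip s) j′ js
  entry≡ : build (s ∷ flip s ∷ S) (maskOf s zero (j′ ∷ js)) zero (position s zero (j′ ∷ js) (prepend b))
         ≡ is (position (flip s) j′ js (e zero)) (position (flip s) j′ js b) ∧ kept js
  entry≡ = trans (cong (build (s ∷ flip s ∷ S) (maskOf s zero (j′ ∷ js)) zero) (position-prepend s j′ js b))
    (trans (link-behind s S true (kept js) (position (flip s) j′ js b))
      (cong (λ v → is v (position (flip s) j′ js b) ∧ kept js)
        (trans (cong (current S) (sym (flip-flip s))) (current-centre (flip s) j′ js))))
  to : Entry s zero (j′ ∷ js) (e′ zero zero) (prepend b) → b ≡ e zero × kept js ≡ true
  to eq = let p , q = ∧-elim (trans (sym entry≡) eq) in proj₁ (is-position (flip s) j′ js (e zero) b) p , q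
  from : b ≡ e zero × kept js ≡ true → Entry s zero (j′ ∷ js) (e′ zero zero) (prepend b)
  from (p , q) = trans entry≡ (∧-intro (proj₂ (is-position (flip s) j′ js (e zero) b) p) q)

entry-centre : ∀ s j′ js b → Entry s zero (j′ ∷ js) (e zero) (prepend b)
  iff Allowed (map suc (zero ∷ j′ ∷ js)) (e zero) (prepend b)
entry-centre s j′ js b = iff-trans (trans (sym entry≡) , trans entry≡)
  (iff-trans (link-position (flip s) j′ js (kept js) true b) (iff-sym (centre-prepend {j′} {js} b)))
  where
  S = sidesOf (flip s) j′ js
  entry≡ : build (s ∷ flip s ∷ S) (maskOf s zero (j′ ∷ js)) (suc zero) (position s zero (j′ ∷ js) (prepend b))
         ≡ link S (flip s) (kept js) true (position (flip s) j′ js b)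
  entry≡ = cong (build (s ∷ flip s ∷ S) (maskOf s zero (j′ ∷ js)) (suc zero)) (position-prepend s j′ js b)

mirror : ∀ s j js {a b} → Entry s j js a b iff Allowed (map suc (j ∷ js)) a b → Entry s j js b a iff Allowed (map suc (j ∷ js)) b a
mirror s j js {a} {b} (f , g) = allowed-sym ∘ f ∘ entry-sym s j js {b} {a} , entry-sym s j js {a} {b} ∘ g ∘ allowed-sym

-- Faces are peeled off in the same order on both sides: one face of the first fan, or the last face
-- of a fan together with its centre. Pairs of remaining faces reduce to smaller parameters, so only
-- the neighbours of the peeled faces have to be compared.
entry⇔allowed : ∀ s j js a b → Entry s j js a b iff Allowed (map suc (j ∷ js)) a b
entry⇔allowed s (suc j) js a b with widened a | widened b
... | first    | first    = (λ _ → inj₁ (refl , inj₁ refl) , (λ ()) , (λ ())) , λ _ → refl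
... | first    | later b′ = entry-first s j js b′
... | later a′ | first    = mirror s (suc j) js {e′ zero zero} {widen a′} (entry-first s j js a′)
... | later a′ | later b′ = iff-trans
  (subst₂ (λ v w → build (s ∷ sidesOf s j js) (maskOf s (suc j) js) v w ≡ true iff Entry s j js a′ b′)
    (sym (position-widen s j js a′)) (sym (position-widen s j js b′)) (id , id))
  (iff-trans (entry⇔allowed s j js a′ b′) (iff-sym (allowed-iff
    (supported-widen a′ b′) (supported-widen b′ a′) (last-widen a′) (last-widen b′))))
entry⇔allowed s zero (j′ ∷ js) a b with prepended a | prepended b
... | fan      | fan      = (λ _ → inj₁ (refl , inj₁ refl) , (λ ()) , (λ ())) , λ _ → refl
... | fan      | centre   = (λ _ → inj₂ (inj₁ refl) , (λ ()) , (λ ())) , λ _ → entry-fan-centre s j′ js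
... | centre   | fan      = (λ _ → inj₁ (inj₁ refl) , (λ ()) , (λ ())) , λ _ → entry-fan-centre s j′ js
... | centre   | centre   = (λ _ → inj₁ (inj₁ refl) , (λ ()) , (λ ())) , λ _ → refl
... | fan      | later b′ = entry-fan s j′ js b′
... | later a′ | fan      = mirror s zero (j′ ∷ js) {e′ zero zero} {prepend a′} (entry-fan s j′ js a′)
... | centre   | later b′ = entry-centre s j′ js b′
... | later a′ | centre   = mirror s zero (j′ ∷ js) {e zero} {prepend a′} (entry-centre s j′ js a′)
... | later a′ | later b′ = iff-trans
  (subst₂ (λ v w → build (s ∷ flip s ∷ sidesOf (flip s) j′ js) (maskOf s zero (j′ ∷ js)) v w ≡ true iff Entry (flip s) j′ js a′ b′)
    (sym (position-prepend s j′ js a′)) (sym (position-prepend s j′ js b′)) (id , id))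
  (iff-trans (entry⇔allowed (flip s) j′ js a′ b′) (iff-sym (allowed-iff
    (supported-prepend a′ b′) (supported-prepend b′ a′) (last-prepend a′) (last-prepend b′))))
entry⇔allowed above zero [] (e′ zero zero) (e′ zero zero) = (λ _ → inj₁ (refl , inj₁ refl) , (λ ()) , (λ ())) , λ _ → refl
entry⇔allowed above zero [] (e′ zero zero) (e zero)       = (λ ()) , λ (_ , _ , ¬last) → contradiction refl ¬last
entry⇔allowed above zero [] (e zero)       (e′ zero zero) = (λ ()) , λ (_ , ¬last , _) → contradiction refl ¬last
entry⇔allowed above zero [] (e zero)       (e zero)       = (λ ()) , λ (_ , ¬last , _) → contradiction refl ¬last
entry⇔allowed below zero [] (e′ zero zero) (e′ zero zero) = (λ _ → inj₁ (refl , inj₁ refl) , (λ ()) , (λ ())) , λ _ → refl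
entry⇔allowed below zero [] (e′ zero zero) (e zero)       = (λ ()) , λ (_ , _ , ¬last) → contradiction refl ¬last
entry⇔allowed below zero [] (e zero)       (e′ zero zero) = (λ ()) , λ (_ , ¬last , _) → contradiction refl ¬last
entry⇔allowed below zero [] (e zero)       (e zero)       = (λ ()) , λ (_ , ¬last , _) → contradiction refl ¬last

module _ (ms : List ℕ) where
  private
    k : ℕ
    k = length ms

    fanIndices : Fin k → List (Index ms)
    fanIndices i = map (e′ i) (allFin (lookup ms i))

    e-injective : ∀ {i j} → e {ms} i ≡ e j → i ≡ j
    e-injective refl = refl

    e′-injective : ∀ {i l l′} → e′ {ms} i l ≡ e′ i l′ → l ≡ l′
    e′-injective refl = refl

  ∈-indices : ∀ a → a ∈ indices ms
  ∈-indices (e i)    = Membership.∈-++⁺ˡ (Membership.∈-map⁺ e (Membership.∈-allFin i))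
  ∈-indices (e′ i l) = Membership.∈-++⁺ʳ (map e (allFin k)) (Membership.∈-concat⁺′
    (Membership.∈-map⁺ (e′ i) (Membership.∈-allFin l)) (Membership.∈-map⁺ fanIndices (Membership.∈-allFin i)))

  indices-unique : Unique (indices ms)
  indices-unique = Unique.++⁺ (Unique.map⁺ e-injective (Unique.allFin⁺ k))
    (Unique.concat⁺ (All.map⁺ (All.tabulate λ {i} _ → Unique.map⁺ e′-injective (Unique.allFin⁺ (lookup ms i))))
      (AllPairs.map⁺ {f = fanIndices} (AllPairs.map (λ i≢j {a} (p , q) → i≢j (fan-disjoint {a = a} p q)) (Unique.allFin⁺ k))))
    λ {a} (p , q) → apart {a} p q
    where
    fan-disjoint : ∀ {i j a} → a ∈ fanIndices i → a ∈ fanIndices j → i ≡ j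
    fan-disjoint {i} {j} p q with Membership.∈-map⁻ (e′ i) p | Membership.∈-map⁻ (e′ j) q
    ... | _ , _ , refl | _ , _ , refl = refl
    apart : ∀ {a} → a ∈ map e (allFin k) → a ∈ concatMap fanIndices (allFin k) → ⊥
    apart p q with Membership.∈-map⁻ e p | Membership.∈-concat⁻′ (map fanIndices (allFin k)) q
    ... | _ , _ , refl | _ , e∈ , f∈ with Membership.∈-map⁻ fanIndices f∈
    ...   | i , _ , refl with Membership.∈-map⁻ (e′ i) e∈
    ...     | _ , _ , ()

module _ (s : Side) (j : ℕ) (js : List ℕ) where
  private
    ms : List ℕ
    ms = map suc (j ∷ js)

    index : Index ms → Fin (dim ms)
    index a = Any.index (∈-indices ms a)

    lookup-index : ∀ a → lookup (indices ms) (index a) ≡ a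
    lookup-index a = sym (Any.lookup-index (∈-indices ms a))

    order : Permutation (dim ms) (dimension (sidesOf s j js))
    order = mkInverse (position s j js ∘ lookup (indices ms)) (index ∘ faceAt s j js)
      (λ { refl → refl }) (λ { refl → refl })
      (λ v → trans (cong (position s j js) (lookup-index (faceAt s j js v))) (position-faceAt s j js v))
      (λ p → lookup-injective (indices-unique ms) (trans (lookup-index _) (faceAt-position s j js (lookup (indices ms) p))))

    entry-allowed : ∀ p q → Entry s j js (lookup (indices ms) p) (lookup (indices ms) q)
                    iff Allowed ms (lookup (indices ms) p) (lookup (indices ms) q)
    entry-allowed p q = entry⇔allowed s j js (lookup (indices ms) p) (lookup (indices ms) q)

    Supporting : Matrix (dim ms) → Set
    Supporting M = ∀ p q → entry M p q ≡ true → Entry s j js (lookup (indices ms) p) (lookup (indices ms) q)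

    form⇒symmetric : ∀ {M} → HasFormΛ ms M → ∀ p q → entry M p q ≡ entry M q p
    form⇒symmetric (formΔ , _) p q = proj₁ (formΔ p q)

    form⇒supporting : ∀ {M} → HasFormΛ ms M → Supporting M
    form⇒supporting (formΔ , zero-last) p q eq = proj₂ (entry-allowed p q)
      ( proj₂ (formΔ p q) eq
      , (λ last → contradiction (trans (sym eq) (proj₁ (zero-last p q last))) λ ())
      , (λ last → contradiction (trans (sym eq) (proj₂ (zero-last q p last))) λ ()))

    ⇒form : ∀ {M} → (∀ p q → entry M p q ≡ entry M q p) → Supporting M → HasFormΛ ms M
    ⇒form {M} symm supp = (λ p q → symm p q , λ eq → proj₁ (proj₁ (entry-allowed p q) (supp p q eq)))
      , λ p q last → let zero′ = vanishes p q last in zero′ , trans (symm q p) zero′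
      where
      not-true : ∀ {b} → b ≢ true → b ≡ false
      not-true {false} _   = refl
      not-true {true}  neq = contradiction refl neq
      vanishes : ∀ p q → IsLast ms (lookup (indices ms) p) → entry M p q ≡ false
      vanishes p q last = not-true λ eq → proj₁ (proj₂ (proj₁ (entry-allowed p q) (supp p q eq))) last

  λ-poly-masked : λ-poly ms ≗ maskedCount (sidesOf s j js , maskOf s j js)
  λ-poly-masked = Bordered.form-count (sidesOf s j js) (maskOf s j js) order {HasFormΛ ms} (hasFormΛ? ms)
    (λ {M} → form⇒symmetric {M}) (λ {M} → form⇒supporting {M}) (λ {M} → ⇒form {M})

-- The parameters of the graphs

-- The leaf just before the last block is left out as well: its step brings in the face eₖ, and it
-- is where `faceMask` begins to mask.
before : Side → ℕ → List ℕ → List Side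
before s (suc j) js        = s ∷ before s j js
before s zero    (j′ ∷ js) = s ∷ flip s ∷ before (flip s) j′ js
before s zero    []        = []

lastSide : Side → ℕ → List ℕ → Side
lastSide s (suc j) js        = lastSide s j js
lastSide s zero    (j′ ∷ js) = lastSide (flip s) j′ js
lastSide s zero    []        = flip s

extend : Side → (g y d : Bool) → Masked → Masked
extend s g y d (S , m) = s ∷ S , g ∷ y ∷ d ∷ m

kept-snoc : ∀ js c → kept (js ++ c ∷ []) ≡ true
kept-snoc []       c = refl
kept-snoc (j ∷ js) c = refl

sidesOf-block : ∀ s c → _≡_ {A = Masked} (sidesOf s c [] , maskOf s c []) (replicate c s , blockMask s c)
sidesOf-block s     zero    = refl
sidesOf-block above (suc c) = cong (extend above false true true) (sidesOf-block above c)
sidesOf-block below (suc c) = cong (extend below false true true) (sidesOf-block below c)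

-- This identifies the mask that remains after deleting eₖ with the support of Λ. Sides and mask are
-- equated as a pair because the type of the mask depends on the sides.
sidesOf-before : ∀ s j js c → _≡_ {A = Masked}
  (sidesOf s j (js ++ c ∷ []) , maskOf s j (js ++ c ∷ []))
  (before s j js ++ flip (lastSide s j js) ∷ replicate (suc c) (lastSide s j js)
    , faceMask (before s j js) (lastSide s j js) (suc c))
sidesOf-before s     (suc j) js        c = cong₂ (λ k M → extend s k true true M) (kept-snoc js c) (sidesOf-before s j js c)
sidesOf-before s     zero    (j′ ∷ js) c = cong₂ (λ k M → extend s true k true (extend (flip s) k true true M))
  (kept-snoc js c) (sidesOf-before (flip s) j′ js c)
sidesOf-before above zero    []        c = cong (extend above true false true ∘ extend below false true true) (sidesOf-block below c)
sidesOf-before below zero    []        c = cong (extend below true false true ∘ extend above false true true) (sidesOf-block above c)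

sidesFrom : Side → List ℕ → List Side
sidesFrom s ms = alternate s (leafCounts ms)

sidesFrom-step : ∀ s m x ys z zs →
  sidesFrom s (m ∷ x ∷ (ys ++ z ∷ zs)) ≡ replicate m s ++ flip s ∷ sidesFrom (flip s) (x ∷ (ys ++ z ∷ zs))
sidesFrom-step s m x []       z zs = refl
sidesFrom-step s m x (y ∷ ys) z zs = refl

sidesFrom-before : ∀ s j js c → sidesFrom s (map suc (j ∷ js) ++ c ∷ [])
  ≡ before s j js ++ flip (lastSide s j js) ∷ replicate c (lastSide s j js)
sidesFrom-before s j [] c = block j
  where
  block : ∀ j → s ∷ replicate j s ++ (replicate c (flip s) ++ [])
              ≡ before s j [] ++ flip (lastSide s j []) ∷ replicate c (lastSide s j [])
  block zero    = cong₂ _∷_ (sym (flip-flip s)) (List.++-identityʳ (replicate c (flip s)))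
  block (suc j) = cong (s ∷_) (block j)
sidesFrom-before s j (j′ ∷ js) c = trans (sidesFrom-step s (suc j) (suc j′) (map suc js) c []) (block j)
  where
  block : ∀ j → s ∷ replicate j s ++ flip s ∷ sidesFrom (flip s) (map suc (j′ ∷ js) ++ c ∷ [])
              ≡ before s j (j′ ∷ js) ++ flip (lastSide s j (j′ ∷ js)) ∷ replicate c (lastSide s j (j′ ∷ js))
  block zero    = cong (λ S → s ∷ flip s ∷ S) (sidesFrom-before (flip s) j′ js c)
  block (suc j) = cong (s ∷_) (block j)

-- An interior parameter `a` stands for a + 1 leaves and a last parameter 0 for none, so both lists
-- describe the same drawing. That `a` is interior is due to the parameter `m` before it.
sidesFrom-zero : ∀ s m ms a → sidesFrom s (m ∷ (ms ++ a ∷ 0 ∷ [])) ≡ sidesFrom s (m ∷ (ms ++ (a + 1) ∷ []))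
sidesFrom-zero s m []        a = cong (λ k → replicate m s ++ replicate k (flip s) ++ []) (ℕ.+-comm 1 a)
sidesFrom-zero s m (m′ ∷ ms) a = trans (sidesFrom-step s m m′ ms a (0 ∷ []))
  (trans (cong (λ S → replicate m s ++ flip s ∷ S) (sidesFrom-zero (flip s) m′ ms a))
    (sym (sidesFrom-step s m m′ ms (a + 1) [])))

replicate-snoc : ∀ (s : Side) k → replicate (suc k) s ≡ replicate k s ++ s ∷ []
replicate-snoc s zero    = refl
replicate-snoc s (suc k) = cong (s ∷_) (replicate-snoc s k)

-- The a + 1 leaves of the interior block followed by one leaf on the other side differ from a + 2
-- leaves on one side only in the place of the last leaf.
sidesFrom-one : ∀ s m ms a → ∃ λ S → ∃ λ t →
  sidesFrom s (m ∷ (ms ++ a ∷ 1 ∷ [])) ≡ S ++ t ∷ [] × sidesFrom s (m ∷ (ms ++ (a + 2) ∷ [])) ≡ S ++ flip t ∷ []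
sidesFrom-one s m [] a = replicate m s ++ replicate (suc a) (flip s) , flip (flip s)
  , sym (List.++-assoc (replicate m s) (replicate (suc a) (flip s)) _)
  , trans (cong (replicate m s ++_) (trans (List.++-identityʳ (replicate (a + 2) (flip s)))
      (trans (cong (λ k → replicate k (flip s)) (ℕ.+-comm a 2)) (trans (replicate-snoc (flip s) (suc a))
        (cong (λ t → replicate (suc a) (flip s) ++ t ∷ []) (sym (flip-flip (flip s))))))))
    (sym (List.++-assoc (replicate m s) (replicate (suc a) (flip s)) _))
sidesFrom-one s m (m′ ∷ ms) a with sidesFrom-one (flip s) m′ ms a
... | S , t , eq , eq′ = replicate m s ++ flip s ∷ S , t
  , trans (sidesFrom-step s m m′ ms a (1 ∷ [])) (trans (cong (λ S → replicate m s ++ flip s ∷ S) eq)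
      (sym (List.++-assoc (replicate m s) (flip s ∷ S) _)))
  , trans (sidesFrom-step s m m′ ms (a + 2) []) (trans (cong (λ S → replicate m s ++ flip s ∷ S) eq′)
      (sym (List.++-assoc (replicate m s) (flip s ∷ S) _)))

-- Moving the last leaf across the path

last-flip : ∀ g y d g′ x z → step above g y d (close g′ x z) ≋ step below g g′ z (close y d x)
last-flip = exhaust′ ℕ._≟_ 10 (λ g y d g′ x z → step above g y d (close g′ x z))
  (λ g y d g′ x z → step below g g′ z (close y d x)) refl

-- The last three faces are pairwise adjacent, so the final one may count as lying above or below
-- the path, with the other two completed in the corresponding order. This only permutes the six
-- last slots, over all of which the sum runs.
sumOver-last : ∀ S Ψ → Extensional Ψ → sumOver close (S ++ above ∷ []) Ψ ≡ sumOver close (S ++ below ∷ []) Ψ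
sumOver-last [] Ψ ext = trans
  (∑³-cong λ g y d → ∑³-cong λ g′ x z → ext (last-flip g y d g′ x z))
  (∑ᵇ-cong λ g → trans
    (∑ᵇ-cong λ y → trans (∑ᵇ-cong λ d → ∑ᵇ-cong λ g′ → ∑ᵇ-comm λ x z → F g g′ z y d x)
      (∑ᵇ-comm λ d g′ → ∑ᵇ λ z → ∑ᵇ λ x → F g g′ z y d x))
    (trans (∑ᵇ-comm λ y g′ → ∑ᵇ λ d → ∑ᵇ λ z → ∑ᵇ λ x → F g g′ z y d x)
      (∑ᵇ-cong λ g′ → trans (∑ᵇ-cong λ y → ∑ᵇ-comm λ d z → ∑ᵇ λ x → F g g′ z y d x)
        (∑ᵇ-comm λ y z → ∑ᵇ λ d → ∑ᵇ λ x → F g g′ z y d x))))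
  where
  F : (g y d g′ x z : Bool) → ℕ
  F g y d g′ x z = Ψ (step below g y d (close g′ x z))
sumOver-last (s ∷ S) Ψ ext = ∑³-cong λ g y d → sumOver-last S (Ψ ∘ step s g y d) (ext ∘ step-cong s g y d)

rankCount-last : ∀ S → rankCount (S ++ above ∷ []) ≗ rankCount (S ++ below ∷ [])
rankCount-last S i = trans
  (cong (λ n → ∑ⱽ (slots (S ++ above ∷ [])) λ τ → isRank (2 + n) (kernelSize (S ++ above ∷ []) τ) i)
    (trans (List.length-++ S) (sym (List.length-++ S))))
  (sumOver-last S (λ W → isRank (2 + length (S ++ below ∷ [])) (total W) i)
    λ eq → cong (λ N → isRank (2 + length (S ++ below ∷ [])) N i) (total-cong eq))

rankCount-flip : ∀ S t → rankCount (S ++ t ∷ []) ≗ rankCount (S ++ flip t ∷ [])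
rankCount-flip S above i = rankCount-last S i
rankCount-flip S below i = sym (rankCount-last S i)

-- Products with monomials

sum-upTo : ∀ F n → sum (map F (upTo (suc n))) ≡ F 0 + sum (map (F ∘ suc) (upTo n))
sum-upTo F n = cong (λ xs → F 0 + sum xs) (trans (List.map-applyUpTo suc F n) (sym (List.map-applyUpTo id (F ∘ suc) n)))

sum-zero : ∀ {F : ℕ → ℕ} → (∀ i → F i ≡ 0) → ∀ xs → sum (map F xs) ≡ 0
sum-zero eq []       = refl
sum-zero eq (x ∷ xs) = cong₂ _+_ (eq x) (sum-zero eq xs)

monomial-⊛ : ∀ c d p → c ·z^ d ⊛ p ≗ λ n → c * shift d p n
monomial-⊛ c zero    p n = trans (sum-upTo (λ i → (c ·z^ 0) i * p (n ∸ i)) n)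
  (trans (cong (c * p n +_) (sum-zero (λ i → refl) (upTo n))) (ℕ.+-identityʳ (c * p n)))
monomial-⊛ c (suc d) p zero    = sym (ℕ.*-zeroʳ c)
monomial-⊛ c (suc d) p (suc n) = trans (sum-upTo (λ i → (c ·z^ suc d) i * p (suc n ∸ i)) (suc n)) (monomial-⊛ c d p n)

⊕-⊛ : ∀ p q r → (p ⊕ q) ⊛ r ≗ p ⊛ r ⊕ q ⊛ r
⊕-⊛ p q r n = distribute (upTo (suc n))
  where
  distribute : ∀ xs → sum (map (λ i → (p i + q i) * r (n ∸ i)) xs)
                    ≡ sum (map (λ i → p i * r (n ∸ i)) xs) + sum (map (λ i → q i * r (n ∸ i)) xs)
  distribute []       = refl
  distribute (i ∷ xs) = trans (cong₂ _+_ (ℕ.*-distribʳ-+ (r (n ∸ i)) (p i) (q i)) (distribute xs))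
    (CommutativeSemigroup.interchange ℕ.+-commutativeSemigroup (p i * r (n ∸ i)) (q i * r (n ∸ i)) _ _)

-- The factor 2 between `ℰ` and `rankCount` is absorbed by `E₁` and `E₀`. The λ term has nothing to
-- absorb it, so there 2^(4+c) becomes 2^(5+c), the exponent being mₖ + 3 for mₖ = c + 2.
combine : ∀ c (E E₁ E₀ L R₁ R₀ : Poly) → E₁ ≗ (λ i → 2 * R₁ i) → E₀ ≗ (λ i → 2 * R₀ i) →
  (∀ i → E i ≡ 2 * (4 * shift 1 R₁ i + R₁ i + 2 ^ (4 + c) * shift 2 L i + 16 * shift 2 R₀ i)) →
  E ≗ (1 ·z^ 0 ⊕ 4 ·z^ 1) ⊛ E₁ ⊕ 16 ·z^ 2 ⊛ E₀ ⊕ (2 ^ (suc (suc c) + 3)) ·z^ 2 ⊛ L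
combine c E E₁ E₀ L R₁ R₀ eq₁ eq₀ eq i = begin
  E i
    ≡⟨ eq i ⟩
  2 * (4 * shift 1 R₁ i + R₁ i + 2 ^ (4 + c) * shift 2 L i + 16 * shift 2 R₀ i)
    ≡⟨ solve 5 (λ a b p l r → con 2 :* (con 4 :* a :+ b :+ p :* l :+ con 16 :* r)
         := con 1 :* (con 2 :* b) :+ con 4 :* (con 2 :* a) :+ con 16 :* (con 2 :* r) :+ (con 2 :* p) :* l)
         refl (shift 1 R₁ i) (R₁ i) (2 ^ (4 + c)) (shift 2 L i) (shift 2 R₀ i) ⟩
  1 * (2 * R₁ i) + 4 * (2 * shift 1 R₁ i) + 16 * (2 * shift 2 R₀ i) + 2 ^ (5 + c) * shift 2 L i
    ≡⟨ cong₂ _+_ (cong₂ _+_ (cong₂ (λ x y → 1 * x + 4 * y)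
         (sym (eq₁ i)) (trans (shift-* 1 2 R₁ i) (shift-cong 1 (sym ∘ eq₁) i)))
         (cong (16 *_) (trans (shift-* 2 2 R₀ i) (shift-cong 2 (sym ∘ eq₀) i))))
         (cong (λ m → 2 ^ m * shift 2 L i) (cong (2 +_) (ℕ.+-comm 3 c))) ⟩
  1 * E₁ i + 4 * shift 1 E₁ i + 16 * shift 2 E₀ i + 2 ^ (suc (suc c) + 3) * shift 2 L i
    ≡⟨ cong₂ _+_ (cong₂ _+_ (trans (⊕-⊛ (1 ·z^ 0) (4 ·z^ 1) E₁ i) (cong₂ _+_ (monomial-⊛ 1 0 E₁ i) (monomial-⊛ 4 1 E₁ i)))
         (monomial-⊛ 16 2 E₀ i)) (monomial-⊛ (2 ^ (suc (suc c) + 3)) 2 L i) ⟨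
  ((1 ·z^ 0 ⊕ 4 ·z^ 1) ⊛ E₁ ⊕ 16 ·z^ 2 ⊛ E₀ ⊕ (2 ^ (suc (suc c) + 3)) ·z^ 2 ⊛ L) i ∎
  where
  open ≡-Reasoning
  open ℕSolver.+-*-Solver using (solve; _:+_; _:*_; _:=_; con)

-- Recursion and initial conditions

ℰ-H : ∀ ms {S} → sidesFrom above ms ≡ S → (T : SpanningTree (H ms)) → ℰ (H ms) T ≗ λ i → 2 * rankCount S i
ℰ-H ms refl T i = ℰ-halin (sidesFrom above ms) T i

positive : ∀ {ms} → All (1 ≤_) ms → ∃ λ js → ms ≡ map suc js
positive []               = [] , refl
positive (_∷_ {suc m} _ ps) with positive ps
... | js , eq = m ∷ js , cong (suc m ∷_) eq

Recurrence : ℕ → (ms ms₁ ms₂ : List ℕ) → Set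
Recurrence b ms ms₁ ms₂ = (T : SpanningTree (H ms)) (T₁ : SpanningTree (H ms₁)) (T₂ : SpanningTree (H ms₂)) →
  ℰ (H ms) T ≗ (1 ·z^ 0 ⊕ 4 ·z^ 1) ⊛ ℰ (H ms₁) T₁ ⊕ 16 ·z^ 2 ⊛ ℰ (H ms₂) T₂ ⊕ (2 ^ (b + 3)) ·z^ 2 ⊛ λ-poly ms₁

recurrence-cong : ∀ {b ms ms₁ ms₂ ms′ ms₁′ ms₂′} → ms ≡ ms′ → ms₁ ≡ ms₁′ → ms₂ ≡ ms₂′ →
                  Recurrence b ms ms₁ ms₂ → Recurrence b ms′ ms₁′ ms₂′
recurrence-cong refl refl refl rec = rec

module Recursion (k : ℕ) (js : List ℕ) where
  private
    t = lastSide above k js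

    S : ℕ → List Side
    S c = before above k js ++ flip t ∷ replicate c t

  params : ℕ → List ℕ
  params c = map suc (k ∷ js) ++ c ∷ []

  private
    sides≡ : ∀ c → sidesFrom above (params c) ≡ S c
    sides≡ = sidesFrom-before above k js

    Λ : ℕ → Poly
    Λ c = maskedCount (S c , faceMask (before above k js) t c)

    λ-params : ∀ c → map suc (k ∷ (js ++ c ∷ [])) ≡ params (suc c)
    λ-params c = List.map-++ suc (k ∷ js) (c ∷ [])

    λ-masked : ∀ c → λ-poly (map suc (k ∷ (js ++ c ∷ []))) ≗ maskedCount (sidesOf above k (js ++ c ∷ []) , maskOf above k (js ++ c ∷ []))
    λ-masked c = λ-poly-masked above k (js ++ c ∷ [])

    λ≡ : ∀ c → λ-poly (params (suc c)) ≗ Λ (suc c)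
    λ≡ c = subst₂ (λ ms M → λ-poly ms ≗ maskedCount M) (λ-params c) (sidesOf-before above k js c) (λ-masked c)

  private
    ranks : ∀ c i → rankCount (S (suc (suc c))) i ≡ 4 * shift 1 (rankCount (S (suc c))) i + rankCount (S (suc c)) i
      + 2 ^ (4 + c) * shift 2 (λ-poly (params (suc c))) i + 16 * shift 2 (rankCount (S c)) i
    ranks c i = subst (λ l → rankCount (S (suc (suc c))) i ≡ 4 * shift 1 (rankCount (S (suc c))) i + rankCount (S (suc c)) i
        + 2 ^ (4 + c) * l + 16 * shift 2 (rankCount (S c)) i)
      (shift-cong 2 {Λ (suc c)} {λ-poly (params (suc c))} (λ k → sym (λ≡ c k)) i)
      (rankCount-recursion (before above k js) t c i)

    ℰ-params : ∀ c T → ℰ (H (params c)) T ≗ λ i → 2 * rankCount (S c) i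
    ℰ-params c = ℰ-H (params c) (sides≡ c)

  -- The indices b₁ and b₂ are variables since unfolding λ-poly and ℰ to compare them is too expensive.
  recursion : ∀ {b b₁ b₂} c → b ≡ suc (suc c) → b₁ ≡ suc c → b₂ ≡ c → Recurrence b (params b) (params b₁) (params b₂)
  recursion c refl refl refl T T₁ T₂ = combine c (ℰ (H (params (suc (suc c)))) T) (ℰ (H (params (suc c))) T₁)
    (ℰ (H (params c)) T₂) (λ-poly (params (suc c))) (rankCount (S (suc c))) (rankCount (S c))
    (ℰ-params (suc c) T₁) (ℰ-params c T₂) (λ i → trans (ℰ-params (suc (suc c)) T i) (cong (2 *_) (ranks c i)))

recurrence : ∀ m ms a → ∃ (λ js → m ∷ ms ≡ map suc js) → ∀ b → 2 ≤ b →
  Recurrence b (m ∷ ms ++ suc a ∷ b ∷ []) (m ∷ ms ++ suc a ∷ (b ∸ 1) ∷ []) (m ∷ ms ++ suc a ∷ (b ∸ 2) ∷ [])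
recurrence m ms a (k ∷ ks , ms≡) b 2≤b = recurrence-cong {b} (params≡ b) (params≡ (b ∸ 1)) (params≡ (b ∸ 2))
    (recursion {b} {b ∸ 1} {b ∸ 2} (b ∸ 2) (b≡ 2≤b) (b∸1≡ 2≤b) refl)
  where
  open Recursion k (ks ++ a ∷ [])
  params≡ : ∀ c → params c ≡ m ∷ ms ++ suc a ∷ c ∷ []
  params≡ c = trans (cong (_++ c ∷ []) (trans (List.map-++ suc (k ∷ ks) (a ∷ [])) (cong (_++ suc a ∷ []) (sym ms≡))))
    (List.++-assoc (m ∷ ms) (suc a ∷ []) (c ∷ []))
  b≡ : ∀ {b} → 2 ≤ b → b ≡ suc (suc (b ∸ 2))
  b≡ (s≤s (s≤s _)) = refl
  b∸1≡ : ∀ {b} → 2 ≤ b → b ∸ 1 ≡ suc (b ∸ 2)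
  b∸1≡ (s≤s (s≤s _)) = refl

ℰ-same-sides : ∀ ms ms′ → sidesFrom above ms ≡ sidesFrom above ms′ → ∀ T T′ → ℰ (H ms) T ≗ ℰ (H ms′) T′
ℰ-same-sides ms ms′ eq T T′ i = trans (ℰ-H ms eq T i) (sym (ℰ-H ms′ refl T′ i))

ℰ-last-flipped : ∀ ms ms′ → (∃ λ S → ∃ λ t → sidesFrom above ms ≡ S ++ t ∷ [] × sidesFrom above ms′ ≡ S ++ flip t ∷ []) →
                 ∀ T T′ → ℰ (H ms) T ≗ ℰ (H ms′) T′
ℰ-last-flipped ms ms′ (S , t , eq , eq′) T T′ i =
  trans (ℰ-H ms eq T i) (trans (cong (2 *_) (rankCount-flip S t i)) (sym (ℰ-H ms′ eq′ T′ i)))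

theorem3p4 : (ms : List ℕ) (a : ℕ) → 3 ≤ length ms + 2 → All (1 ≤_) ms → 1 ≤ a →
    ((b : ℕ) → 2 ≤ b →
    (T  : SpanningTree (H (ms ++ a ∷ b ∷ [])))
    (T₁ : SpanningTree (H (ms ++ a ∷ (b ∸ 1) ∷ [])))
    (T₂ : SpanningTree (H (ms ++ a ∷ (b ∸ 2) ∷ []))) →
    ℰ (H (ms ++ a ∷ b ∷ [])) T
    ≗ (1 ·z^ 0 ⊕ 4 ·z^ 1) ⊛ ℰ (H (ms ++ a ∷ (b ∸ 1) ∷ [])) T₁
    ⊕ 16 ·z^ 2 ⊛ ℰ (H (ms ++ a ∷ (b ∸ 2) ∷ [])) T₂
    ⊕ (2 ^ (b + 3)) ·z^ 2 ⊛ λ-poly (ms ++ a ∷ (b ∸ 1) ∷ []))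
    × ((T  : SpanningTree (H (ms ++ a ∷ 0 ∷ [])))
    (T′ : SpanningTree (H (ms ++ (a + 1) ∷ []))) →
    ℰ (H (ms ++ a ∷ 0 ∷ [])) T ≗ ℰ (H (ms ++ (a + 1) ∷ [])) T′)
    × ((T  : SpanningTree (H (ms ++ a ∷ 1 ∷ [])))
    (T′ : SpanningTree (H (ms ++ (a + 2) ∷ []))) →
    ℰ (H (ms ++ a ∷ 1 ∷ [])) T ≗ ℰ (H (ms ++ (a + 2) ∷ [])) T′)
theorem3p4 []       a (s≤s (s≤s ())) _ _
theorem3p4 (m ∷ ms) (suc a) _ ps _ = recurrence m ms a (positive ps)
  , ℰ-same-sides (m ∷ ms ++ suc a ∷ 0 ∷ []) (m ∷ ms ++ (suc a + 1) ∷ []) (sidesFrom-zero above m ms (suc a))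
  , ℰ-last-flipped (m ∷ ms ++ suc a ∷ 1 ∷ []) (m ∷ ms ++ (suc a + 2) ∷ []) (sidesFrom-one above m ms (suc a))
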